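{- The Tutte polynomial $T:\mathcal{M}\to\mathbb{Z}[x,y]$ is valuatively universal within the class of elementary split matroids.
   Context: All matroids have ground set $[n]=\{1,\dots,n\}$ for some $n\geq 0$; $\mathcal{M}_{n,k}$ denotes the set of matroids on $[n]$ of rank $k$ and $\mathcal{M}$ the disjoint union of all $\mathcal{M}_{n,k}$. The base polytope $\mathscr{P}(\mathsf{M})\subseteq\mathbb{R}^n$ is the convex hull of the indicator vectors of the bases of $\mathsf{M}$. For an abelian group $A$, a map $f:\mathcal{M}_{n,k}\to A$ is valuative if $\sum_i a_i f(\mathsf{M}_i)=0$ whenever $a_i\in\mathbb{Z}$ and $\sum_i a_i\mathbb{1}_{\mathscr{P}(\mathsf{M}_i)}$ is identically zero on $\mathbb{R}^n$. A valuative invariant $f:\mathcal{M}\to A$ is valuative on each $\mathcal{M}_{n,k}$ and isomorphism invariant. The Tutte polynomial $T_{\mathsf{M}}(x,y)=\sum_{S\subseteq E}(x-1)^{\operatorname{rk}E-\operatorname{rk}S}(y-1)^{|S|-\operatorname{rk}S}$ is a valuative invariant $\mathcal{M}\to\mathbb{Z}[x,y]$. For a class $\mathcal{C}$ let $\mathcal{C}_{n,k}=\mathcal{C}\cap\mathcal{M}_{n,k}$. A valuative invariant $u:\mathcal{M}\to A$ is valuatively universal within $\mathcal{C}$ if for every abelian group $A'$, every valuative invariant $f:\mathcal{M}\to A'$ and every pair $(n,k)$ there is a group homomorphism $\widehat{f}_{n,k}:A\to A'$ with $f(\mathsf{M})=\widehat{f}_{n,k}(u(\mathsf{M}))$ for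 all $\mathsf{M}\in\mathcal{C}_{n,k}$. A matroid is elementary split if it has no minor isomorphic to $\mathsf{U}_{0,1}\oplus\mathsf{U}_{1,2}\oplus\mathsf{U}_{1,1}$ (equivalently, its proper cyclic flats form a clutter), where $\mathsf{U}_{k,n}$ is the uniform matroid.
   Formalization: In the definition of valuative, the indicator sum is required to vanish at all points of ℚⁿ (polytope membership via rational convex coefficients) instead of ℝⁿ; since base polytopes are rational, this is equivalent. -}

module Defs where

open import Level using (Level; 0ℓ; Setω)
open import Data.Bool using (Bool; true; false; if_then_else_; _∧_)
open import Data.Nat as ℕ using (ℕ; zero; suc; _∸_; _⊔_)
open import Data.Integer as ℤ using (ℤ; +_; -[1+_])
import Data.Integer.Properties as ℤP
import Data.List.Properties as LP
open import Data.Rational as ℚ using (ℚ; 0ℚ; 1ℚ)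
open import Data.Fin using (Fin)
open import Data.Fin.Subset as Sub using (Subset; inside; outside; ⁅_⁆; ⋃; ∣_∣; _∩_; _∪_; ∁)
open import Data.Vec as Vec using (Vec; []; _∷_; _[_]≔_)
open import Data.List as List using (List; []; _∷_; _++_; map; concat; concatMap; foldr; length; zipWith; allFin)
open import Data.List.Membership.Propositional using () renaming (_∈_ to _∈ᴸ_)
open import Data.List.Relation.Unary.All using (All)
open import Data.List.Relation.Binary.Pointwise using (Pointwise)
open import Data.Product using (Σ; ∃; ∃-syntax; _×_; _,_; proj₁; proj₂)
open import Relation.Nullary using (¬_; does)
open import Relation.Binary.PropositionalEquality
open import Function using (Injective)
open import Function.Bundles using (_⇔_; _↔_; Inverse)
open import Algebra.Bundles using (AbelianGroup; RawGroup)
open import Algebra.Structures using (IsAbelianGroup)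
open import Algebra.Morphism.Structures using (module GroupMorphisms)

_∈ˢ_ : ∀ {n} → Fin n → Subset n → Set
_∈ˢ_ = Sub._∈_

_∉ˢ_ : ∀ {n} → Fin n → Subset n → Set
_∉ˢ_ = Sub._∉_

record Matroid (n : ℕ) : Set where
  field
    bases    : List (Subset n)
    nonempty : ∃[ B ] (B ∈ᴸ bases)
    exchange : ∀ B₁ B₂ → B₁ ∈ᴸ bases → B₂ ∈ᴸ bases →
               ∀ x → x ∈ˢ B₁ → x ∉ˢ B₂ →
               ∃[ y ] (y ∈ˢ B₂ × y ∉ˢ B₁ × (((B₁ [ x ]≔ outside) [ y ]≔ inside) ∈ᴸ bases))
open Matroid public

IsBase : ∀ {n} → Matroid n → Subset n → Set
IsBase M B = B ∈ᴸ bases M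

maxℕ : List ℕ → ℕ
maxℕ = foldr _⊔_ 0

rk : ∀ {n} → Matroid n → Subset n → ℕ
rk M S = maxℕ (map (λ B → ∣ B ∩ S ∣) (bases M))

rank : ∀ {n} → Matroid n → ℕ
rank {n} M = rk M Sub.⊤

allSubsets : ∀ n → List (Subset n)
allSubsets zero    = [] ∷ []
allSubsets (suc n) = map (outside ∷_) (allSubsets n) ++ map (inside ∷_) (allSubsets n)

image : ∀ {m n} → (Fin m → Fin n) → Subset m → Subset n
image {m} ι X = ⋃ (map (λ i → if Vec.lookup X i then ⁅ ι i ⁆ else Sub.⊥) (allFin m))

Iso : ∀ {n} → Matroid n → Matroid n → Set
Iso {n} M N = Σ (Fin n ↔ Fin n) λ σ →
  ∀ B → IsBase M B ⇔ IsBase N (image (Inverse.to σ) B)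

sumℚ : List ℚ → ℚ
sumℚ = foldr ℚ._+_ 0ℚ

_∈P_ : ∀ {n} → (Fin n → ℚ) → Matroid n → Set
x ∈P M = Σ (List ℚ) λ λs →
    length λs ≡ length (bases M)
  × All (ℚ._≤_ 0ℚ) λs
  × sumℚ λs ≡ 1ℚ
  × (∀ j → sumℚ (zipWith (λ l B → if Vec.lookup B j then l else 0ℚ) λs (bases M)) ≡ x j)

sumℤ : List ℤ → ℤ
sumℤ = foldr ℤ._+_ (+ 0)

-- Σ_i a_i 1_{P(M_i)} vanishes identically (at all points of ℚ^n).
-- The boolean list bs records the values 1_{P(M_i)}(x).
IndicatorsCancel : ∀ {n} → List (ℤ × Matroid n) → Set
IndicatorsCancel {n} xs =
  ∀ (x : Fin n → ℚ) (bs : List Bool) →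
  Pointwise (λ b aM → (b ≡ true) ⇔ (x ∈P proj₂ aM)) bs xs →
  sumℤ (zipWith (λ b aM → if b then proj₁ aM else + 0) bs xs) ≡ + 0

module _ {c ℓ : Level} (A : AbelianGroup c ℓ) where
  open AbelianGroup A

  _×ₙ_ : ℕ → Carrier → Carrier
  zero  ×ₙ a = ε
  suc k ×ₙ a = a ∙ (k ×ₙ a)

  _·_ : ℤ → Carrier → Carrier
  (+ k)      · a = k ×ₙ a
  (-[1+ k ]) · a = (suc k ×ₙ a) ⁻¹

  sumA : List Carrier → Carrier
  sumA = foldr _∙_ ε

  IsValuativeOn : (∀ {n} → Matroid n → Carrier) → ℕ → ℕ → Set ℓ
  IsValuativeOn f n k = ∀ (xs : List (ℤ × Matroid n)) →
    All (λ aM → rank (proj₂ aM) ≡ k) xs →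
    IndicatorsCancel xs →
    sumA (map (λ aM → proj₁ aM · f (proj₂ aM)) xs) ≈ ε

  IsValuativeInvariant : (∀ {n} → Matroid n → Carrier) → Set ℓ
  IsValuativeInvariant f =
      (∀ n k → IsValuativeOn f n k)
    × (∀ {n} (M N : Matroid n) → Iso M N → f M ≈ f N)

record IsValuativelyUniversalWithin
  {c ℓ} (A : AbelianGroup c ℓ) (u : ∀ {n} → Matroid n → AbelianGroup.Carrier A)
  (C : ∀ {n} → Matroid n → Set) : Setω where
  field
    valuative : IsValuativeInvariant A u
    universal :
      ∀ {c' ℓ'} (A' : AbelianGroup c' ℓ') (f : ∀ {n} → Matroid n → AbelianGroup.Carrier A') →
      IsValuativeInvariant A' f →
      ∀ n k → Σ (AbelianGroup.Carrier A → AbelianGroup.Carrier A') λ φ →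
        GroupMorphisms.IsGroupHomomorphism (AbelianGroup.rawGroup A) (AbelianGroup.rawGroup A') φ
      × (∀ (M : Matroid n) → C M → rank M ≡ k → AbelianGroup._≈_ A' (f M) (φ (u M)))

-- ℤ[x,y] : finite lists of terms (i , j , c) meaning c·x^i·y^j,
-- identified when all coefficients agree.

Poly : Set
Poly = List (ℕ × ℕ × ℤ)

termCoeff : ℕ → ℕ → ℤ → ℕ → ℕ → ℤ
termCoeff a b c i j = if does (a ℕ.≟ i) ∧ does (b ℕ.≟ j) then c else + 0

coeff : Poly → ℕ → ℕ → ℤ
coeff []                  i j = + 0
coeff ((a , b , c) ∷ p)   i j = termCoeff a b c i j ℤ.+ coeff p i j

_≈ₚ_ : Poly → Poly → Set
p ≈ₚ q = ∀ i j → coeff p i j ≡ coeff q i j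

negₚ : Poly → Poly
negₚ = map (λ { (a , b , c) → (a , b , ℤ.- c) })

mulₚ : Poly → Poly → Poly
mulₚ p q = concatMap (λ { (a , b , c) → map (λ { (a' , b' , c') → (a ℕ.+ a' , b ℕ.+ b' , c ℤ.* c') }) q }) p

powₚ : Poly → ℕ → Poly
powₚ p zero    = (0 , 0 , + 1) ∷ []
powₚ p (suc k) = mulₚ p (powₚ p k)

private
  coeff-++ : ∀ p q i j → coeff (p ++ q) i j ≡ coeff p i j ℤ.+ coeff q i j
  coeff-++ [] q i j = sym (ℤP.+-identityˡ (coeff q i j))
  coeff-++ ((a , b , c) ∷ p) q i j =
    trans (cong (λ t → termCoeff a b c i j ℤ.+ t) (coeff-++ p q i j))
          (sym (ℤP.+-assoc (termCoeff a b c i j) (coeff p i j) (coeff q i j)))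

  neg-if : ∀ (t : Bool) c → (if t then ℤ.- c else + 0) ≡ ℤ.- (if t then c else + 0)
  neg-if true  c = refl
  neg-if false c = refl

  coeff-neg : ∀ p i j → coeff (negₚ p) i j ≡ ℤ.- coeff p i j
  coeff-neg [] i j = refl
  coeff-neg ((a , b , c) ∷ p) i j =
    trans (cong₂ ℤ._+_ (neg-if (does (a ℕ.≟ i) ∧ does (b ℕ.≟ j)) c) (coeff-neg p i j))
          (sym (ℤP.neg-distrib-+ (termCoeff a b c i j) (coeff p i j)))

ℤ[x,y] : AbelianGroup 0ℓ 0ℓ
ℤ[x,y] = record
  { Carrier = Poly
  ; _≈_ = _≈ₚ_
  ; _∙_ = _++_
  ; ε = []
  ; _⁻¹ = negₚ
  ; isAbelianGroup = record
    { isGroup = record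
      { isMonoid = record
        { isSemigroup = record
          { isMagma = record
            { isEquivalence = record
              { refl = λ i j → refl
              ; sym = λ e i j → sym (e i j)
              ; trans = λ e f i j → trans (e i j) (f i j) }
            ; ∙-cong = λ {p} {p'} {q} {q'} e f i j →
                trans (coeff-++ p q i j) (trans (cong₂ ℤ._+_ (e i j) (f i j)) (sym (coeff-++ p' q' i j))) }
          ; assoc = λ p q r i j → cong (λ s → coeff s i j) (LP.++-assoc p q r) }
        ; identity = (λ p i j → refl) , (λ p i j → cong (λ s → coeff s i j) (LP.++-identityʳ p)) }
      ; inverse = (λ p i j → trans (coeff-++ (negₚ p) p i j)
                      (trans (cong (λ t → t ℤ.+ coeff p i j) (coeff-neg p i j)) (ℤP.+-inverseˡ (coeff p i j))))
                , (λ p i j → trans (coeff-++ p (negₚ p) i j)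
                      (trans (cong (λ t → coeff p i j ℤ.+ t) (coeff-neg p i j)) (ℤP.+-inverseʳ (coeff p i j))))
      ; ⁻¹-cong = λ {p} {q} e i j → trans (coeff-neg p i j) (trans (cong ℤ.-_ (e i j)) (sym (coeff-neg q i j))) }
    ; comm = λ p q i j → trans (coeff-++ p q i j) (trans (ℤP.+-comm (coeff p i j) (coeff q i j)) (sym (coeff-++ q p i j))) } }

x-1 : Poly
x-1 = (1 , 0 , + 1) ∷ (0 , 0 , -[1+ 0 ]) ∷ []

y-1 : Poly
y-1 = (0 , 1 , + 1) ∷ (0 , 0 , -[1+ 0 ]) ∷ []

tutte : ∀ {n} → Matroid n → Poly
tutte {n} M = concat (map (λ S → mulₚ (powₚ x-1 (rank M ∸ rk M S)) (powₚ y-1 (∣ S ∣ ∸ rk M S))) (allSubsets n))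

uniformBases : ℕ → (n : ℕ) → List (Subset n)
uniformBases k n = List.filter (λ S → ∣ S ∣ ℕ.≟ k) (allSubsets n)

U-bases : ℕ → (n : ℕ) → List (Subset n)
U-bases = uniformBases

_⊕ᴮ_ : ∀ {m n} → List (Subset m) → List (Subset n) → List (Subset (m ℕ.+ n))
Bs ⊕ᴮ Cs = concatMap (λ B → map (λ C → B Vec.++ C) Cs) Bs

-- Y is a basis of M \ D / C  (Y ⊆ E − (C ∪ D), independent in M/C and spanning in M\D/C)
MinorBase : ∀ {n} → Matroid n → Subset n → Subset n → Subset n → Set
MinorBase M C D Y =
    (∀ e → e ∈ˢ Y → e ∉ˢ C × e ∉ˢ D)
  × rk M (Y ∪ C) ≡ rk M C ℕ.+ ∣ Y ∣
  × rk M (Y ∪ C) ≡ rk M (∁ D)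

-- M has a minor (M \ D / C for disjoint C, D) isomorphic to the matroid on [m]
-- with list of bases Ns; ι identifies [m] with E − (C ∪ D).
HasMinorIsoTo : ∀ {n m} → Matroid n → List (Subset m) → Set
HasMinorIsoTo {n} {m} M Ns =
  Σ (Subset n) λ C → Σ (Subset n) λ D → Σ (Fin m → Fin n) λ ι →
    (∀ e → e ∈ˢ C → e ∉ˢ D)
  × Injective _≡_ _≡_ ι
  × (∀ i → ι i ∉ˢ C × ι i ∉ˢ D)
  × (∀ e → e ∉ˢ C → e ∉ˢ D → ∃[ i ] (ι i ≡ e))
  × (∀ X → (X ∈ᴸ Ns) ⇔ MinorBase M C D (image ι X))

forbiddenBases : List (Subset 4)
forbiddenBases = (U-bases 0 1 ⊕ᴮ U-bases 1 2) ⊕ᴮ U-bases 1 1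

ElementarySplit : ∀ {n} → Matroid n → Set
ElementarySplit M = ¬ HasMinorIsoTo M forbiddenBases

{-# OPTIONS --safe #-}
-- Let 𝓕 be the proper cyclic flats of an elementary split matroid M of rank k on [n].  They form a
-- clutter, so |F ∩ G| + k ≤ rk F + rk G for distinct F, G ∈ 𝓕.  Hence P(M) is the hypersimplex cut by
-- the inequalities x(F) ≤ rk F, no two of which fail at the same point, and every valuative invariant f
-- satisfies
--     f(M) = f(U_{k,n}) − Σ_{F ∈ 𝓕} (f(Λ_F) − f(U_{rk F,F} ⊕ U_{k−rk F,E∖F})),
-- where Λ_F has as bases the k-sets B with |B ∩ F| ≥ rk F.  By isomorphism invariance the summand
-- depends only on rk F and |F|.  On the other side, the Tutte polynomial determines linearly the number
-- of subsets of given rank and size.  A set S with rk S < min(|S|, k) satisfies rk S = rk F + |S ∖ F|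
-- for exactly one F ∈ 𝓕, so these numbers are a unitriangular transform of the numbers of flats in 𝓕
-- of given rank and size; inverting it expresses f(M) through T_M.
--
-- The Tutte polynomial is valuative because rk S ≥ r holds exactly when the slice {x ∈ P(M) : x(S) ≥ r}
-- is nonempty, and nonemptiness (the Euler characteristic) is additive on indicator functions of
-- polyhedra: coordinates are eliminated one at a time, and a cancelling combination of closed intervals
-- has coefficient sum zero.

module Submission where

open import Level using (Level)
open import Algebra.Bundles using (AbelianGroup; CommutativeMonoid)
open import Algebra.Morphism.Structures using (module GroupMorphisms)
import Algebra.Properties.AbelianGroup as AbelianGroupProperties
import Algebra.Properties.CommutativeSemigroup as CommutativeSemigroupProperties
open import Data.Bool as Bool using (Bool; true; false; if_then_else_; _∧_)
open import Data.Fin as Fin using (Fin; zero; suc)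
import Data.Fin.Properties as FP
import Data.Fin.Permutation as Perm
open import Data.Fin.Subset as Sub using (Subset; inside; outside; ⁅_⁆; ⋃; ∣_∣; _∩_; _∪_; ∁; _∈_; _∉_; _⊆_)
import Data.Fin.Subset.Properties as SP
open import Data.Integer as ℤ using (ℤ; -[1+_]; 0ℤ; 1ℤ) renaming (+_ to pos)
import Data.Integer.Properties as ℤP
open import Data.List as List using (List; []; _∷_; _++_; map; concat; concatMap; length; zipWith; allFin; filter)
import Data.List.Properties as LP
open import Data.List.Membership.Propositional using () renaming (_∈_ to _∈ᴸ_)
import Data.List.Membership.Propositional.Properties as MP
open import Data.List.Membership.Propositional.Properties.WithK using (unique∧set⇒bag)
open import Data.List.Relation.Binary.BagAndSetEquality using (∼bag⇒↭)
open import Data.List.Relation.Binary.Permutation.Propositional using (_↭_; ↭⇒↭ₛ)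
import Data.List.Relation.Binary.Permutation.Setoid.Properties as PermP
open import Data.List.Relation.Binary.Pointwise using (Pointwise; []; _∷_)
open import Data.List.Relation.Unary.All as All using (All; []; _∷_)
import Data.List.Relation.Unary.All.Properties as AllP
import Data.List.Relation.Unary.Any.Properties as AnyP
open import Data.List.Relation.Unary.AllPairs using ([]; _∷_)
open import Data.List.Relation.Unary.Any as Any using (Any; here; there)
open import Data.List.Relation.Unary.Unique.Propositional using (Unique)
import Data.List.Relation.Unary.Unique.Propositional.Properties as UP
open import Data.Nat
open import Data.Nat.Properties
open import Data.Nat.Tactic.RingSolver using (solve-∀)
open import Data.Product using (Σ; ∃; ∃-syntax; _×_; _,_; proj₁; proj₂)
open import Data.Rational as ℚ using (ℚ; 0ℚ; 1ℚ)
import Data.Rational.Properties as ℚP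
open import Data.Sum using (_⊎_; inj₁; inj₂; [_,_]′)
open import Data.Vec as Vec using (Vec; []; _∷_; _[_]≔_; lookup)
import Data.Vec.Properties as VP
open import Function using (_∘_; id; Injective; _⇔_; mk⇔; _↔_; Inverse; Equivalence)
open import Relation.Binary using (DecidableEquality; tri<; tri≈; tri>)
open import Relation.Binary.PropositionalEquality using (_≡_; _≢_; refl; sym; trans; cong; cong₂; subst; subst₂; module ≡-Reasoning) renaming (setoid to ≡-setoid)
import Relation.Binary.Reasoning.Setoid as SetoidReasoning
open import Relation.Nullary using (¬_; Dec; yes; no; does; contradiction)
open import Relation.Nullary.Decidable using (_×-dec_; _→-dec_; ¬?; map′; dec⇒maybe)
import Tactic.RingSolver as RingSolver
open import Tactic.RingSolver.Core.AlmostCommutativeRing using (fromCommutativeRing)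

open import Defs

-- `IndicatorsCancel` concerns rational points whose weights merely exist, so the polyhedral
-- arguments use elimination of variables and no topology. The polytopes and the vertex weights lie
-- in the nonnegative orthant, hence every nonempty fibre met during elimination is an interval with
-- a least element. The same elimination, applied to the vertex weights, makes membership in P(M)
-- decidable.
--
-- The bound |F ∩ G| + k ≤ rk F + rk G comes from submodularity: the clutter property forces F ∩ G
-- to be independent and F ∪ G to be spanning. It serves twice, for x(F) + x(G) on the hypersimplex
-- and for the sets S attached to a flat.
--
-- The target group is arbitrary, so the inversion is carried out on the dual side: instead of
-- recovering numbers of flats, one solves for weights of pairs (rank, size) whose sum over the sets
-- attached to a flat is the prescribed defect. The diagonal coefficient, from S = F, is 1, so no
-- division occurs, and the weights depend only on f, n and k, as a homomorphism common to all M
-- requires.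

-- Finite sums with integer weights in an abelian group

module AbelianSums {c ℓ : Level} (A : AbelianGroup c ℓ) where
  open AbelianGroup A using (Carrier; _≈_; _∙_; ε; _⁻¹; setoid; ∙-cong; ∙-congˡ; ∙-congʳ; identityˡ; identityʳ; assoc; comm; ⁻¹-cong; inverseʳ; commutativeMonoid)
    renaming (refl to ≈-refl; sym to ≈-sym; trans to ≈-trans; reflexive to ≈-reflexive)
  open AbelianGroupProperties A using (ε⁻¹≈ε; ⁻¹-involutive; ⁻¹-∙-comm)
  open CommutativeSemigroupProperties (CommutativeMonoid.commutativeSemigroup commutativeMonoid) using (interchange)
  open SetoidReasoning setoid

  infixr 8 _•_
  _•_ : ℤ → Carrier → Carrier
  _•_ = _·_ A

  ∑ : ∀ {x} {X : Set x} → List X → (X → Carrier) → Carrier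
  ∑ xs f = sumA A (map f xs)

  ×-distribʳ : ∀ m n x → _×ₙ_ A (m + n) x ≈ _×ₙ_ A m x ∙ _×ₙ_ A n x
  ×-distribʳ zero    n x = ≈-sym (identityˡ _)
  ×-distribʳ (suc m) n x = ≈-trans (∙-congˡ (×-distribʳ m n x)) (≈-sym (assoc _ _ _))

  ×-cong : ∀ m {x y} → x ≈ y → _×ₙ_ A m x ≈ _×ₙ_ A m y
  ×-cong zero    e = ≈-refl
  ×-cong (suc m) e = ∙-cong e (×-cong m e)

  ×-distribˡ : ∀ m x y → _×ₙ_ A m (x ∙ y) ≈ _×ₙ_ A m x ∙ _×ₙ_ A m y
  ×-distribˡ zero    x y = ≈-sym (identityˡ _)
  ×-distribˡ (suc m) x y = ≈-trans (∙-congˡ (×-distribˡ m x y)) (interchange x y _ _)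

  ×-ε : ∀ m → _×ₙ_ A m ε ≈ ε
  ×-ε zero    = ≈-refl
  ×-ε (suc m) = ≈-trans (identityˡ _) (×-ε m)

  •-cong : ∀ a {x y} → x ≈ y → a • x ≈ a • y
  •-cong (pos m)      e = ×-cong m e
  •-cong (-[1+ m ]) e = ⁻¹-cong (×-cong (suc m) e)

  •-ε : ∀ a → a • ε ≈ ε
  •-ε (pos m)      = ×-ε m
  •-ε (-[1+ m ]) = ≈-trans (⁻¹-cong (×-ε (suc m))) ε⁻¹≈ε

  •-distribˡ : ∀ a x y → a • (x ∙ y) ≈ a • x ∙ a • y
  •-distribˡ (pos m)      x y = ×-distribˡ m x y
  •-distribˡ (-[1+ m ]) x y = ≈-trans (⁻¹-cong (×-distribˡ (suc m) x y)) (≈-sym (⁻¹-∙-comm _ _))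

  •-neg : ∀ a x → (ℤ.- a) • x ≈ (a • x) ⁻¹
  •-neg (pos zero)   x = ≈-sym ε⁻¹≈ε
  •-neg (pos (suc m))  x = ≈-refl
  •-neg (-[1+ m ]) x = ≈-sym (⁻¹-involutive _)

  ⊖-• : ∀ m n x → (m ℤ.⊖ n) • x ≈ _×ₙ_ A m x ∙ (_×ₙ_ A n x) ⁻¹
  ⊖-• m zero x = ≈-sym (≈-trans (∙-congˡ ε⁻¹≈ε) (identityʳ _))
  ⊖-• zero (suc n) x = ≈-sym (identityˡ _)
  ⊖-• (suc m) (suc n) x = begin
    (suc m ℤ.⊖ suc n) • x                                       ≡⟨ cong (_• x) (ℤP.[1+m]⊖[1+n]≡m⊖n m n) ⟩
    (m ℤ.⊖ n) • x                                               ≈⟨ ⊖-• m n x ⟩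
    _×ₙ_ A m x ∙ (_×ₙ_ A n x) ⁻¹                                ≈⟨ identityˡ _ ⟨
    ε ∙ (_×ₙ_ A m x ∙ (_×ₙ_ A n x) ⁻¹)                          ≈⟨ ∙-congʳ (inverseʳ x) ⟨
    (x ∙ x ⁻¹) ∙ (_×ₙ_ A m x ∙ (_×ₙ_ A n x) ⁻¹)                 ≈⟨ interchange x (x ⁻¹) _ _ ⟩
    (x ∙ _×ₙ_ A m x) ∙ (x ⁻¹ ∙ (_×ₙ_ A n x) ⁻¹)                 ≈⟨ ∙-congˡ (⁻¹-∙-comm _ _) ⟩
    (x ∙ _×ₙ_ A m x) ∙ (x ∙ _×ₙ_ A n x) ⁻¹                      ∎

  •-distribʳ : ∀ a b x → (a ℤ.+ b) • x ≈ a • x ∙ b • x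
  •-distribʳ (pos m)      (pos n)      x = ×-distribʳ m n x
  •-distribʳ (pos m)      (-[1+ n ]) x = ⊖-• m (suc n) x
  •-distribʳ (-[1+ m ]) (pos n)      x = ≈-trans (⊖-• n (suc m) x) (comm _ _)
  •-distribʳ (-[1+ m ]) (-[1+ n ]) x = begin
    _×ₙ_ A (suc (suc (m + n))) x ⁻¹           ≡⟨ cong (λ k → _×ₙ_ A k x ⁻¹) (cong suc (sym (+-suc m n))) ⟩
    _×ₙ_ A (suc m + suc n) x ⁻¹               ≈⟨ ⁻¹-cong (×-distribʳ (suc m) (suc n) x) ⟩
    (_×ₙ_ A (suc m) x ∙ _×ₙ_ A (suc n) x) ⁻¹  ≈⟨ ⁻¹-∙-comm _ _ ⟨
    -[1+ m ] • x ∙ -[1+ n ] • x               ∎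

  •-assoc-+ : ∀ m b x → (pos m ℤ.* b) • x ≈ _×ₙ_ A m (b • x)
  •-assoc-+ zero    b x = ≈-reflexive (cong (_• x) (ℤP.*-zeroˡ b))
  •-assoc-+ (suc m) b x = begin
    (pos (suc m) ℤ.* b) • x          ≡⟨ cong (_• x) (ℤP.suc-* (pos m) b) ⟩
    (b ℤ.+ pos m ℤ.* b) • x        ≈⟨ •-distribʳ b (pos m ℤ.* b) x ⟩
    b • x ∙ (pos m ℤ.* b) • x      ≈⟨ ∙-congˡ (•-assoc-+ m b x) ⟩
    b • x ∙ _×ₙ_ A m (b • x)     ∎

  •-assoc : ∀ a b x → (a ℤ.* b) • x ≈ a • (b • x)
  •-assoc (pos m)      b x = •-assoc-+ m b x
  •-assoc (-[1+ m ]) b x = begin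
    (-[1+ m ] ℤ.* b) • x           ≡⟨ cong (_• x) (ℤP.neg-distribˡ-* (pos (suc m)) b) ⟨
    (ℤ.- (pos (suc m) ℤ.* b)) • x      ≈⟨ •-neg (pos (suc m) ℤ.* b) x ⟩
    ((pos (suc m) ℤ.* b) • x) ⁻¹       ≈⟨ ⁻¹-cong (•-assoc-+ (suc m) b x) ⟩
    -[1+ m ] • (b • x)             ∎

  ∑-cong-∈ : ∀ {x} {X : Set x} (xs : List X) {f g : X → Carrier} → (∀ {x} → x ∈ᴸ xs → f x ≈ g x) → ∑ xs f ≈ ∑ xs g
  ∑-cong-∈ []       e = ≈-refl
  ∑-cong-∈ (x ∷ xs) e = ∙-cong (e (here refl)) (∑-cong-∈ xs (e ∘ there))

  ∑-cong : ∀ {x} {X : Set x} (xs : List X) {f g : X → Carrier} → (∀ x → f x ≈ g x) → ∑ xs f ≈ ∑ xs g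
  ∑-cong xs e = ∑-cong-∈ xs (λ {x} _ → e x)

  ∑-ε : ∀ {x} {X : Set x} (xs : List X) {f : X → Carrier} → (∀ {x} → x ∈ᴸ xs → f x ≈ ε) → ∑ xs f ≈ ε
  ∑-ε []       e = ≈-refl
  ∑-ε (x ∷ xs) e = ≈-trans (∙-cong (e (here refl)) (∑-ε xs (e ∘ there))) (identityˡ ε)

  ∑-∙ : ∀ {x} {X : Set x} (xs : List X) (f g : X → Carrier) → ∑ xs (λ x → f x ∙ g x) ≈ ∑ xs f ∙ ∑ xs g
  ∑-∙ []       f g = ≈-sym (identityˡ ε)
  ∑-∙ (x ∷ xs) f g = ≈-trans (∙-congˡ (∑-∙ xs f g)) (interchange _ _ _ _)

  ∑-• : ∀ {x} {X : Set x} a (xs : List X) (f : X → Carrier) → a • ∑ xs f ≈ ∑ xs (λ x → a • f x)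
  ∑-• a []       f = •-ε a
  ∑-• a (x ∷ xs) f = ≈-trans (•-distribˡ a _ _) (∙-congˡ (∑-• a xs f))

  ∑-⁻¹ : ∀ {x} {X : Set x} (xs : List X) (f : X → Carrier) → ∑ xs f ⁻¹ ≈ ∑ xs (λ x → f x ⁻¹)
  ∑-⁻¹ []       f = ε⁻¹≈ε
  ∑-⁻¹ (x ∷ xs) f = ≈-trans (≈-sym (⁻¹-∙-comm _ _)) (∙-congˡ (∑-⁻¹ xs f))

  ∑-swap : ∀ {x y} {X : Set x} {Y : Set y} (xs : List X) (ys : List Y) (f : X → Y → Carrier) →
           ∑ xs (λ x → ∑ ys (f x)) ≈ ∑ ys (λ y → ∑ xs (λ x → f x y))
  ∑-swap []       ys f = ≈-sym (∑-ε ys (λ _ → ≈-refl))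
  ∑-swap (x ∷ xs) ys f = ≈-trans (∙-congˡ (∑-swap xs ys f)) (≈-sym (∑-∙ ys (f x) _))

  ∑-map : ∀ {x y} {X : Set x} {Y : Set y} (g : X → Y) (xs : List X) (f : Y → Carrier) → ∑ (map g xs) f ≡ ∑ xs (f ∘ g)
  ∑-map g xs f = cong (sumA A) (sym (LP.map-∘ xs))

  ∑-↭ : ∀ {x} {X : Set x} {xs ys : List X} → xs ↭ ys → ∀ f → ∑ xs f ≈ ∑ ys f
  ∑-↭ p f = PermP.foldr-commMonoid setoid (CommutativeMonoid.isCommutativeMonoid commutativeMonoid)
    (PermP.map⁺ (≡-setoid _) setoid (λ e → ≈-reflexive (cong f e)) (↭⇒↭ₛ p))

  ∑-sole : ∀ {X : Set} (_≟_ : DecidableEquality X) {xs : List X} → Unique xs → ∀ {x} → x ∈ᴸ xs → (f : X → Carrier) →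
           (∀ {y} → y ∈ᴸ xs → y ≢ x → f y ≈ ε) → ∑ xs f ≈ f x
  ∑-sole _≟_ (x∉xs ∷ uniq) (here refl) f z =
    ≈-trans (∙-congˡ (∑-ε _ (λ y∈ → z (there y∈) (λ eq → All.lookup x∉xs y∈ (sym eq))))) (identityʳ _)
  ∑-sole _≟_ (x∉xs ∷ uniq) (there x∈) f z =
    ≈-trans (∙-cong (z (here refl) (All.lookup x∉xs x∈)) (∑-sole _≟_ uniq x∈ f (z ∘ there))) (identityˡ _)

  private
    •-split : (t : Bool) (a : ℤ) (x : Carrier) → a • x ≈ (if t then a else 0ℤ) • x ∙ (if t then 0ℤ else a) • x
    •-split true  a x = ≈-sym (identityʳ _)
    •-split false a x = ≈-sym (identityˡ _)

  -- Values of ρ are removed one at a time by zeroing the weights of their fibres.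
  ∑-fibres : ∀ {x} {X : Set x} {R : Set} (_≟_ : DecidableEquality R) (xs : List X) (a : X → ℤ) (ρ : X → R) (h : R → Carrier) →
             (∀ r → sumℤ (map (λ x → if does (ρ x ≟ r) then a x else 0ℤ) xs) ≡ 0ℤ) →
             ∑ xs (λ x → a x • h (ρ x)) ≈ ε
  ∑-fibres {X = X} {R} _≟_ xs a₀ ρ h fib₀ = go (map ρ xs) a₀ fib₀ (λ x∈ → inj₂ (MP.∈-map⁺ ρ x∈))
    where
    sum-• : ∀ (ys : List X) (b : X → ℤ) y → ∑ ys (λ x → b x • y) ≈ sumℤ (map b ys) • y
    sum-• []       b y = ≈-refl
    sum-• (z ∷ ys) b y = ≈-trans (∙-congˡ (sum-• ys b y)) (≈-sym (•-distribʳ (b z) (sumℤ (map b ys)) y))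

    go : ∀ (rs : List R) (a : X → ℤ) → (∀ r → sumℤ (map (λ x → if does (ρ x ≟ r) then a x else 0ℤ) xs) ≡ 0ℤ) →
         (∀ {x} → x ∈ᴸ xs → a x ≡ 0ℤ ⊎ ρ x ∈ᴸ rs) → ∑ xs (λ x → a x • h (ρ x)) ≈ ε
    go [] a fib cov = ∑-ε xs λ x∈ → [ (λ e → ≈-reflexive (cong (_• _) e)) , (λ ()) ]′ (cov x∈)
    go (r ∷ rs) a fib cov = begin
      ∑ xs (λ x → a x • h (ρ x))                                             ≈⟨ ∑-cong xs (λ x → •-split (does (ρ x ≟ r)) (a x) _) ⟩
      ∑ xs (λ x → hit x • h (ρ x) ∙ miss x • h (ρ x))                        ≈⟨ ∑-∙ xs _ _ ⟩
      ∑ xs (λ x → hit x • h (ρ x)) ∙ ∑ xs (λ x → miss x • h (ρ x))           ≈⟨ ∙-cong (∑-cong xs hit-r) (go rs miss fib′ cov′) ⟩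
      ∑ xs (λ x → hit x • h r) ∙ ε                                           ≈⟨ identityʳ _ ⟩
      ∑ xs (λ x → hit x • h r)                                               ≈⟨ sum-• xs hit (h r) ⟩
      sumℤ (map hit xs) • h r                                                ≡⟨ cong (_• h r) (fib r) ⟩
      ε                                                                      ∎
      where
      hit miss : X → ℤ
      hit  x = if does (ρ x ≟ r) then a x else 0ℤ
      miss x = if does (ρ x ≟ r) then 0ℤ else a x

      hit-r : ∀ x → hit x • h (ρ x) ≈ hit x • h r
      hit-r x with ρ x ≟ r
      ... | yes refl = ≈-refl
      ... | no _     = ≈-refl

      cov′ : ∀ {x} → x ∈ᴸ xs → miss x ≡ 0ℤ ⊎ ρ x ∈ᴸ rs
      cov′ {x} x∈ with ρ x ≟ r
      ... | yes _  = inj₁ refl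
      ... | no neq with cov x∈
      ...   | inj₁ e          = inj₁ e
      ...   | inj₂ (here e)   = contradiction e neq
      ...   | inj₂ (there r∈) = inj₂ r∈

      fib′ : ∀ r′ → sumℤ (map (λ x → if does (ρ x ≟ r′) then miss x else 0ℤ) xs) ≡ 0ℤ
      fib′ r′ with r ≟ r′
      ... | yes refl = trans (cong sumℤ (LP.map-cong zero-hit xs)) (all-zero xs)
        where
        zero-hit : ∀ x → (if does (ρ x ≟ r) then miss x else 0ℤ) ≡ 0ℤ
        zero-hit x with ρ x ≟ r
        ... | yes _ = refl
        ... | no _  = refl
        all-zero : ∀ (ys : List X) → sumℤ (map (λ _ → 0ℤ) ys) ≡ 0ℤ
        all-zero []       = refl
        all-zero (_ ∷ ys) = trans (ℤP.+-identityˡ _) (all-zero ys)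
      ... | no r≢r′ = trans (cong sumℤ (LP.map-cong same xs)) (fib r′)
        where
        same : ∀ x → (if does (ρ x ≟ r′) then miss x else 0ℤ) ≡ (if does (ρ x ≟ r′) then a x else 0ℤ)
        same x with ρ x ≟ r′ | ρ x ≟ r
        ... | yes refl | yes e = contradiction (sym e) r≢r′
        ... | yes refl | no _  = refl
        ... | no _     | _     = refl

-- Finite subsets

insert delete : ∀ {n} → Subset n → Fin n → Subset n
insert S e = S [ e ]≔ inside
delete S e = S [ e ]≔ outside

exchangeAt : ∀ {n} → Subset n → Fin n → Fin n → Subset n
exchangeAt B x y = insert (delete B x) y

weight : ∀ {n} → Subset n → Fin n → ℕ
weight T x = if lookup T x then 1 else 0

∈⇒lookup : ∀ {n} {S : Subset n} {x} → x ∈ S → lookup S x ≡ inside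
∈⇒lookup = VP.[]=⇒lookup

lookup⇒∈ : ∀ {n} {S : Subset n} {x} → lookup S x ≡ inside → x ∈ S
lookup⇒∈ {S = S} {x} = VP.lookup⇒[]= x S

∉⇒lookup : ∀ {n} {S : Subset n} {x} → x ∉ S → lookup S x ≡ outside
∉⇒lookup {S = S} {x} x∉ with lookup S x in e
... | true  = contradiction (lookup⇒∈ e) x∉
... | false = refl

weight-∈ : ∀ {n} {T : Subset n} {x} → x ∈ T → weight T x ≡ 1
weight-∈ x∈ = cong (if_then 1 else 0) (∈⇒lookup x∈)

weight-∉ : ∀ {n} {T : Subset n} {x} → x ∉ T → weight T x ≡ 0
weight-∉ x∉ = cong (if_then 1 else 0) (∉⇒lookup x∉)

weight-cases : ∀ {n} (T : Subset n) x → (x ∈ T × weight T x ≡ 1) ⊎ (x ∉ T × weight T x ≡ 0)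
weight-cases T x with x SP.∈? T
... | yes x∈ = inj₁ (x∈ , weight-∈ x∈)
... | no  x∉ = inj₂ (x∉ , weight-∉ x∉)

∈-insert : ∀ {n} (S : Subset n) e → e ∈ insert S e
∈-insert S e = lookup⇒∈ (VP.lookup∘update e S inside)

⊆-insert : ∀ {n} (S : Subset n) e → S ⊆ insert S e
⊆-insert S e {x} x∈ with x Fin.≟ e
... | yes refl = ∈-insert S e
... | no  x≢e  = lookup⇒∈ (trans (VP.lookup∘update′ x≢e S inside) (∈⇒lookup x∈))

∈-insert⁻ : ∀ {n} (S : Subset n) e {x} → x ∈ insert S e → x ≡ e ⊎ x ∈ S
∈-insert⁻ S e {x} x∈ with x Fin.≟ e
... | yes x≡e = inj₁ x≡e
... | no  x≢e = inj₂ (lookup⇒∈ (trans (sym (VP.lookup∘update′ x≢e S inside)) (∈⇒lookup x∈)))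

insert-⊆ : ∀ {n} {S T : Subset n} {e} → S ⊆ T → e ∈ T → insert S e ⊆ T
insert-⊆ {S = S} {e = e} S⊆T e∈T x∈ with ∈-insert⁻ S e x∈
... | inj₁ refl = e∈T
... | inj₂ x∈S  = S⊆T x∈S

insert-mono : ∀ {n} {S T : Subset n} {e} → S ⊆ T → insert S e ⊆ insert T e
insert-mono {T = T} {e} S⊆T = insert-⊆ (λ x∈ → ⊆-insert T e (S⊆T x∈)) (∈-insert T e)

∈-delete⁻ : ∀ {n} (S : Subset n) e {x} → x ∈ delete S e → x ∈ S × x ≢ e
∈-delete⁻ S e {x} x∈ with x Fin.≟ e
... | yes refl with () ← trans (sym (∈⇒lookup x∈)) (VP.lookup∘update e S outside)
... | no  x≢e  = lookup⇒∈ (trans (sym (VP.lookup∘update′ x≢e S outside)) (∈⇒lookup x∈)) , x≢e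

∈-delete : ∀ {n} (S : Subset n) e {x} → x ∈ S → x ≢ e → x ∈ delete S e
∈-delete S e x∈ x≢e = lookup⇒∈ (trans (VP.lookup∘update′ x≢e S outside) (∈⇒lookup x∈))

delete-⊆ : ∀ {n} (S : Subset n) e → delete S e ⊆ S
delete-⊆ S e x∈ = proj₁ (∈-delete⁻ S e x∈)

∉-delete : ∀ {n} (S : Subset n) e → e ∉ delete S e
∉-delete S e e∈ = proj₂ (∈-delete⁻ S e e∈) refl

⊆-insert-delete : ∀ {n} (S : Subset n) e → S ⊆ insert (delete S e) e
⊆-insert-delete S e {x} x∈ with x Fin.≟ e
... | yes refl = ∈-insert (delete S e) e
... | no  x≢e  = ⊆-insert (delete S e) e (∈-delete S e x∈ x≢e)

∣insert∣∩ : ∀ {n} (B T : Subset n) {y} → y ∉ B → ∣ insert B y ∩ T ∣ ≡ weight T y + ∣ B ∩ T ∣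
∣insert∣∩ (true  ∷ B) (t ∷ T)     {zero} y∉ = contradiction Vec.here y∉
∣insert∣∩ (false ∷ B) (true ∷ T)  {zero} y∉ = refl
∣insert∣∩ (false ∷ B) (false ∷ T) {zero} y∉ = refl
∣insert∣∩ (b ∷ B) (t ∷ T) {suc y} y∉ with b ∧ t
... | true  = trans (cong suc (∣insert∣∩ B T (y∉ ∘ Vec.there))) (sym (+-suc _ _))
... | false = ∣insert∣∩ B T (y∉ ∘ Vec.there)

∣delete∣∩ : ∀ {n} (B T : Subset n) {x} → x ∈ B → weight T x + ∣ delete B x ∩ T ∣ ≡ ∣ B ∩ T ∣
∣delete∣∩ (true ∷ B) (true ∷ T)  Vec.here = refl
∣delete∣∩ (true ∷ B) (false ∷ T) Vec.here = refl
∣delete∣∩ (b ∷ B) (t ∷ T) (Vec.there x∈) with b ∧ t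
... | true  = trans (+-suc _ _) (cong suc (∣delete∣∩ B T x∈))
... | false = ∣delete∣∩ B T x∈

-- Both weights are added rather than subtracted, so that one equation covers all positions of `x`
-- and `y` relative to `T` without truncated subtraction.
∣exchangeAt∣∩ : ∀ {n} (B T : Subset n) {x y} → x ∈ B → y ∉ B →
                weight T x + ∣ exchangeAt B x y ∩ T ∣ ≡ weight T y + ∣ B ∩ T ∣
∣exchangeAt∣∩ B T {x} {y} x∈ y∉ = begin
  weight T x + ∣ exchangeAt B x y ∩ T ∣             ≡⟨ cong (_ +_) (∣insert∣∩ (delete B x) T (y∉ ∘ delete-⊆ B x)) ⟩
  weight T x + (weight T y + ∣ delete B x ∩ T ∣)    ≡⟨ rearrange (weight T x) (weight T y) _ ⟩
  weight T y + (weight T x + ∣ delete B x ∩ T ∣)    ≡⟨ cong (_ +_) (∣delete∣∩ B T x∈) ⟩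
  weight T y + ∣ B ∩ T ∣                            ∎
  where
  open ≡-Reasoning
  rearrange : ∀ a b c → a + (b + c) ≡ b + (a + c)
  rearrange = solve-∀

∣∩⊤∣ : ∀ {n} (B : Subset n) → ∣ B ∩ Sub.⊤ ∣ ≡ ∣ B ∣
∣∩⊤∣ B = cong ∣_∣ (SP.∩-identityʳ B)

∣exchangeAt∣ : ∀ {n} (B : Subset n) {x y} → x ∈ B → y ∉ B → ∣ exchangeAt B x y ∣ ≡ ∣ B ∣
∣exchangeAt∣ {n} B {x} {y} x∈ y∉ = trans (sym (∣∩⊤∣ (exchangeAt B x y))) (trans
  (+-cancelˡ-≡ 1 _ _ (subst₂ (λ a b → a + ∣ exchangeAt B x y ∩ Sub.⊤ ∣ ≡ b + ∣ B ∩ Sub.⊤ ∣)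
    (weight-∈ {x = x} SP.∈⊤) (weight-∈ {x = y} SP.∈⊤) (∣exchangeAt∣∩ B Sub.⊤ x∈ y∉)))
  (∣∩⊤∣ B))

∣∩∁∣ : ∀ {n} (B F : Subset n) → ∣ B ∩ F ∣ + ∣ B ∩ ∁ F ∣ ≡ ∣ B ∣
∣∩∁∣ []          []          = refl
∣∩∁∣ (true ∷ B)  (true ∷ F)  = cong suc (∣∩∁∣ B F)
∣∩∁∣ (true ∷ B)  (false ∷ F) = trans (+-suc _ _) (cong suc (∣∩∁∣ B F))
∣∩∁∣ (false ∷ B) (_ ∷ F)     = ∣∩∁∣ B F

∣∩∪∣+∣∩∩∣ : ∀ {n} (X A B : Subset n) → ∣ X ∩ (A ∪ B) ∣ + ∣ X ∩ (A ∩ B) ∣ ≡ ∣ X ∩ A ∣ + ∣ X ∩ B ∣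
∣∩∪∣+∣∩∩∣ []          []          []          = refl
∣∩∪∣+∣∩∩∣ (false ∷ X) (_ ∷ A)     (_ ∷ B)     = ∣∩∪∣+∣∩∩∣ X A B
∣∩∪∣+∣∩∩∣ (true ∷ X)  (true ∷ A)  (true ∷ B)  = cong suc (trans (+-suc _ _) (trans (cong suc (∣∩∪∣+∣∩∩∣ X A B)) (sym (+-suc _ _))))
∣∩∪∣+∣∩∩∣ (true ∷ X)  (true ∷ A)  (false ∷ B) = cong suc (∣∩∪∣+∣∩∩∣ X A B)
∣∩∪∣+∣∩∩∣ (true ∷ X)  (false ∷ A) (true ∷ B)  = trans (cong suc (∣∩∪∣+∣∩∩∣ X A B)) (sym (+-suc _ _))
∣∩∪∣+∣∩∩∣ (true ∷ X)  (false ∷ A) (false ∷ B) = ∣∩∪∣+∣∩∩∣ X A B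

∣<∣⇒∃ : ∀ {n} (A B : Subset n) → ∣ A ∣ < ∣ B ∣ → ∃[ y ] (y ∈ B × y ∉ A)
∣<∣⇒∃ A B lt with FP.any? (λ y → (y SP.∈? B) ×-dec ¬? (y SP.∈? A))
... | yes w = w
... | no none = contradiction (SP.p⊆q⇒∣p∣≤∣q∣ B⊆A) (<⇒≱ lt)
  where
  B⊆A : B ⊆ A
  B⊆A {x} x∈ with x SP.∈? A
  ... | yes x∈A = x∈A
  ... | no x∉A = contradiction (x , x∈ , x∉A) none

∣∩<∩∣⇒∃ : ∀ {n} (A B T : Subset n) → ∣ A ∩ T ∣ < ∣ B ∩ T ∣ → ∃[ y ] (y ∈ B × y ∉ A × y ∈ T)
∣∩<∩∣⇒∃ A B T lt with ∣<∣⇒∃ (A ∩ T) (B ∩ T) lt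
... | y , y∈ , y∉ with SP.x∈p∩q⁻ B T y∈
...   | y∈B , y∈T = y , y∈B , (λ y∈A → y∉ (SP.x∈p∩q⁺ (y∈A , y∈T))) , y∈T

∣∩∣-monoˡ : ∀ {n} {A B : Subset n} (T : Subset n) → A ⊆ B → ∣ A ∩ T ∣ ≤ ∣ B ∩ T ∣
∣∩∣-monoˡ {A = A} T A⊆B = SP.p⊆q⇒∣p∣≤∣q∣ λ x∈ → let (x∈A , x∈T) = SP.x∈p∩q⁻ A T x∈ in SP.x∈p∩q⁺ (A⊆B x∈A , x∈T)

∣∩∣-monoʳ : ∀ {n} (B : Subset n) {S T : Subset n} → S ⊆ T → ∣ B ∩ S ∣ ≤ ∣ B ∩ T ∣
∣∩∣-monoʳ B {S} S⊆T = SP.p⊆q⇒∣p∣≤∣q∣ λ x∈ → let (x∈B , x∈S) = SP.x∈p∩q⁻ B S x∈ in SP.x∈p∩q⁺ (x∈B , S⊆T x∈S)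

∣∩∣≤∣∩∣+∣∩∁∣ : ∀ {n} (B T S : Subset n) → ∣ B ∩ T ∣ ≤ ∣ B ∩ S ∣ + ∣ T ∩ ∁ S ∣
∣∩∣≤∣∩∣+∣∩∁∣ B T S = ≤-trans (≤-reflexive (sym (∣∩∁∣ (B ∩ T) S)))
  (+-mono-≤ (∣∩∣-monoˡ S (SP.p∩q⊆p B T)) (∣∩∣-monoˡ (∁ S) (SP.p∩q⊆q B T)))

∣∩∣≡∣∣⇒⊆ : ∀ {n} (A B : Subset n) → ∣ A ∣ ≤ ∣ A ∩ B ∣ → A ⊆ B
∣∩∣≡∣∣⇒⊆ A B le {x} x∈ with x SP.∈? B
... | yes x∈B = x∈B
... | no  x∉B = contradiction le (<⇒≱ (SP.p⊂q⇒∣p∣<∣q∣ (SP.p∩q⊆p A B , x , x∈ , λ x∈∩ → x∉B (proj₂ (SP.x∈p∩q⁻ A B x∈∩)))))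

⊆∧∣≤∣⇒≡ : ∀ {n} {A B : Subset n} → A ⊆ B → ∣ B ∣ ≤ ∣ A ∣ → A ≡ B
⊆∧∣≤∣⇒≡ {A = A} {B} A⊆B le = SP.⊆-antisym A⊆B
  (∣∩∣≡∣∣⇒⊆ B A (≤-trans le (SP.p⊆q⇒∣p∣≤∣q∣ λ x∈ → SP.x∈p∩q⁺ (A⊆B x∈ , x∈))))

∈⇒0<∣∣ : ∀ {n} {A : Subset n} {x} → x ∈ A → 0 < ∣ A ∣
∈⇒0<∣∣ {A = A} {x} x∈ = ≤-trans (≤-reflexive (sym (SP.∣⁅x⁆∣≡1 x)))
  (SP.p⊆q⇒∣p∣≤∣q∣ λ {y} y∈ → subst (_∈ A) (sym (SP.x∈⁅y⁆⇒x≡y x y∈)) x∈)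

∣∁insert∣ : ∀ {n} {F : Subset n} {e} → e ∉ F → ∣ ∁ (insert F e) ∣ < ∣ ∁ F ∣
∣∁insert∣ {F = F} {e} e∉ = SP.p⊂q⇒∣p∣<∣q∣
  ( (λ x∈ → SP.x∉p⇒x∈∁p λ x∈F → SP.x∈∁p⇒x∉p x∈ (⊆-insert F e x∈F))
  , e , SP.x∉p⇒x∈∁p e∉ , λ e∈∁ → SP.x∈∁p⇒x∉p e∈∁ (∈-insert F e))

-- Rank functions

maxℕ-upper : ∀ {X : Set} (f : X → ℕ) {xs : List X} {x} → x ∈ᴸ xs → f x ≤ maxℕ (map f xs)
maxℕ-upper f (here refl) = m≤m⊔n _ _
maxℕ-upper f (there x∈)  = ≤-trans (maxℕ-upper f x∈) (m≤n⊔m _ _)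

maxℕ-attained : ∀ {X : Set} (f : X → ℕ) {xs : List X} {x} → x ∈ᴸ xs → ∃[ y ] (y ∈ᴸ xs × f y ≡ maxℕ (map f xs))
maxℕ-attained f {x ∷ []}     x∈ = x , here refl , sym (⊔-identityʳ (f x))
maxℕ-attained f {x ∷ y ∷ xs} x∈ with maxℕ-attained f {y ∷ xs} (here refl) | ⊔-sel (f x) (maxℕ (map f (y ∷ xs)))
... | _            | inj₁ e = x , here refl , sym e
... | z , z∈ , z≡  | inj₂ e = z , there z∈ , trans z≡ (sym e)

rk-upper : ∀ {n} (M : Matroid n) S {B} → IsBase M B → ∣ B ∩ S ∣ ≤ rk M S
rk-upper M S = maxℕ-upper (λ B → ∣ B ∩ S ∣)

rk-attained : ∀ {n} (M : Matroid n) S → ∃[ B ] (IsBase M B × ∣ B ∩ S ∣ ≡ rk M S)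
rk-attained M S = maxℕ-attained (λ B → ∣ B ∩ S ∣) (proj₂ (nonempty M))

rk-unique : ∀ {n} (M : Matroid n) S {m} → (∀ {B} → IsBase M B → ∣ B ∩ S ∣ ≤ m) → ∃[ B ] (IsBase M B × m ≤ ∣ B ∩ S ∣) → rk M S ≡ m
rk-unique M S upper (B , B∈ , le) with rk-attained M S
... | B′ , B′∈ , e = ≤-antisym (subst (_≤ _) e (upper B′∈)) (≤-trans le (rk-upper M S B∈))

module _ {n : ℕ} (M : Matroid n) where
  open ≤-Reasoning

  private
    ∣exchange∖∣ : ∀ (B₁ B₂ : Subset n) {x y} → x ∈ B₁ → x ∉ B₂ → y ∈ B₂ → y ∉ B₁ →
                  suc ∣ exchangeAt B₁ x y ∩ ∁ B₂ ∣ ≡ ∣ B₁ ∩ ∁ B₂ ∣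
    ∣exchange∖∣ B₁ B₂ {x} {y} x∈ x∉ y∈ y∉ =
      subst₂ (λ a b → a + ∣ exchangeAt B₁ x y ∩ ∁ B₂ ∣ ≡ b + ∣ B₁ ∩ ∁ B₂ ∣)
        (weight-∈ (SP.x∉p⇒x∈∁p x∉)) (weight-∉ (λ y∈∁ → SP.x∈∁p⇒x∉p y∈∁ y∈)) (∣exchangeAt∣∩ B₁ (∁ B₂) x∈ y∉)

    0<∣∖∣ : ∀ {B₁ B₂ : Subset n} {x} → x ∈ B₁ → x ∉ B₂ → 0 < ∣ B₁ ∩ ∁ B₂ ∣
    0<∣∖∣ x∈ x∉ = ∈⇒0<∣∣ (SP.x∈p∩q⁺ (x∈ , SP.x∉p⇒x∈∁p x∉))

    -- Each exchange moves `B₁` one element closer to `B₂` without changing its size; the fuel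
    -- bounds |B₁ ∖ B₂|. Once `B₁` lies in `B₂`, an element of `B₂` outside `B₁` would have nothing
    -- to be exchanged with.
    bases-equicardinal′ : ∀ m {B₁ B₂ : Subset n} → ∣ B₁ ∩ ∁ B₂ ∣ ≤ m → IsBase M B₁ → IsBase M B₂ → ∣ B₁ ∣ ≡ ∣ B₂ ∣
    bases-equicardinal′ m {B₁} {B₂} le B₁∈ B₂∈ with FP.any? (λ y → (y SP.∈? B₁) ×-dec ¬? (y SP.∈? B₂))
    bases-equicardinal′ zero le B₁∈ B₂∈ | yes (x , x∈ , x∉) = contradiction le (<⇒≱ (0<∣∖∣ x∈ x∉))
    bases-equicardinal′ (suc m) {B₁} {B₂} le B₁∈ B₂∈ | yes (x , x∈ , x∉) with exchange M B₁ B₂ B₁∈ B₂∈ x x∈ x∉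
    ... | y , y∈ , y∉ , B∈ = trans (sym (∣exchangeAt∣ B₁ x∈ y∉))
      (bases-equicardinal′ m (≤-pred (subst (_≤ suc m) (sym (∣exchange∖∣ B₁ B₂ x∈ x∉ y∈ y∉)) le)) B∈ B₂∈)
    bases-equicardinal′ m {B₁} {B₂} le B₁∈ B₂∈ | no B₁⊆B₂ with <-cmp ∣ B₁ ∣ ∣ B₂ ∣
    ... | tri≈ _ e _ = e
    ... | tri> _ _ gt = contradiction (∣<∣⇒∃ B₂ B₁ gt) B₁⊆B₂
    ... | tri< lt _ _ with ∣<∣⇒∃ B₁ B₂ lt
    ...   | x , x∈ , x∉ with exchange M B₂ B₁ B₂∈ B₁∈ x x∈ x∉
    ...     | y , y∈ , y∉ , _ = contradiction (y , y∈ , y∉) B₁⊆B₂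

  bases-equicardinal : ∀ {B₁ B₂} → IsBase M B₁ → IsBase M B₂ → ∣ B₁ ∣ ≡ ∣ B₂ ∣
  bases-equicardinal = bases-equicardinal′ _ ≤-refl

  ∣base∣≡rank : ∀ {B} → IsBase M B → ∣ B ∣ ≡ rank M
  ∣base∣≡rank {B} B∈ with rk-attained M Sub.⊤
  ... | B′ , B′∈ , e = trans (bases-equicardinal B∈ B′∈) (trans (sym (∣∩⊤∣ B′)) e)

  private
    -- If `B₂` has more elements in `T`, equal cardinality gives an element of `B₁ ∖ B₂` outside
    -- `T`. Exchanging it keeps `B₁ ∩ T` and brings `B₁` closer to `B₂`.
    extend-within′ : ∀ m T {B₁ B₂ : Subset n} → ∣ B₁ ∩ ∁ B₂ ∣ ≤ m → IsBase M B₁ → IsBase M B₂ →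
                     ∃[ B ] (IsBase M B × (B₁ ∩ T ⊆ B) × ∣ B₂ ∩ T ∣ ≤ ∣ B ∩ T ∣)
    extend-within′ m T {B₁} {B₂} le B₁∈ B₂∈ with ∣ B₂ ∩ T ∣ ≤? ∣ B₁ ∩ T ∣
    ... | yes done = B₁ , B₁∈ , SP.p∩q⊆p B₁ T , done
    ... | no ¬done with ∣∩<∩∣⇒∃ B₂ B₁ (∁ T) more-outside
      where
      more-outside : ∣ B₂ ∩ ∁ T ∣ < ∣ B₁ ∩ ∁ T ∣
      more-outside = +-cancelˡ-< (∣ B₁ ∩ T ∣) _ _ (begin-strict
        ∣ B₁ ∩ T ∣ + ∣ B₂ ∩ ∁ T ∣  <⟨ +-monoˡ-< _ (≰⇒> ¬done) ⟩
        ∣ B₂ ∩ T ∣ + ∣ B₂ ∩ ∁ T ∣  ≡⟨ ∣∩∁∣ B₂ T ⟩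
        ∣ B₂ ∣                     ≡⟨ bases-equicardinal B₂∈ B₁∈ ⟩
        ∣ B₁ ∣                     ≡⟨ ∣∩∁∣ B₁ T ⟨
        ∣ B₁ ∩ T ∣ + ∣ B₁ ∩ ∁ T ∣  ∎)
    extend-within′ zero T {B₁} {B₂} le B₁∈ B₂∈ | no _ | x , x∈ , x∉ , x∉T = contradiction le (<⇒≱ (0<∣∖∣ x∈ x∉))
    extend-within′ (suc m) T {B₁} {B₂} le B₁∈ B₂∈ | no _ | x , x∈ , x∉ , x∉T with exchange M B₁ B₂ B₁∈ B₂∈ x x∈ x∉
    ... | y , y∈ , y∉ , B₁′∈ with extend-within′ m T (≤-pred (subst (_≤ suc m) (sym (∣exchange∖∣ B₁ B₂ x∈ x∉ y∈ y∉)) le)) B₁′∈ B₂∈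
    ...   | B , B∈ , ⊆B , le′ = B , B∈ , (λ z∈ → let (z∈B₁ , z∈T) = SP.x∈p∩q⁻ B₁ T z∈ in
              ⊆B (SP.x∈p∩q⁺ (⊆-insert (delete B₁ x) y (∈-delete B₁ x z∈B₁ λ { refl → SP.x∈∁p⇒x∉p x∉T z∈T }) , z∈T))) , le′

  extend-within : ∀ T {B₁ B₂} → IsBase M B₁ → IsBase M B₂ →
                  ∃[ B ] (IsBase M B × (B₁ ∩ T ⊆ B) × ∣ B₂ ∩ T ∣ ≤ ∣ B ∩ T ∣)
  extend-within T = extend-within′ _ T ≤-refl

  -- A basis optimal for `S` is made optimal for `T` without losing its elements in `S`. Counting
  -- such a common basis on an intersection and a union gives submodularity.
  rk-attained-nested : ∀ {S T} → S ⊆ T → ∃[ B ] (IsBase M B × rk M S ≤ ∣ B ∩ S ∣ × rk M T ≤ ∣ B ∩ T ∣)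
  rk-attained-nested {S} {T} S⊆T with rk-attained M S | rk-attained M T
  ... | B₁ , B₁∈ , e₁ | B₂ , B₂∈ , e₂ with extend-within T B₁∈ B₂∈
  ...   | B , B∈ , ⊆B , le = B , B∈ ,
    ≤-trans (≤-reflexive (sym e₁)) (SP.p⊆q⇒∣p∣≤∣q∣ λ x∈ → let (x∈B₁ , x∈S) = SP.x∈p∩q⁻ B₁ S x∈ in
      SP.x∈p∩q⁺ (⊆B (SP.x∈p∩q⁺ (x∈B₁ , S⊆T x∈S)) , x∈S)) ,
    ≤-trans (≤-reflexive (sym e₂)) le

  rk-mono : ∀ {S T} → S ⊆ T → rk M S ≤ rk M T
  rk-mono {S} {T} S⊆T with rk-attained M S
  ... | B , B∈ , e = subst (_≤ rk M T) e (≤-trans (∣∩∣-monoʳ B S⊆T) (rk-upper M T B∈))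

  rk≤rank : ∀ S → rk M S ≤ rank M
  rk≤rank S = rk-mono SP.⊆⊤

  rk≤∣∣ : ∀ S → rk M S ≤ ∣ S ∣
  rk≤∣∣ S with rk-attained M S
  ... | B , B∈ , e = subst (_≤ ∣ S ∣) e (SP.∣p∩q∣≤∣q∣ B S)

  rk-submodular : ∀ A B → rk M (A ∪ B) + rk M (A ∩ B) ≤ rk M A + rk M B
  rk-submodular A B with rk-attained-nested {A ∩ B} {A ∪ B} (λ x∈ → SP.p⊆p∪q B (SP.p∩q⊆p A B x∈))
  ... | X , X∈ , ∩≤ , ∪≤ = begin
    rk M (A ∪ B) + rk M (A ∩ B)             ≤⟨ +-mono-≤ ∪≤ ∩≤ ⟩
    ∣ X ∩ (A ∪ B) ∣ + ∣ X ∩ (A ∩ B) ∣       ≡⟨ ∣∩∪∣+∣∩∩∣ X A B ⟩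
    ∣ X ∩ A ∣ + ∣ X ∩ B ∣                   ≤⟨ +-mono-≤ (rk-upper M A X∈) (rk-upper M B X∈) ⟩
    rk M A + rk M B                         ∎

  rk≤rk+∣∖∣ : ∀ T S → rk M T ≤ rk M S + ∣ T ∩ ∁ S ∣
  rk≤rk+∣∖∣ T S with rk-attained M T
  ... | B , B∈ , e = subst (_≤ _) e (≤-trans (∣∩∣≤∣∩∣+∣∩∁∣ B T S) (+-monoˡ-≤ _ (rk-upper M S B∈)))

  rk-insert-≤ : ∀ S e → rk M (insert S e) ≤ suc (rk M S)
  rk-insert-≤ S e with rk-attained M (insert S e)
  ... | B , B∈ , eq = subst (_≤ _) eq (begin
    ∣ B ∩ insert S e ∣                                    ≤⟨ ∣∩∣≤∣∩∣+∣∩∁∣ B (insert S e) S ⟩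
    ∣ B ∩ S ∣ + ∣ insert S e ∩ ∁ S ∣                      ≤⟨ +-mono-≤ (rk-upper M S B∈) (SP.p⊆q⇒∣p∣≤∣q∣ only-e) ⟩
    rk M S + ∣ ⁅ e ⁆ ∣                                    ≡⟨ cong (rk M S +_) (SP.∣⁅x⁆∣≡1 e) ⟩
    rk M S + 1                                            ≡⟨ +-comm (rk M S) 1 ⟩
    suc (rk M S)                                          ∎)
    where
    only-e : insert S e ∩ ∁ S ⊆ ⁅ e ⁆
    only-e x∈ with SP.x∈p∩q⁻ (insert S e) (∁ S) x∈
    ... | x∈ins , x∉S with ∈-insert⁻ S e x∈ins
    ...   | inj₁ refl = SP.x∈⁅x⁆ e
    ...   | inj₂ x∈S  = contradiction x∈S (SP.x∈∁p⇒x∉p x∉S)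

  -- The inequality `rk M (insert X e) ≤ rk M X` is the form in which "`e` lies in the closure of
  -- `X`" is used throughout. Monotonicity of closure is submodularity of `rk` at `insert X e` and
  -- `Y`.
  spans-mono : ∀ {X Y e} → X ⊆ Y → rk M (insert X e) ≤ rk M X → rk M (insert Y e) ≤ rk M Y
  spans-mono {X} {Y} {e} X⊆Y le = +-cancelʳ-≤ (rk M X) _ _ (begin
    rk M (insert Y e) + rk M X                           ≤⟨ +-mono-≤ (rk-mono (insert-⊆ (SP.q⊆p∪q (insert X e) Y) (SP.p⊆p∪q Y (∈-insert X e))))
                                                                     (rk-mono λ x∈ → SP.x∈p∩q⁺ (⊆-insert X e x∈ , X⊆Y x∈)) ⟩
    rk M (insert X e ∪ Y) + rk M (insert X e ∩ Y)        ≤⟨ rk-submodular (insert X e) Y ⟩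
    rk M (insert X e) + rk M Y                           ≤⟨ +-monoˡ-≤ _ le ⟩
    rk M X + rk M Y                                      ≡⟨ +-comm (rk M X) _ ⟩
    rk M Y + rk M X                                      ∎)

  independent-spanning⇒base : ∀ {B} → ∣ B ∣ ≡ rank M → rank M ≤ rk M B → IsBase M B
  independent-spanning⇒base {B} card le with rk-attained M B
  ... | B′ , B′∈ , e = subst (IsBase M) (⊆∧∣≤∣⇒≡ (∣∩∣≡∣∣⇒⊆ B′ B (begin
      ∣ B′ ∣     ≡⟨ ∣base∣≡rank B′∈ ⟩
      rank M     ≤⟨ le ⟩
      rk M B     ≡⟨ e ⟨
      ∣ B′ ∩ B ∣ ∎)) (≤-reflexive (trans card (sym (∣base∣≡rank B′∈))))) B′∈

-- Images of subsets

image-∷ : ∀ {m n} (ι : Fin (suc m) → Fin n) x (X : Subset m) →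
          image ι (x ∷ X) ≡ (if x then ⁅ ι zero ⁆ else Sub.⊥) ∪ image (ι ∘ suc) X
image-∷ {m} {n} ι x X = cong (λ Ys → (if x then ⁅ ι zero ⁆ else Sub.⊥) ∪ ⋃ Ys)
  (trans (LP.map-tabulate {n = m} suc part) (sym (LP.map-tabulate {n = m} id (part ∘ suc))))
  where
  part : Fin (suc m) → Subset n
  part i = if lookup (x ∷ X) i then ⁅ ι i ⁆ else Sub.⊥

∈-image : ∀ {m n} (ι : Fin m → Fin n) (X : Subset m) {i} → i ∈ X → ι i ∈ image ι X
∈-image ι (true ∷ X) Vec.here = subst (ι zero ∈_) (sym (image-∷ ι true X)) (SP.p⊆p∪q _ (SP.x∈⁅x⁆ (ι zero)))
∈-image ι (x ∷ X) (Vec.there i∈) = subst (_ ∈_) (sym (image-∷ ι x X)) (SP.q⊆p∪q _ _ (∈-image (ι ∘ suc) X i∈))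

∈-image⁻ : ∀ {m n} (ι : Fin m → Fin n) (X : Subset m) {y} → y ∈ image ι X → ∃[ i ] (i ∈ X × ι i ≡ y)
∈-image⁻ ι [] y∈ = contradiction y∈ SP.∉⊥
∈-image⁻ ι (x ∷ X) y∈ with SP.x∈p∪q⁻ _ _ (subst (_ ∈_) (image-∷ ι x X) y∈)
∈-image⁻ ι (true ∷ X)  y∈ | inj₁ y∈′ = zero , Vec.here , sym (SP.x∈⁅y⁆⇒x≡y _ y∈′)
∈-image⁻ ι (false ∷ X) y∈ | inj₁ y∈′ = contradiction y∈′ SP.∉⊥
∈-image⁻ ι (x ∷ X)     y∈ | inj₂ y∈′ with ∈-image⁻ (ι ∘ suc) X y∈′
... | i , i∈ , e = suc i , Vec.there i∈ , e

∣⁅⁆∪∣ : ∀ {n} (i : Fin n) (S : Subset n) → i ∉ S → ∣ ⁅ i ⁆ ∪ S ∣ ≡ suc ∣ S ∣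
∣⁅⁆∪∣ zero    (true ∷ S)  i∉ = contradiction Vec.here i∉
∣⁅⁆∪∣ zero    (false ∷ S) i∉ = cong (λ T → suc ∣ T ∣) (SP.∪-identityˡ S)
∣⁅⁆∪∣ (suc i) (true ∷ S)  i∉ = cong suc (∣⁅⁆∪∣ i S (i∉ ∘ Vec.there))
∣⁅⁆∪∣ (suc i) (false ∷ S) i∉ = ∣⁅⁆∪∣ i S (i∉ ∘ Vec.there)

∣image∣ : ∀ {m n} (ι : Fin m → Fin n) → Injective _≡_ _≡_ ι → ∀ X → ∣ image ι X ∣ ≡ ∣ X ∣
∣image∣ {n = n} ι inj [] = SP.∣⊥∣≡0 n
∣image∣ ι inj (true ∷ X) = trans (cong ∣_∣ (image-∷ ι true X)) (trans
  (∣⁅⁆∪∣ (ι zero) _ λ 0∈ → case-suc (∈-image⁻ (ι ∘ suc) X 0∈))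
  (cong suc (∣image∣ (ι ∘ suc) (FP.suc-injective ∘ inj) X)))
  where
  case-suc : ¬ (∃[ i ] (i ∈ X × ι (suc i) ≡ ι zero))
  case-suc (i , _ , e) with () ← inj e
∣image∣ ι inj (false ∷ X) = trans (cong ∣_∣ (trans (image-∷ ι false X) (SP.∪-identityˡ _)))
  (∣image∣ (ι ∘ suc) (FP.suc-injective ∘ inj) X)

-- Cyclic flats

module _ {n : ℕ} (M : Matroid n) where
  -- `Cyclic` says that the restriction to `F` has no coloop, so that `F` is a union of circuits.
  -- Properness excludes the empty set and the ground set, not the least and greatest cyclic flats;
  -- a nonempty set of loops may be proper.
  Flat Cyclic ProperCyclicFlat : Subset n → Set
  Flat F   = ∀ e → e ∉ F → rk M F < rk M (insert F e)
  Cyclic F = ∀ e → e ∈ F → rk M F ≤ rk M (delete F e)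
  ProperCyclicFlat F = Flat F × Cyclic F × (∃[ e ] (e ∈ F)) × (∃[ d ] (d ∉ F))

  proper-cyclic-flat? : ∀ F → Dec (ProperCyclicFlat F)
  proper-cyclic-flat? F = FP.all? (λ e → ¬? (e SP.∈? F) →-dec (rk M F <? rk M (insert F e)))
    ×-dec FP.all? (λ e → (e SP.∈? F) →-dec (rk M F ≤? rk M (delete F e)))
    ×-dec FP.any? (SP._∈? F) ×-dec FP.any? (λ d → ¬? (d SP.∈? F))

  -- An element of a cyclic set is spanned by the rest of it, hence is no coloop of any larger set.
  -- Deleting coloops therefore never damages a cyclic subset.
  cyclic-spans : ∀ {A Y e} → Cyclic A → e ∈ A → A ⊆ Y → rk M Y ≤ rk M (delete Y e)
  cyclic-spans {A} {Y} {e} cyc e∈ A⊆Y = ≤-trans (rk-mono M (⊆-insert-delete Y e))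
    (spans-mono M {delete A e} {delete Y e} (λ x∈ → let (x∈A , x≢e) = ∈-delete⁻ A e x∈ in ∈-delete Y e (A⊆Y x∈A) x≢e)
      (≤-trans (rk-mono M (insert-⊆ (delete-⊆ A e) e∈)) (cyc e e∈)))

  flat-∈ : ∀ {X G e} → Flat G → X ⊆ G → rk M (insert X e) ≤ rk M X → e ∈ G
  flat-∈ {X} {G} {e} fl X⊆G le with e SP.∈? G
  ... | yes e∈ = e∈
  ... | no  e∉ = contradiction (spans-mono M X⊆G le) (<⇒≱ (fl e e∉))

  -- The cyclic part of the closure of S.
  record CyclicFlatOf (S F : Subset n) : Set where
    field
      flat    : Flat F
      cyclic  : Cyclic F
      rk-le   : rk M F + ∣ S ∩ ∁ F ∣ ≤ rk M S
      largest : ∀ {A} → Cyclic A → A ⊆ S → A ⊆ F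
      inside-flats : ∀ {G} → Flat G → S ⊆ G → F ⊆ G

    rk-eq : rk M S ≡ rk M F + ∣ S ∩ ∁ F ∣
    rk-eq = ≤-antisym (rk≤rk+∣∖∣ M S F) rk-le

  private
    fuel-drop : ∀ {ρ′ ρ c′ c m} → ρ′ < ρ → c′ ≤ n → ρ * suc n + c ≤ suc m → ρ′ * suc n + c′ ≤ m
    fuel-drop {ρ′} {ρ} {c′} {c} {m} ρ< c≤ le = ≤-pred (begin
      suc (ρ′ * suc n + c′)     ≡⟨ +-suc _ _ ⟨
      ρ′ * suc n + suc c′       ≤⟨ +-monoʳ-≤ (ρ′ * suc n) (s≤s c≤) ⟩
      ρ′ * suc n + suc n        ≡⟨ +-comm _ (suc n) ⟩
      suc ρ′ * suc n            ≤⟨ *-monoˡ-≤ (suc n) ρ< ⟩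
      ρ * suc n                 ≤⟨ m≤m+n _ c ⟩
      ρ * suc n + c             ≤⟨ le ⟩
      suc m                     ∎)
      where open ≤-Reasoning

    ∣∩∁delete∣ : ∀ (S F : Subset n) e → ∣ S ∩ ∁ (delete F e) ∣ ≤ suc ∣ S ∩ ∁ F ∣
    ∣∩∁delete∣ S F e = begin
      ∣ S ∩ ∁ (delete F e) ∣                                 ≤⟨ ∣∩∣≤∣∩∣+∣∩∁∣ S (∁ (delete F e)) (∁ F) ⟩
      ∣ S ∩ ∁ F ∣ + ∣ ∁ (delete F e) ∩ ∁ (∁ F) ∣             ≤⟨ +-monoʳ-≤ _ (SP.p⊆q⇒∣p∣≤∣q∣ only-e) ⟩
      ∣ S ∩ ∁ F ∣ + ∣ ⁅ e ⁆ ∣                                ≡⟨ cong (∣ S ∩ ∁ F ∣ +_) (SP.∣⁅x⁆∣≡1 e) ⟩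
      ∣ S ∩ ∁ F ∣ + 1                                        ≡⟨ +-comm _ 1 ⟩
      suc ∣ S ∩ ∁ F ∣                                        ∎
      where
      open ≤-Reasoning
      only-e : ∁ (delete F e) ∩ ∁ (∁ F) ⊆ ⁅ e ⁆
      only-e {x} x∈ with SP.x∈p∩q⁻ (∁ (delete F e)) (∁ (∁ F)) x∈ | x Fin.≟ e
      ... | _ | yes refl = SP.x∈⁅x⁆ e
      ... | x∉del , x∈F | no x≢e = contradiction
        (∈-delete F e (SP.x∉∁p⇒x∈p (SP.x∈∁p⇒x∉p x∈F)) x≢e) (SP.x∈∁p⇒x∉p x∉del)

    -- Coloops of `F` are deleted and elements of its closure added until neither exists. The fuel
    -- is lexicographic: a deletion lowers the rank, an addition keeps it and shrinks the
    -- complement. A deletion enlarges `S ∖ F` by at most one element, which the drop in rank pays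
    -- for; it spares cyclic subsets by `cyclic-spans`, and additions stay inside flats by `flat-∈`.
    cyclic-flat-from : ∀ m S F → rk M F * suc n + ∣ ∁ F ∣ ≤ m →
      rk M F + ∣ S ∩ ∁ F ∣ ≤ rk M S → (∀ {A} → Cyclic A → A ⊆ S → A ⊆ F) → (∀ {G} → Flat G → S ⊆ G → F ⊆ G) →
      ∃ (CyclicFlatOf S)
    cyclic-flat-from m S F fuel le lar ins with FP.any? (λ e → (e SP.∈? F) ×-dec (rk M (delete F e) <? rk M F))
    cyclic-flat-from zero S F fuel le lar ins | yes (e , e∈ , lt) =
      contradiction (≤-trans (*-monoˡ-≤ (suc n) (≤-trans (s≤s z≤n) lt)) (m+n≤o⇒m≤o (rk M F * suc n) fuel)) λ ()
    cyclic-flat-from (suc m) S F fuel le lar ins | yes (e , e∈ , lt) =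
      cyclic-flat-from m S (delete F e) (fuel-drop lt (SP.∣p∣≤n (∁ (delete F e))) fuel)
        (begin
          rk M (delete F e) + ∣ S ∩ ∁ (delete F e) ∣      ≤⟨ +-monoʳ-≤ _ (∣∩∁delete∣ S F e) ⟩
          rk M (delete F e) + suc ∣ S ∩ ∁ F ∣             ≡⟨ +-suc _ _ ⟩
          suc (rk M (delete F e)) + ∣ S ∩ ∁ F ∣           ≤⟨ +-monoˡ-≤ _ lt ⟩
          rk M F + ∣ S ∩ ∁ F ∣                            ≤⟨ le ⟩
          rk M S                                          ∎)
        (λ {A} cA A⊆S {x} x∈ → ∈-delete F e (lar cA A⊆S x∈) λ { refl →
          contradiction (cyclic-spans cA x∈ (lar cA A⊆S)) (<⇒≱ lt) })
        (λ fG S⊆G x∈ → ins fG S⊆G (delete-⊆ F e x∈))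
      where open ≤-Reasoning
    ... | no coloopless with FP.any? (λ e → ¬? (e SP.∈? F) ×-dec (rk M (insert F e) ≤? rk M F))
    cyclic-flat-from m S F fuel le lar ins | no coloopless | no closed = F , record
      { flat = λ e e∉ → ≰⇒> λ le → closed (e , e∉ , le)
      ; cyclic = λ e e∈ → ≮⇒≥ λ lt → coloopless (e , e∈ , lt)
      ; rk-le = le ; largest = lar ; inside-flats = ins }
    cyclic-flat-from zero S F fuel le lar ins | no _ | yes (e , e∉ , sp) =
      contradiction (≤-trans (∈⇒0<∣∣ (SP.x∉p⇒x∈∁p e∉)) (m+n≤o⇒n≤o (rk M F * suc n) fuel)) λ ()
    cyclic-flat-from (suc m) S F fuel le lar ins | no _ | yes (e , e∉ , sp) =
      cyclic-flat-from m S (insert F e)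
        (≤-pred (≤-trans (+-mono-≤-< (*-monoˡ-≤ (suc n) sp) (∣∁insert∣ e∉)) fuel))
        (≤-trans (+-mono-≤ sp (∣∩∣-monoʳ S λ x∈ → SP.x∉p⇒x∈∁p λ x∈F → SP.x∈∁p⇒x∉p x∈ (⊆-insert F e x∈F))) le)
        (λ cA A⊆S x∈ → ⊆-insert F e (lar cA A⊆S x∈))
        (λ fG S⊆G → insert-⊆ (ins fG S⊆G) (flat-∈ fG (ins fG S⊆G) sp))

  cyclic-flat-of : ∀ S → ∃ (CyclicFlatOf S)
  cyclic-flat-of S = cyclic-flat-from _ S S ≤-refl
    (≤-reflexive (trans (cong (rk M S +_) (trans (cong ∣_∣ (SP.∩-inverseʳ S)) (SP.∣⊥∣≡0 n))) (+-identityʳ _)))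
    (λ _ A⊆S → A⊆S) (λ _ S⊆G → S⊆G)

  module _ {S F : Subset n} (F-of-S : CyclicFlatOf S F) where
    open CyclicFlatOf F-of-S

    cyclic-flat-dependent : rk M S < ∣ S ∣ → rk M F < ∣ S ∩ F ∣
    cyclic-flat-dependent lt = +-cancelʳ-< (∣ S ∩ ∁ F ∣) _ _
      (≤-trans (s≤s rk-le) (≤-trans lt (≤-reflexive (sym (∣∩∁∣ S F)))))

    cyclic-flat-nonempty : rk M S < ∣ S ∣ → ∃[ e ] (e ∈ F)
    cyclic-flat-nonempty lt with ∣<∣⇒∃ Sub.⊥ F
      (subst (_< ∣ F ∣) (sym (SP.∣⊥∣≡0 n)) (≤-trans (s≤s z≤n) (≤-trans (cyclic-flat-dependent lt) (SP.∣p∩q∣≤∣q∣ S F))))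
    ... | y , y∈ , _ = y , y∈

    cyclic-flat-proper : rk M S < rank M → ∃[ d ] (d ∉ F)
    cyclic-flat-proper lt with ∣<∣⇒∃ Sub.⊥ (∁ F)
      (subst (_< ∣ ∁ F ∣) (sym (SP.∣⊥∣≡0 n)) (≤-trans 0<∣∖∣ (SP.∣p∩q∣≤∣q∣ Sub.⊤ (∁ F))))
      where
      0<∣∖∣ : 0 < ∣ Sub.⊤ ∩ ∁ F ∣
      0<∣∖∣ = +-cancelˡ-< (rk M F) _ _ (≤-trans (s≤s (≤-trans (≤-reflexive (+-identityʳ _)) (m+n≤o⇒m≤o _ rk-le)))
        (≤-trans lt (rk≤rk+∣∖∣ M Sub.⊤ F)))
    ... | d , d∈ , _ = d , SP.x∈∁p⇒x∉p d∈

  -- Dependence of `S` makes the cyclic part of its closure nonempty, and failure to span keeps it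
  -- away from the ground set. This flat both certifies that a `k`-set is not a basis and accounts
  -- for the rank of a degenerate set.
  dependent⇒proper-cyclic-flat : ∀ S → rk M S < ∣ S ∣ → rk M S < rank M →
    ∃[ F ] (ProperCyclicFlat F × rk M S ≡ rk M F + ∣ S ∩ ∁ F ∣ × rk M F < ∣ S ∩ F ∣)
  dependent⇒proper-cyclic-flat S dep lt with cyclic-flat-of S
  ... | F , o = F , (flat , cyclic , cyclic-flat-nonempty o dep , cyclic-flat-proper o lt) , rk-eq , cyclic-flat-dependent o dep
    where open CyclicFlatOf o

  -- Were `F ∩ G` dependent, its cyclic flat would be a proper cyclic flat inside both `F` and `G`,
  -- and the clutter property would identify the two. Were `F ∪ G` not spanning, its cyclic flat
  -- would contain both, with the same effect. Submodularity does the rest.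
  clutter⇒∩-bound : (∀ {F G} → ProperCyclicFlat F → ProperCyclicFlat G → F ⊆ G → F ≡ G) →
    ∀ {F G} → ProperCyclicFlat F → ProperCyclicFlat G → F ≢ G → ∣ F ∩ G ∣ + rank M ≤ rk M F + rk M G
  clutter⇒∩-bound clutter {F} {G} pF@(fF , cF , (e , e∈F) , (d , d∉F)) pG@(fG , cG , _ , _) F≢G = begin
    ∣ F ∩ G ∣ + rank M               ≤⟨ +-mono-≤ ∩-independent ∪-spanning ⟩
    rk M (F ∩ G) + rk M (F ∪ G)      ≡⟨ +-comm (rk M (F ∩ G)) _ ⟩
    rk M (F ∪ G) + rk M (F ∩ G)      ≤⟨ rk-submodular M F G ⟩
    rk M F + rk M G                  ∎
    where
    open ≤-Reasoning
    ∩-independent : ∣ F ∩ G ∣ ≤ rk M (F ∩ G)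
    ∩-independent with ∣ F ∩ G ∣ ≤? rk M (F ∩ G)
    ... | yes le = le
    ... | no ¬le with cyclic-flat-of (F ∩ G)
    ...   | H , o = contradiction (trans (sym (clutter pH pF H⊆F)) (clutter pH pG H⊆G)) F≢G
      where
      open CyclicFlatOf o
      H⊆F : H ⊆ F
      H⊆F = inside-flats fF (SP.p∩q⊆p F G)
      H⊆G : H ⊆ G
      H⊆G = inside-flats fG (SP.p∩q⊆q F G)
      pH : ProperCyclicFlat H
      pH = flat , cyclic , cyclic-flat-nonempty o (≰⇒> ¬le) , (d , d∉F ∘ H⊆F)
    ∪-spanning : rank M ≤ rk M (F ∪ G)
    ∪-spanning with rank M ≤? rk M (F ∪ G)
    ... | yes le = le
    ... | no ¬le with cyclic-flat-of (F ∪ G)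
    ...   | H , o = contradiction (trans (clutter pF pH F⊆H) (sym (clutter pG pH G⊆H))) F≢G
      where
      open CyclicFlatOf o
      F⊆H : F ⊆ H
      F⊆H = largest cF (SP.p⊆p∪q G)
      G⊆H : G ⊆ H
      G⊆H = largest cG (SP.q⊆p∪q F G)
      pH : ProperCyclicFlat H
      pH = flat , cyclic , (e , F⊆H e∈F) , cyclic-flat-proper o (≰⇒> ¬le)

-- The forbidden minor

-- The minor contracts `C` and deletes all elements outside `C` and `e`, `a`, `b`, `d`. It has rank
-- two: `e` is a loop, `a` and `b` are parallel, and `d` is a coloop. The order `e`, `a`, `b`, `d`
-- is that of the direct summands.
module ForbiddenMinor {n : ℕ} (M : Matroid n) {C : Subset n} {e a b d : Fin n}
  (e∉C : e ∉ C) (a∉C : a ∉ C) (b∉C : b ∉ C) (d∉C : d ∉ C)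
  (e≢a : e ≢ a) (e≢b : e ≢ b) (e≢d : e ≢ d) (a≢b : a ≢ b) (a≢d : a ≢ d) (b≢d : b ≢ d)
  (e-loop : rk M (insert C e) ≤ rk M C)
  (ab-parallel : rk M (insert (insert C b) a) ≤ suc (rk M C))
  (ad-independent : suc (suc (rk M C)) ≤ rk M (insert (insert C a) d))
  (bd-independent : suc (suc (rk M C)) ≤ rk M (insert (insert C b) d))
  where

  private
    eab W : Subset n
    eab = insert (insert (insert C b) a) e
    W   = insert eab d

    ι : Fin 4 → Fin n
    ι = lookup (e ∷ a ∷ b ∷ d ∷ [])

    C⊆ab : C ⊆ insert (insert C b) a
    C⊆ab x∈ = ⊆-insert (insert C b) a (⊆-insert C b x∈)

    C⊆eab : C ⊆ eab
    C⊆eab x∈ = ⊆-insert _ e (C⊆ab x∈)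

    e∈eab : e ∈ eab
    e∈eab = ∈-insert _ e
    a∈eab : a ∈ eab
    a∈eab = ⊆-insert _ e (∈-insert (insert C b) a)
    b∈eab : b ∈ eab
    b∈eab = ⊆-insert _ e (⊆-insert _ a (∈-insert C b))

    rk-eab : rk M eab ≤ suc (rk M C)
    rk-eab = ≤-trans (spans-mono M C⊆ab e-loop) ab-parallel

    rk-W-upper : rk M W ≤ suc (suc (rk M C))
    rk-W-upper = ≤-trans (rk-insert-≤ M eab d) (s≤s rk-eab)

    rk-W-lower : suc (suc (rk M C)) ≤ rk M W
    rk-W-lower = ≤-trans ad-independent (rk-mono M (insert-mono (insert-⊆ C⊆eab a∈eab)))

    ∁∁W : ∀ {x} → x ∈ ∁ (∁ W) → x ∈ W
    ∁∁W x∈ = SP.x∉∁p⇒x∈p (SP.x∈∁p⇒x∉p x∈)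

    W⊆∁∁ : W ⊆ ∁ (∁ W)
    W⊆∁∁ x∈ = SP.x∉p⇒x∈∁p λ x∈∁ → SP.x∈∁p⇒x∉p x∈∁ x∈

    rk-∁D : rk M (∁ (∁ W)) ≡ suc (suc (rk M C))
    rk-∁D = ≤-antisym (≤-trans (rk-mono M ∁∁W) rk-W-upper) (≤-trans rk-W-lower (rk-mono M W⊆∁∁))

    ι-injective : Injective _≡_ _≡_ ι
    ι-injective {i} {j} = go i j
      where
      go : ∀ i j → ι i ≡ ι j → i ≡ j
      go zero zero _ = refl
      go zero (suc zero) q = contradiction q e≢a
      go zero (suc (suc zero)) q = contradiction q e≢b
      go zero (suc (suc (suc zero))) q = contradiction q e≢d
      go (suc zero) zero q = contradiction (sym q) e≢a
      go (suc zero) (suc zero) _ = refl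
      go (suc zero) (suc (suc zero)) q = contradiction q a≢b
      go (suc zero) (suc (suc (suc zero))) q = contradiction q a≢d
      go (suc (suc zero)) zero q = contradiction (sym q) e≢b
      go (suc (suc zero)) (suc zero) q = contradiction (sym q) a≢b
      go (suc (suc zero)) (suc (suc zero)) _ = refl
      go (suc (suc zero)) (suc (suc (suc zero))) q = contradiction q b≢d
      go (suc (suc (suc zero))) zero q = contradiction (sym q) e≢d
      go (suc (suc (suc zero))) (suc zero) q = contradiction (sym q) a≢d
      go (suc (suc (suc zero))) (suc (suc zero)) q = contradiction (sym q) b≢d
      go (suc (suc (suc zero))) (suc (suc (suc zero))) _ = refl

    ι∉C : ∀ i → ι i ∉ C
    ι∉C zero = e∉C
    ι∉C (suc zero) = a∉C
    ι∉C (suc (suc zero)) = b∉C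
    ι∉C (suc (suc (suc zero))) = d∉C

    ι∈W : ∀ i → ι i ∈ W
    ι∈W zero = ⊆-insert eab d e∈eab
    ι∈W (suc zero) = ⊆-insert eab d a∈eab
    ι∈W (suc (suc zero)) = ⊆-insert eab d b∈eab
    ι∈W (suc (suc (suc zero))) = ∈-insert eab d

    ι-covers : ∀ x → x ∉ C → x ∉ ∁ W → ∃[ i ] (ι i ≡ x)
    ι-covers x x∉C x∉∁W with ∈-insert⁻ eab d (SP.x∉∁p⇒x∈p x∉∁W)
    ... | inj₁ refl = suc (suc (suc zero)) , refl
    ... | inj₂ x∈ with ∈-insert⁻ _ e x∈
    ...   | inj₁ refl = zero , refl
    ...   | inj₂ x∈ with ∈-insert⁻ _ a x∈
    ...     | inj₁ refl = suc zero , refl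
    ...     | inj₂ x∈ with ∈-insert⁻ C b x∈
    ...       | inj₁ refl = suc (suc zero) , refl
    ...       | inj₂ x∈C  = contradiction x∈C x∉C

    image∪C⊆ : ∀ X {Z} → C ⊆ Z → (∀ i → i ∈ X → ι i ∈ Z) → image ι X ∪ C ⊆ Z
    image∪C⊆ X C⊆Z ι⊆Z x∈ with SP.x∈p∪q⁻ (image ι X) C x∈
    ... | inj₂ x∈C = C⊆Z x∈C
    ... | inj₁ x∈X with ∈-image⁻ ι X x∈X
    ...   | i , i∈ , refl = ι⊆Z i i∈

    dependent : ∀ X {Z} → C ⊆ Z → (∀ i → i ∈ X → ι i ∈ Z) → rk M Z ≤ suc (rk M C) → ¬ MinorBase M C (∁ W) (image ι X)
    dependent X C⊆Z ι⊆Z le (_ , _ , spanning) = contradiction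
      (≤-trans (≤-reflexive (sym (trans spanning rk-∁D))) (≤-trans (rk-mono M (image∪C⊆ X C⊆Z ι⊆Z)) le)) (<⇒≱ ≤-refl)

    wrong-size : ∀ X → ∣ X ∣ ≢ 2 → ¬ MinorBase M C (∁ W) (image ι X)
    wrong-size X ≢2 (_ , independent , spanning) = ≢2 (trans (sym (∣image∣ ι ι-injective X))
      (+-cancelˡ-≡ (rk M C) _ _ (trans (sym independent) (trans spanning (trans rk-∁D (+-comm 2 (rk M C)))))))

    minor-base : ∀ X → ∣ X ∣ ≡ 2 → suc (suc (rk M C)) ≤ rk M (image ι X ∪ C) → MinorBase M C (∁ W) (image ι X)
    minor-base X ≡2 le = in-minor , trans rk-X∪C (trans (+-comm 2 (rk M C)) (cong (rk M C +_) (sym (trans (∣image∣ ι ι-injective X) ≡2))))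
      , trans rk-X∪C (sym rk-∁D)
      where
      in-minor : ∀ x → x ∈ image ι X → x ∉ C × x ∉ ∁ W
      in-minor x x∈ with ∈-image⁻ ι X x∈
      ... | i , _ , refl = ι∉C i , λ x∈∁ → SP.x∈∁p⇒x∉p x∈∁ (ι∈W i)
      rk-X∪C : rk M (image ι X ∪ C) ≡ suc (suc (rk M C))
      rk-X∪C = ≤-antisym (≤-trans (rk-mono M (image∪C⊆ X (λ x∈ → ⊆-insert eab d (C⊆eab x∈)) (λ i _ → ι∈W i))) rk-W-upper) le

    no-d : ∀ x y z → ¬ MinorBase M C (∁ W) (image ι (x ∷ y ∷ z ∷ false ∷ []))
    no-d x y z = dependent (x ∷ y ∷ z ∷ false ∷ []) C⊆eab inside-eab rk-eab
      where
      inside-eab : ∀ i → i ∈ (x ∷ y ∷ z ∷ false ∷ []) → ι i ∈ eab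
      inside-eab zero _ = e∈eab
      inside-eab (suc zero) _ = a∈eab
      inside-eab (suc (suc zero)) _ = b∈eab
      inside-eab (suc (suc (suc zero))) (Vec.there (Vec.there (Vec.there ())))

    e-d-only : ∀ x → ¬ MinorBase M C (∁ W) (image ι (x ∷ false ∷ false ∷ true ∷ []))
    e-d-only x = dependent (x ∷ false ∷ false ∷ true ∷ []) (λ x∈ → ⊆-insert _ d (⊆-insert C e x∈)) inside-ed
      (≤-trans (rk-insert-≤ M (insert C e) d) (s≤s e-loop))
      where
      inside-ed : ∀ i → i ∈ (x ∷ false ∷ false ∷ true ∷ []) → ι i ∈ insert (insert C e) d
      inside-ed zero _ = ⊆-insert _ d (∈-insert C e)
      inside-ed (suc zero) (Vec.there ())
      inside-ed (suc (suc zero)) (Vec.there (Vec.there ()))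
      inside-ed (suc (suc (suc zero))) _ = ∈-insert _ d

    spanned-by : ∀ X i j → i ∈ X → j ∈ X → insert (insert C (ι i)) (ι j) ⊆ image ι X ∪ C
    spanned-by X i j i∈ j∈ = insert-⊆ (insert-⊆ (SP.q⊆p∪q (image ι X) C) (SP.p⊆p∪q C (∈-image ι X i∈))) (SP.p⊆p∪q C (∈-image ι X j∈))

    ad-minor-base : MinorBase M C (∁ W) (image ι (false ∷ true ∷ false ∷ true ∷ []))
    ad-minor-base = minor-base (false ∷ true ∷ false ∷ true ∷ []) refl (≤-trans ad-independent (rk-mono M
      (spanned-by (false ∷ true ∷ false ∷ true ∷ []) (suc zero) (suc (suc (suc zero))) (Vec.there Vec.here) (Vec.there (Vec.there (Vec.there Vec.here))))))

    bd-minor-base : MinorBase M C (∁ W) (image ι (false ∷ false ∷ true ∷ true ∷ []))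
    bd-minor-base = minor-base (false ∷ false ∷ true ∷ true ∷ []) refl (≤-trans bd-independent (rk-mono M
      (spanned-by (false ∷ false ∷ true ∷ true ∷ []) (suc (suc zero)) (suc (suc (suc zero))) (Vec.there (Vec.there Vec.here)) (Vec.there (Vec.there (Vec.there Vec.here))))))

    -- Sets avoiding `d` lie in `eab` and sets inside `{e, d}` are spanned by `C`, `e`, `d`; in both
    -- cases the rank is at most one above that of `C`. Larger sets fail by size, and only `{a, d}`
    -- and `{b, d}` remain.
    bases-match : ∀ X → (X ∈ᴸ forbiddenBases) ⇔ MinorBase M C (∁ W) (image ι X)
    bases-match X = mk⇔ to (from X)
      where
      to : ∀ {X} → X ∈ᴸ forbiddenBases → MinorBase M C (∁ W) (image ι X)
      -- `allSubsets` lists `outside` before `inside`, so `{b, d}` precedes `{a, d}` in the normal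
      -- form of `forbiddenBases`.
      to (here refl)         = bd-minor-base
      to (there (here refl)) = ad-minor-base
      from : ∀ X → MinorBase M C (∁ W) (image ι X) → X ∈ᴸ forbiddenBases
      from (x ∷ y ∷ z ∷ false ∷ []) mb = contradiction mb (no-d x y z)
      from (x ∷ false ∷ false ∷ true ∷ []) mb = contradiction mb (e-d-only x)
      from (false ∷ true ∷ false ∷ true ∷ []) mb = there (here refl)
      from (false ∷ false ∷ true ∷ true ∷ []) mb = here refl
      from X@(false ∷ true ∷ true ∷ true ∷ []) mb = contradiction mb (wrong-size X λ ())
      from X@(true ∷ true ∷ false ∷ true ∷ []) mb = contradiction mb (wrong-size X λ ())
      from X@(true ∷ false ∷ true ∷ true ∷ []) mb = contradiction mb (wrong-size X λ ())
      from X@(true ∷ true ∷ true ∷ true ∷ []) mb = contradiction mb (wrong-size X λ ())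

  has-forbidden-minor : HasMinorIsoTo M forbiddenBases
  has-forbidden-minor = C , ∁ W , ι
    , (λ x x∈C x∈∁W → SP.x∈∁p⇒x∉p x∈∁W (⊆-insert eab d (C⊆eab x∈C)))
    , ι-injective , (λ i → ι∉C i , λ x∈∁ → SP.x∈∁p⇒x∉p x∈∁ (ι∈W i)) , ι-covers , bases-match

module _ {n : ℕ} (M : Matroid n) where
  private
    module _ (G : Subset n) (cG : Cyclic M G) {e a : Fin n} (a∈G : a ∈ G) where
      Room : Subset n
      Room = delete (delete G a) e

      -- Elements of `Room` are added to `C` while `a` stays outside the span. This must stop: with
      -- `Room` exhausted, `C` together with the spanned element `e` contains `G − a`, which spans
      -- `a` because `G` is cyclic. The element `b` that would make `a` spanned is parallel to `a`
      -- after contracting `C′`.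
      parallel-element : ∀ m C → ∣ ∁ C ∣ ≤ m → C ⊆ Room → rk M (insert C e) ≤ rk M C → rk M C < rk M (insert C a) →
        ∃[ C′ ] ∃[ b ] (C ⊆ C′ × C′ ⊆ Room × b ∈ Room × b ∉ C′ × rk M C′ < rk M (insert C′ a) × rk M (insert (insert C′ b) a) ≤ rk M (insert C′ b))
      parallel-element m C fuel C⊆ e-loop a-free with FP.any? (λ b → (b SP.∈? Room) ×-dec ¬? (b SP.∈? C))
      ... | no full = contradiction (spans-mono M C⊆C+e a-spanned) (<⇒≱ (≤-trans (s≤s e-loop) (≤-trans a-free (rk-mono M (insert-mono (⊆-insert C e))))))
        where
        C⊆C+e : delete G a ⊆ insert C e
        C⊆C+e {x} x∈ with x Fin.≟ e
        ... | yes refl = ∈-insert C e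
        ... | no x≢e with x SP.∈? C
        ...   | yes x∈C = ⊆-insert C e x∈C
        ...   | no x∉C = contradiction (x , ∈-delete _ e x∈ x≢e , x∉C) full
        a-spanned : rk M (insert (delete G a) a) ≤ rk M (delete G a)
        a-spanned = ≤-trans (rk-mono M (insert-⊆ (delete-⊆ G a) a∈G)) (cG a a∈G)
      ... | yes (b , b∈ , b∉) with rk M (insert (insert C b) a) ≤? rk M (insert C b)
      ...   | yes le = C , b , id , C⊆ , b∈ , b∉ , a-free , le
      parallel-element zero C fuel C⊆ e-loop a-free | yes (b , b∈ , b∉) | no ¬le =
        contradiction (≤-trans (∈⇒0<∣∣ (SP.x∉p⇒x∈∁p b∉)) fuel) λ ()
      parallel-element (suc m) C fuel C⊆ e-loop a-free | yes (b , b∈ , b∉) | no ¬le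
        with parallel-element m (insert C b) (≤-pred (≤-trans (∣∁insert∣ b∉) fuel)) (insert-⊆ C⊆ b∈)
               (spans-mono M (⊆-insert C b) e-loop) (≰⇒> ¬le)
      ... | C′ , b′ , C⊆C′ , rest = C′ , b′ , (λ x∈ → C⊆C′ (⊆-insert C b x∈)) , rest

  -- For F ⊊ G, contracting a suitable set between F − e and G makes e a loop and two elements of
  -- G parallel, while an element outside G stays a coloop.
  elementary-split⇒clutter : ElementarySplit M → ∀ {F G} → ProperCyclicFlat M F → ProperCyclicFlat M G → F ⊆ G → F ≡ G
  elementary-split⇒clutter split {F} {G} (fF , cF , (e , e∈F) , _) (fG , cG , _ , (d , d∉G)) F⊆G
    with FP.any? (λ a → (a SP.∈? G) ×-dec ¬? (a SP.∈? F))
  ... | no G⊆F = SP.⊆-antisym F⊆G λ {x} x∈ → [ id , (λ x∉ → contradiction (x , x∈ , x∉) G⊆F) ]′ (dec⊎ x)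
    where
    dec⊎ : ∀ x → x ∈ F ⊎ x ∉ F
    dec⊎ x with x SP.∈? F
    ... | yes p = inj₁ p
    ... | no p  = inj₂ p
  ... | yes (a , a∈G , a∉F) with parallel-element G cG {e} {a} a∈G _ (delete F e) ≤-refl
        (λ x∈ → let (x∈F , x≢e) = ∈-delete⁻ F e x∈ in ∈-delete _ e (∈-delete G a (F⊆G x∈F) λ { refl → a∉F x∈F }) x≢e)
        e-spanned a-free
    where
    e-spanned : rk M (insert (delete F e) e) ≤ rk M (delete F e)
    e-spanned = ≤-trans (rk-mono M (insert-⊆ (delete-⊆ F e) e∈F)) (cF e e∈F)
    a-free : rk M (delete F e) < rk M (insert (delete F e) a)
    a-free = ≰⇒> λ le → contradiction (spans-mono M (delete-⊆ F e) le) (<⇒≱ (fF a a∉F))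
  ... | C , b , F-e⊆C , C⊆ , b∈ , b∉C , a-free , a-spanned =
    contradiction (ForbiddenMinor.has-forbidden-minor M e∉C a∉C b∉C (d∉G ∘ C⊆G)
      (λ { refl → a∉F e∈F }) (λ { refl → ∉-delete _ e b∈ }) (λ { refl → d∉G (F⊆G e∈F) })
      (λ { refl → ∉-delete G a (delete-⊆ _ e b∈) }) (λ { refl → d∉G a∈G }) (λ { refl → d∉G b∈G })
      e-loop (≤-trans a-spanned (rk-insert-≤ M C b))
      (≤-trans (s≤s a-free) (d-free (insert-⊆ C⊆G a∈G)))
      (≤-trans (s≤s b-free) (d-free (insert-⊆ C⊆G b∈G)))) split
    where
    C⊆G : C ⊆ G
    C⊆G x∈ = delete-⊆ G a (delete-⊆ _ e (C⊆ x∈))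
    b∈G : b ∈ G
    b∈G = delete-⊆ G a (delete-⊆ _ e b∈)
    e∉C : e ∉ C
    e∉C e∈ = ∉-delete _ e (C⊆ e∈)
    a∉C : a ∉ C
    a∉C a∈ = ∉-delete G a (delete-⊆ _ e (C⊆ a∈))
    e-loop : rk M (insert C e) ≤ rk M C
    e-loop = spans-mono M F-e⊆C (≤-trans (rk-mono M (insert-⊆ (delete-⊆ F e) e∈F)) (cF e e∈F))
    b-free : rk M C < rk M (insert C b)
    b-free = ≤-trans a-free (≤-trans (rk-mono M (insert-mono (⊆-insert C b))) a-spanned)
    d-free : ∀ {X} → X ⊆ G → rk M X < rk M (insert X d)
    d-free X⊆G = ≰⇒> λ le → d∉G (flat-∈ M fG X⊆G le)

-- Rational cones over 0/1 vectors

ℚring = fromCommutativeRing ℚP.+-*-commutativeRing (λ x → dec⇒maybe (0ℚ ℚP.≟ x))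

≤-by-difference : ∀ {a b d} → 0ℚ ℚ.≤ d → b ≡ a ℚ.+ d → a ℚ.≤ b
≤-by-difference {a} 0≤d e = ℚP.≤-trans (ℚP.≤-reflexive (sym (ℚP.+-identityʳ a))) (ℚP.≤-trans (ℚP.+-monoʳ-≤ a 0≤d) (ℚP.≤-reflexive (sym e)))

0≤difference : ∀ {a b} → a ℚ.≤ b → 0ℚ ℚ.≤ b ℚ.- a
0≤difference {a} {b} a≤b = subst (ℚ._≤ b ℚ.- a) (ℚP.+-inverseʳ a) (ℚP.+-monoˡ-≤ (ℚ.- a) a≤b)

0≤+ : ∀ {a b} → 0ℚ ℚ.≤ a → 0ℚ ℚ.≤ b → 0ℚ ℚ.≤ a ℚ.+ b
0≤+ 0≤a 0≤b = ℚP.+-mono-≤ 0≤a 0≤b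

0≤* : ∀ {a b} → 0ℚ ℚ.≤ a → 0ℚ ℚ.≤ b → 0ℚ ℚ.≤ a ℚ.* b
0≤* {a} {b} 0≤a 0≤b = ℚP.≤-trans (ℚP.≤-reflexive (sym (ℚP.*-zeroʳ a))) (ℚP.*-monoˡ-≤-nonNeg a {{ℚ.nonNegative 0≤a}} 0≤b)

≤ℚ⇒≯ : ∀ {a b} → a ℚ.≤ b → ¬ (b ℚ.< a)
≤ℚ⇒≯ le lt = ℚP.<-irrefl refl (ℚP.<-≤-trans lt le)

0≤1 : 0ℚ ℚ.≤ 1ℚ
0≤1 = ℚP.nonNegative⁻¹ 1ℚ

0<a⇒0≤a : ∀ {a} → 0ℚ ℚ.< a → 0ℚ ℚ.≤ a
0<a⇒0≤a = ℚP.<⇒≤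

a<0⇒0≤-a : ∀ {a} → a ℚ.< 0ℚ → 0ℚ ℚ.≤ ℚ.- a
a<0⇒0≤-a a<0 = ℚP.neg-antimono-≤ (ℚP.<⇒≤ a<0)

∃-quotient : ∀ {l a} → 0ℚ ℚ.≤ l → 0ℚ ℚ.< a → ∃[ c ] (0ℚ ℚ.≤ c × c ℚ.* a ≡ l)
∃-quotient {l} {a} 0≤l 0<a = l ℚ.* 1/a , 0≤* 0≤l (0<a⇒0≤a (ℚP.positive⁻¹ 1/a {{ℚP.1/pos⇒pos a}})) ,
  trans (ℚP.*-assoc l 1/a a) (trans (cong (l ℚ.*_) (ℚP.*-inverseˡ a)) (ℚP.*-identityʳ l))
  where
  instance
    positive-a : ℚ.Positive a
    positive-a = ℚ.positive 0<a
    nonzero-a : ℚ.NonZero a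
    nonzero-a = ℚP.pos⇒nonZero a
  1/a : ℚ
  1/a = ℚ.1/ a

⊔-< : ∀ {a b c} → a ℚ.< c → b ℚ.< c → a ℚ.⊔ b ℚ.< c
⊔-< {a} {b} {c} a<c b<c with ℚP.⊔-sel a b
... | inj₁ e = subst (ℚ._< c) (sym e) a<c
... | inj₂ e = subst (ℚ._< c) (sym e) b<c

fromℕ : ℕ → ℚ
fromℕ zero    = 0ℚ
fromℕ (suc n) = 1ℚ ℚ.+ fromℕ n

0≤fromℕ : ∀ n → 0ℚ ℚ.≤ fromℕ n
0≤fromℕ zero    = ℚP.≤-refl
0≤fromℕ (suc n) = 0≤+ 0≤1 (0≤fromℕ n)

fromℕ-+ : ∀ m n → fromℕ (m + n) ≡ fromℕ m ℚ.+ fromℕ n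
fromℕ-+ zero    n = sym (ℚP.+-identityˡ _)
fromℕ-+ (suc m) n = trans (cong (1ℚ ℚ.+_) (fromℕ-+ m n)) (sym (ℚP.+-assoc 1ℚ (fromℕ m) (fromℕ n)))

fromℕ-mono : ∀ {m n} → m ≤ n → fromℕ m ℚ.≤ fromℕ n
fromℕ-mono {n = n} z≤n = 0≤fromℕ n
fromℕ-mono (s≤s p)     = ℚP.+-monoʳ-≤ 1ℚ (fromℕ-mono p)

fromℕ-< : ∀ {m n} → m < n → fromℕ m ℚ.< fromℕ n
fromℕ-< {m} m<n = ℚP.<-≤-trans (subst (ℚ._< 1ℚ ℚ.+ fromℕ m) (ℚP.+-identityˡ _) (ℚP.+-monoˡ-< (fromℕ m) (ℚP.positive⁻¹ 1ℚ))) (fromℕ-mono m<n)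

fromℕ-cancel-≤ : ∀ {m n} → fromℕ m ℚ.≤ fromℕ n → m ≤ n
fromℕ-cancel-≤ {m} {n} le with m ≤? n
... | yes p = p
... | no ¬p = contradiction (ℚP.<-≤-trans (fromℕ-< (≰⇒> ¬p)) le) (ℚP.<-irrefl refl)

dot : ∀ {n} → (Fin n → ℚ) → (Fin n → ℚ) → ℚ
dot {zero}  w v = 0ℚ
dot {suc n} w v = w zero ℚ.* v zero ℚ.+ dot (w ∘ suc) (v ∘ suc)

dot-cong : ∀ {n} (w : Fin n → ℚ) {u v} → (∀ j → u j ≡ v j) → dot w u ≡ dot w v
dot-cong {zero}  w e = refl
dot-cong {suc n} w e = cong₂ (λ a b → w zero ℚ.* a ℚ.+ b) (e zero) (dot-cong (w ∘ suc) (e ∘ suc))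

dot-zero : ∀ {n} (w : Fin n → ℚ) {u} → (∀ j → u j ≡ 0ℚ) → dot w u ≡ 0ℚ
dot-zero {zero}  w e = refl
dot-zero {suc n} w e = trans (cong₂ (λ a b → w zero ℚ.* a ℚ.+ b) (e zero) (dot-zero (w ∘ suc) (e ∘ suc)))
  (trans (cong (ℚ._+ 0ℚ) (ℚP.*-zeroʳ (w zero))) (ℚP.+-identityʳ 0ℚ))

dot-+ : ∀ {n} (w u v : Fin n → ℚ) → dot w (λ j → u j ℚ.+ v j) ≡ dot w u ℚ.+ dot w v
dot-+ {zero}  w u v = sym (ℚP.+-identityʳ 0ℚ)
dot-+ {suc n} w u v = trans (cong (w zero ℚ.* (u zero ℚ.+ v zero) ℚ.+_) (dot-+ (w ∘ suc) (u ∘ suc) (v ∘ suc)))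
  (rearrange (w zero) (u zero) (v zero) (dot (w ∘ suc) (u ∘ suc)) (dot (w ∘ suc) (v ∘ suc)))
  where
  rearrange : ∀ a b c d e → a ℚ.* (b ℚ.+ c) ℚ.+ (d ℚ.+ e) ≡ (a ℚ.* b ℚ.+ d) ℚ.+ (a ℚ.* c ℚ.+ e)
  rearrange = RingSolver.solve-∀ ℚring

dot-* : ∀ {n} (w : Fin n → ℚ) l v → dot w (λ j → l ℚ.* v j) ≡ l ℚ.* dot w v
dot-* {zero}  w l v = sym (ℚP.*-zeroʳ l)
dot-* {suc n} w l v = trans (cong (w zero ℚ.* (l ℚ.* v zero) ℚ.+_) (dot-* (w ∘ suc) l (v ∘ suc)))
  (rearrange (w zero) l (v zero) (dot (w ∘ suc) (v ∘ suc)))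
  where
  rearrange : ∀ a l b d → a ℚ.* (l ℚ.* b) ℚ.+ l ℚ.* d ≡ l ℚ.* (a ℚ.* b ℚ.+ d)
  rearrange = RingSolver.solve-∀ ℚring

indicator : Bool → ℚ
indicator b = if b then 1ℚ else 0ℚ

dot-indicators : ∀ {n} (T B : Subset n) → dot (indicator ∘ lookup T) (indicator ∘ lookup B) ≡ fromℕ ∣ B ∩ T ∣
dot-indicators [] [] = refl
dot-indicators (true ∷ T)  (true ∷ B)  = cong₂ ℚ._+_ (ℚP.*-identityʳ 1ℚ) (dot-indicators T B)
dot-indicators (true ∷ T)  (false ∷ B) = trans (cong₂ ℚ._+_ (ℚP.*-zeroʳ 1ℚ) (dot-indicators T B)) (ℚP.+-identityˡ _)
dot-indicators (false ∷ T) (true ∷ B)  = trans (cong₂ ℚ._+_ (ℚP.*-zeroˡ 1ℚ) (dot-indicators T B)) (ℚP.+-identityˡ _)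
dot-indicators (false ∷ T) (false ∷ B) = trans (cong₂ ℚ._+_ (ℚP.*-zeroˡ 0ℚ) (dot-indicators T B)) (ℚP.+-identityˡ _)

-- Homogeneous coordinates: coordinate zero is the total weight.
vertex : ∀ {n} → Subset n → Fin (suc n) → ℚ
vertex B = indicator ∘ lookup (inside ∷ B)

-- The cone over the homogenized vertices satisfying `Q`; the slice where coordinate zero is one is
-- their convex hull. In a cone, weights can be split and rescaled without normalization. Points are
-- compared coordinatewise, in place of function extensionality.
data Hull {n} (Q : Subset n → Set) : (Fin (suc n) → ℚ) → Set where
  none  : ∀ {v} → (∀ j → v j ≡ 0ℚ) → Hull Q v
  point : ∀ {u v} l B → 0ℚ ℚ.≤ l → Q B → Hull Q u → (∀ j → v j ≡ l ℚ.* vertex B j ℚ.+ u j) → Hull Q v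

module _ {n : ℕ} where
  private
    V : Set
    V = Fin (suc n) → ℚ

  hull-cong : ∀ {Q : Subset n → Set} {u v} → (∀ j → v j ≡ u j) → Hull Q u → Hull Q v
  hull-cong e (none z)              = none λ j → trans (e j) (z j)
  hull-cong e (point l B 0≤l q h f) = point l B 0≤l q h λ j → trans (e j) (f j)

  hull-mono : ∀ {Q Q′ : Subset n → Set} {v} → (∀ {B} → Q B → Q′ B) → Hull Q v → Hull Q′ v
  hull-mono Q⊆ (none z)              = none z
  hull-mono Q⊆ (point l B 0≤l q h f) = point l B 0≤l (Q⊆ q) (hull-mono Q⊆ h) f

  hull-vertex : ∀ {Q : Subset n → Set} l B → 0ℚ ℚ.≤ l → Q B → Hull Q (λ j → l ℚ.* vertex B j)
  hull-vertex l B 0≤l q = point l B 0≤l q (none λ _ → refl) λ _ → sym (ℚP.+-identityʳ _)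

  hull-+ : ∀ {Q : Subset n → Set} {u v} → Hull Q u → Hull Q v → Hull Q (λ j → u j ℚ.+ v j)
  hull-+ {v = v} (none z) g = hull-cong (λ j → trans (cong (ℚ._+ v j) (z j)) (ℚP.+-identityˡ _)) g
  hull-+ {v = v} (point l B 0≤l q h f) g = point l B 0≤l q (hull-+ h g)
    λ j → trans (cong (ℚ._+ v j) (f j)) (ℚP.+-assoc (l ℚ.* vertex B j) _ _)

  hull-* : ∀ {Q : Subset n → Set} {v} c → 0ℚ ℚ.≤ c → Hull Q v → Hull Q (λ j → c ℚ.* v j)
  hull-* c 0≤c (none z) = none λ j → trans (cong (c ℚ.*_) (z j)) (ℚP.*-zeroʳ c)
  hull-* c 0≤c (point {u} l B 0≤l q h f) = point (c ℚ.* l) B (0≤* 0≤c 0≤l) q (hull-* c 0≤c h)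
    λ j → trans (cong (c ℚ.*_) (f j)) (rearrange c l (vertex B j) (u j))
    where
    rearrange : ∀ c l m u → c ℚ.* (l ℚ.* m ℚ.+ u) ≡ c ℚ.* l ℚ.* m ℚ.+ c ℚ.* u
    rearrange = RingSolver.solve-∀ ℚring

  dot-point : ∀ w l B {u v : V} → (∀ j → v j ≡ l ℚ.* vertex B j ℚ.+ u j) → dot w v ≡ l ℚ.* dot w (vertex B) ℚ.+ dot w u
  dot-point w l B {u} e = trans (dot-cong w e) (trans (dot-+ w (λ j → l ℚ.* vertex B j) u) (cong (ℚ._+ dot w u) (dot-* w l (vertex B))))

  hull-dot-≥0 : ∀ {Q : Subset n → Set} {v} w → (∀ {B} → Q B → 0ℚ ℚ.≤ dot w (vertex B)) → Hull Q v → 0ℚ ℚ.≤ dot w v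
  hull-dot-≥0 w 0≤ (none z) = ℚP.≤-reflexive (sym (dot-zero w z))
  hull-dot-≥0 w 0≤ (point l B 0≤l q h f) = subst (0ℚ ℚ.≤_) (sym (dot-point w l B f)) (0≤+ (0≤* 0≤l (0≤ q)) (hull-dot-≥0 w 0≤ h))

  -- Vertices beyond the hyperplane dot w = 0 are paired off with vertices on the other side; each
  -- pair is replaced by the point where its segment crosses the hyperplane.
  module HullCut (w : V) {Q Q′ : Subset n → Set}
    (below : ∀ {B} → Q B → dot w (vertex B) ℚ.≤ 0ℚ → Q′ B)
    (crossing : ∀ {B B′} → Q B → Q B′ → 0ℚ ℚ.< dot w (vertex B) → dot w (vertex B′) ℚ.< 0ℚ →
                Hull Q′ (λ j → dot w (vertex B) ℚ.* vertex B′ j ℚ.+ (ℚ.- dot w (vertex B′)) ℚ.* vertex B j))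
    where

    private
      height : Subset n → ℚ
      height B = dot w (vertex B)

      Above Below : Subset n → Set
      Above B = Q B × 0ℚ ℚ.< height B
      Below B = Q B × height B ℚ.≤ 0ℚ

      partition : ∀ {v} → Hull Q v → ∃[ a ] ∃[ b ] (Hull Above a × Hull Below b × (∀ j → v j ≡ a j ℚ.+ b j))
      partition (none z) = _ , _ , none (λ _ → refl) , none (λ _ → refl) , λ j → trans (z j) (sym (ℚP.+-identityʳ 0ℚ))
      partition (point {u} l B 0≤l q h f) with partition h | 0ℚ ℚP.<? height B
      ... | a , b , ha , hb , e | yes p = _ , _ , point l B 0≤l (q , p) ha (λ _ → refl) , hb ,
        λ j → trans (f j) (trans (cong (l ℚ.* vertex B j ℚ.+_) (e j)) (sym (ℚP.+-assoc (l ℚ.* vertex B j) _ _)))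
      ... | a , b , ha , hb , e | no ¬p = _ , _ , ha , point l B 0≤l (q , ℚP.≮⇒≥ ¬p) hb (λ _ → refl) ,
        λ j → trans (f j) (trans (cong (l ℚ.* vertex B j ℚ.+_) (e j)) (rearrange (l ℚ.* vertex B j) (a j) (b j)))
        where
        rearrange : ∀ x y z → x ℚ.+ (y ℚ.+ z) ≡ y ℚ.+ (x ℚ.+ z)
        rearrange = RingSolver.solve-∀ ℚring

      -- Bookkeeping for spending the weight `l` of one vertex `B` above the hyperplane against a
      -- point of the lower cone. `paid` collects crossing points and lower vertices already on the
      -- hyperplane; `left` and `rest` are what remains on the two sides, and one of them is zero.
      record Consumed (l : ℚ) (B : Subset n) (v : V) : Set where
        constructor consumed
        field
          {left}    : ℚ
          {rest}    : V
          {paid}    : V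
          0≤left    : 0ℚ ℚ.≤ left
          rest-hull : Hull Below rest
          paid-hull : Hull Q′ paid
          balance   : ∀ j → l ℚ.* vertex B j ℚ.+ v j ≡ left ℚ.* vertex B j ℚ.+ (rest j ℚ.+ paid j)
          on-plane  : dot w paid ≡ 0ℚ
          exhausted : left ≡ 0ℚ ⊎ (∀ j → rest j ≡ 0ℚ)

      crossing-point : Subset n → Subset n → V
      crossing-point B B′ j = height B ℚ.* vertex B′ j ℚ.+ (ℚ.- height B′) ℚ.* vertex B j

      crossing-on-plane : ∀ c B B′ → dot w (λ j → c ℚ.* crossing-point B B′ j) ≡ 0ℚ
      crossing-on-plane c B B′ = trans (dot-* w c (crossing-point B B′)) (trans (cong (c ℚ.*_) (trans
        (dot-+ w (λ j → height B ℚ.* vertex B′ j) (λ j → (ℚ.- height B′) ℚ.* vertex B j))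
        (cong₂ ℚ._+_ (dot-* w (height B) (vertex B′)) (dot-* w (ℚ.- height B′) (vertex B))))) (cancel c (height B) (height B′)))
        where
        cancel : ∀ c x y → c ℚ.* (x ℚ.* y ℚ.+ (ℚ.- y) ℚ.* x) ≡ 0ℚ
        cancel = RingSolver.solve-∀ ℚring

      consume : ∀ l B {v} → 0ℚ ℚ.≤ l → Above B → Hull Below v → Consumed l B v
      consume l B {v} 0≤l _ (none z) = consumed {rest = λ _ → 0ℚ} {paid = λ _ → 0ℚ} 0≤l (none (λ _ → refl)) (none (λ _ → refl))
        (λ j → cong (l ℚ.* vertex B j ℚ.+_) (trans (z j) (sym (ℚP.+-identityʳ 0ℚ)))) (dot-zero w (λ _ → refl)) (inj₂ λ _ → refl)
      consume l B {v} 0≤l above@(qB , 0<B) (point {u} m B′ 0≤m (qB′ , B′≤0) h f) with height B′ ℚP.<? 0ℚ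
      ... | no ¬neg = consumed {paid = λ j → m ℚ.* vertex B′ j ℚ.+ paid j} 0≤left rest-hull (hull-+ (hull-vertex m B′ 0≤m (below qB′ B′≤0)) paid-hull)
        (λ j → trans (cong (l ℚ.* vertex B j ℚ.+_) (f j)) (trans (move (l ℚ.* vertex B j) (m ℚ.* vertex B′ j) (u j))
          (trans (cong (m ℚ.* vertex B′ j ℚ.+_) (balance j)) (move′ (left ℚ.* vertex B j) (m ℚ.* vertex B′ j) (rest j) (paid j)))))
        (trans (dot-+ w (λ j → m ℚ.* vertex B′ j) paid) (trans (cong₂ ℚ._+_ (trans (dot-* w m (vertex B′)) (trans (cong (m ℚ.*_) (ℚP.≤-antisym B′≤0 (ℚP.≮⇒≥ ¬neg))) (ℚP.*-zeroʳ m))) on-plane) (ℚP.+-identityʳ 0ℚ)))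
        exhausted
        where
        open Consumed (consume l B 0≤l above h)
        move : ∀ x y z → x ℚ.+ (y ℚ.+ z) ≡ y ℚ.+ (x ℚ.+ z)
        move = RingSolver.solve-∀ ℚring
        move′ : ∀ x y z t → y ℚ.+ (x ℚ.+ (z ℚ.+ t)) ≡ x ℚ.+ (z ℚ.+ (y ℚ.+ t))
        move′ = RingSolver.solve-∀ ℚring
      -- A crossing point with factor `c` uses weight `c * (- height B′)` of `B` and `c * height B`
      -- of `B′`. The comparison decides which vertex is used up, and hence which equation
      -- determines `c`.
      ... | yes neg with l ℚ.* height B ℚP.≤? m ℚ.* (ℚ.- height B′)
      ...   | yes le with ∃-quotient 0≤l (ℚP.neg-antimono-< neg)
      ...     | c , 0≤c , c*a≡l = consumed ℚP.≤-refl
        (point (m ℚ.- c ℚ.* height B) B′ (0≤difference {c ℚ.* height B} {m} (ℚP.*-cancelʳ-≤-pos (ℚ.- height B′) {{ℚ.positive (ℚP.neg-antimono-< neg)}} le′)) (qB′ , B′≤0) h (λ _ → refl))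
        (hull-* c 0≤c (crossing qB qB′ 0<B neg))
        (λ j → trans (cong₂ (λ x y → x ℚ.* vertex B j ℚ.+ y) (sym c*a≡l) (f j)) (move c (height B) (height B′) m (vertex B j) (vertex B′ j) (u j)))
        (crossing-on-plane c B B′) (inj₁ refl)
        where
        le′ : c ℚ.* height B ℚ.* (ℚ.- height B′) ℚ.≤ m ℚ.* (ℚ.- height B′)
        le′ = ℚP.≤-trans (ℚP.≤-reflexive (trans (comm-last c (height B) (ℚ.- height B′)) (cong (ℚ._* height B) c*a≡l))) le
          where
          comm-last : ∀ x y z → x ℚ.* y ℚ.* z ≡ x ℚ.* z ℚ.* y
          comm-last = RingSolver.solve-∀ ℚring
        move : ∀ c x y m b b′ u → c ℚ.* (ℚ.- y) ℚ.* b ℚ.+ (m ℚ.* b′ ℚ.+ u) ≡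
               0ℚ ℚ.* b ℚ.+ (((m ℚ.- c ℚ.* x) ℚ.* b′ ℚ.+ u) ℚ.+ c ℚ.* (x ℚ.* b′ ℚ.+ (ℚ.- y) ℚ.* b))
        move = RingSolver.solve-∀ ℚring
      consume l B {v} 0≤l above@(qB , 0<B) (point {u} m B′ 0≤m (qB′ , B′≤0) h f) | yes neg | no ¬le with ∃-quotient 0≤m 0<B
      ... | c , 0≤c , c*a≡m = consumed {paid = λ j → c ℚ.* crossing-point B B′ j ℚ.+ paid j}
        0≤left rest-hull (hull-+ (hull-* c 0≤c (crossing qB qB′ 0<B neg)) paid-hull)
        (λ j → trans (cong (l ℚ.* vertex B j ℚ.+_) (trans (f j) (cong (λ x → x ℚ.* vertex B′ j ℚ.+ u j) (sym c*a≡m))))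
          (trans (move c (height B) (height B′) l (vertex B j) (vertex B′ j) (u j))
          (trans (cong (c ℚ.* crossing-point B B′ j ℚ.+_) (balance j))
            (move′ (left ℚ.* vertex B j) (c ℚ.* crossing-point B B′ j) (rest j) (paid j)))))
        (trans (dot-+ w (λ j → c ℚ.* crossing-point B B′ j) paid) (trans (cong₂ ℚ._+_ (crossing-on-plane c B B′) on-plane) (ℚP.+-identityʳ 0ℚ)))
        exhausted
        where
        0≤l′ : 0ℚ ℚ.≤ l ℚ.- c ℚ.* (ℚ.- height B′)
        0≤l′ = 0≤difference {c ℚ.* (ℚ.- height B′)} {l} (ℚP.*-cancelʳ-≤-pos (height B) {{ℚ.positive 0<B}}
          (ℚP.≤-trans (ℚP.≤-reflexive (trans (comm-last c (ℚ.- height B′) (height B)) (cong (ℚ._* (ℚ.- height B′)) c*a≡m))) (ℚP.<⇒≤ (ℚP.≰⇒> ¬le))))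
          where
          comm-last : ∀ x y z → x ℚ.* y ℚ.* z ≡ x ℚ.* z ℚ.* y
          comm-last = RingSolver.solve-∀ ℚring
        open Consumed (consume (l ℚ.- c ℚ.* (ℚ.- height B′)) B 0≤l′ above h)
        move : ∀ c x y l b b′ u → l ℚ.* b ℚ.+ (c ℚ.* x ℚ.* b′ ℚ.+ u) ≡
               c ℚ.* (x ℚ.* b′ ℚ.+ (ℚ.- y) ℚ.* b) ℚ.+ ((l ℚ.- c ℚ.* (ℚ.- y)) ℚ.* b ℚ.+ u)
        move = RingSolver.solve-∀ ℚring
        move′ : ∀ x y z t → y ℚ.+ (x ℚ.+ (z ℚ.+ t)) ≡ x ℚ.+ (z ℚ.+ (y ℚ.+ t))
        move′ = RingSolver.solve-∀ ℚring

      -- Since `paid` has height zero, total height is preserved. If the lower side is used up, what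
      -- remains is `left * height B + dot w u`, a sum of nonnegative terms that is at most zero; so
      -- `left` vanishes in this case as well.
      pay-off : ∀ {a b} → Hull Above a → Hull Below b → dot w a ℚ.+ dot w b ℚ.≤ 0ℚ → Hull Q′ (λ j → a j ℚ.+ b j)
      pay-off {a} {b} (none z) hb _ =
        hull-cong (λ j → trans (cong (ℚ._+ b j) (z j)) (ℚP.+-identityˡ _)) (hull-mono (λ (q , le) → below q le) hb)
      pay-off {a} {b} (point {u} l B 0≤l above@(_ , 0<B) ha f) hb le = hull-cong total (hull-+ (pay-off ha rest-hull le′) paid-hull)
        where
        open Consumed (consume l B 0≤l above hb)
        0≤u : 0ℚ ℚ.≤ dot w u
        0≤u = hull-dot-≥0 w (λ (_ , p) → ℚP.<⇒≤ p) ha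
        balance-dot : l ℚ.* height B ℚ.+ dot w b ≡ left ℚ.* height B ℚ.+ dot w rest
        balance-dot = begin
          l ℚ.* height B ℚ.+ dot w b                             ≡⟨ dot-point w l B {b} (λ _ → refl) ⟨
          dot w (λ j → l ℚ.* vertex B j ℚ.+ b j)                 ≡⟨ dot-point w left B balance ⟩
          left ℚ.* height B ℚ.+ dot w (λ j → rest j ℚ.+ paid j)  ≡⟨ cong (left ℚ.* height B ℚ.+_) (trans (dot-+ w rest paid) (trans (cong (dot w rest ℚ.+_) on-plane) (ℚP.+-identityʳ _))) ⟩
          left ℚ.* height B ℚ.+ dot w rest                       ∎
          where open ≡-Reasoning
        le-left : left ℚ.* height B ℚ.+ dot w rest ℚ.+ dot w u ℚ.≤ 0ℚ
        le-left = ℚP.≤-trans (ℚP.≤-reflexive (trans (cong (ℚ._+ dot w u) (sym balance-dot))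
          (trans (swap-last (l ℚ.* height B) (dot w b) (dot w u)) (cong (ℚ._+ dot w b) (sym (dot-point w l B f)))))) le
          where
          swap-last : ∀ x y z → x ℚ.+ y ℚ.+ z ≡ x ℚ.+ z ℚ.+ y
          swap-last = RingSolver.solve-∀ ℚring
        left≡0 : left ≡ 0ℚ
        left≡0 with exhausted
        ... | inj₁ e = e
        ... | inj₂ z = ℚP.≤-antisym (ℚP.*-cancelʳ-≤-pos (height B) {{ℚ.positive 0<B}}
          (≤-by-difference (0≤+ 0≤u (0≤difference le-left)) (trans (zeros (height B) (left ℚ.* height B) (dot w u)) (cong (λ r → left ℚ.* height B ℚ.+ (dot w u ℚ.+ (0ℚ ℚ.- (left ℚ.* height B ℚ.+ r ℚ.+ dot w u)))) (sym (dot-zero w z)))))) 0≤left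
          where
          zeros : ∀ x y u → 0ℚ ℚ.* x ≡ y ℚ.+ (u ℚ.+ (0ℚ ℚ.- (y ℚ.+ 0ℚ ℚ.+ u)))
          zeros = RingSolver.solve-∀ ℚring
        le′ : dot w u ℚ.+ dot w rest ℚ.≤ 0ℚ
        le′ = ℚP.≤-trans (ℚP.≤-reflexive (trans (zero-first (height B) (dot w u) (dot w rest)) (cong (λ x → x ℚ.* height B ℚ.+ dot w rest ℚ.+ dot w u) (sym left≡0)))) le-left
          where
          zero-first : ∀ x u r → u ℚ.+ r ≡ 0ℚ ℚ.* x ℚ.+ r ℚ.+ u
          zero-first = RingSolver.solve-∀ ℚring
        total : ∀ j → a j ℚ.+ b j ≡ (u j ℚ.+ rest j) ℚ.+ paid j
        total j = begin
          a j ℚ.+ b j                                                    ≡⟨ cong (ℚ._+ b j) (f j) ⟩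
          l ℚ.* vertex B j ℚ.+ u j ℚ.+ b j                               ≡⟨ swap-last (l ℚ.* vertex B j) (u j) (b j) ⟩
          l ℚ.* vertex B j ℚ.+ b j ℚ.+ u j                               ≡⟨ cong (ℚ._+ u j) (balance j) ⟩
          left ℚ.* vertex B j ℚ.+ (rest j ℚ.+ paid j) ℚ.+ u j            ≡⟨ cong (λ x → x ℚ.* vertex B j ℚ.+ (rest j ℚ.+ paid j) ℚ.+ u j) left≡0 ⟩
          0ℚ ℚ.* vertex B j ℚ.+ (rest j ℚ.+ paid j) ℚ.+ u j              ≡⟨ finish (vertex B j) (rest j) (paid j) (u j) ⟩
          (u j ℚ.+ rest j) ℚ.+ paid j                                    ∎
          where
          open ≡-Reasoning
          swap-last : ∀ x y z → x ℚ.+ y ℚ.+ z ≡ x ℚ.+ z ℚ.+ y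
          swap-last = RingSolver.solve-∀ ℚring
          finish : ∀ m r p u → 0ℚ ℚ.* m ℚ.+ (r ℚ.+ p) ℚ.+ u ≡ (u ℚ.+ r) ℚ.+ p
          finish = RingSolver.solve-∀ ℚring

    hull-cut : ∀ {v} → Hull Q v → dot w v ℚ.≤ 0ℚ → Hull Q′ v
    hull-cut h le with partition h
    ... | a , b , ha , hb , e = hull-cong e (pay-off ha hb
      (ℚP.≤-trans (ℚP.≤-reflexive (trans (sym (dot-+ w a b)) (sym (dot-cong w e)))) le))

lookup-exchangeAt : ∀ {n} (B : Subset n) {e f} j → e ∈ B → f ∉ B →
  lookup (exchangeAt B e f) j ≡ (if does (j Fin.≟ f) then true else (if does (j Fin.≟ e) then false else lookup B j))
lookup-exchangeAt B {e} {f} j e∈ f∉ with j Fin.≟ f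
... | yes refl = VP.lookup∘update j (delete B e) inside
... | no j≢f with j Fin.≟ e
...   | yes refl = trans (VP.lookup∘update′ j≢f (delete B e) inside) (VP.lookup∘update j B outside)
...   | no j≢e   = trans (VP.lookup∘update′ j≢f (delete B e) inside) (VP.lookup∘update′ j≢e B outside)

exchange-balance : ∀ {n} {B B′ : Subset n} {e f} → e ∈ B → e ∉ B′ → f ∈ B′ → f ∉ B → ∀ j →
  vertex B j ℚ.+ vertex B′ j ≡ vertex (exchangeAt B e f) j ℚ.+ vertex (exchangeAt B′ f e) j
exchange-balance e∈ e∉ f∈ f∉ zero = refl
exchange-balance {B = B} {B′} {e} {f} e∈ e∉ f∈ f∉ (suc j)
  rewrite lookup-exchangeAt B j e∈ f∉ | lookup-exchangeAt B′ j f∈ e∉ with j Fin.≟ f | j Fin.≟ e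
... | yes refl | yes refl = contradiction e∈ f∉
... | yes refl | no _     rewrite ∉⇒lookup f∉ | ∈⇒lookup f∈ = refl
... | no _     | yes refl rewrite ∉⇒lookup e∉ | ∈⇒lookup e∈ = refl
... | no _     | no _     = refl

module _ {n : ℕ} (F : Subset n) (r k : ℕ) where
  OnHyperplane : Subset n → Set
  OnHyperplane S = ∣ S ∣ ≡ k × ∣ S ∩ F ∣ ≡ r

  -- Exchanging e ∈ B ∩ F with f ∈ B′ ∖ F gives B₁, B₁′ one step closer to the hyperplane, with
  -- B + B′ = B₁ + B₁′.  For weights p, q ≥ 1 this yields the recursion
  -- (p + q − 1)(p B′ + q B) = p ((p − 1) B′ + q B₁) + q (p B₁′ + (q − 1) B).
  hyperplane-crossing : ∀ p q {B B′} → ∣ B ∣ ≡ k → ∣ B′ ∣ ≡ k → ∣ B ∩ F ∣ ≡ r + p → ∣ B′ ∩ F ∣ + q ≡ r →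
    Hull OnHyperplane (λ j → fromℕ p ℚ.* vertex B′ j ℚ.+ fromℕ q ℚ.* vertex B j)
  hyperplane-crossing zero q {B} {B′} B≡k B′≡k B≡ B′≡ = hull-cong (λ j → ring (vertex B′ j) _)
    (hull-vertex (fromℕ q) B (0≤fromℕ q) (B≡k , trans B≡ (+-identityʳ r)))
    where
    ring : ∀ a b → 0ℚ ℚ.* a ℚ.+ b ≡ b
    ring = RingSolver.solve-∀ ℚring
  hyperplane-crossing (suc p) zero {B} {B′} B≡k B′≡k B≡ B′≡ = hull-cong (λ j → ring (vertex B j) (fromℕ (suc p) ℚ.* vertex B′ j))
    (hull-vertex (fromℕ (suc p)) B′ (0≤fromℕ (suc p)) (B′≡k , trans (sym (+-identityʳ _)) B′≡))
    where
    ring : ∀ a b → b ℚ.+ 0ℚ ℚ.* a ≡ b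
    ring = RingSolver.solve-∀ ℚring
  hyperplane-crossing (suc p) (suc q) {B} {B′} B≡k B′≡k B≡ B′≡
    with ∣∩<∩∣⇒∃ B′ B F more-inside | ∣∩<∩∣⇒∃ B B′ (∁ F) more-outside
    where
    more-inside : ∣ B′ ∩ F ∣ < ∣ B ∩ F ∣
    more-inside = begin-strict
      ∣ B′ ∩ F ∣          ≤⟨ m≤m+n _ (suc q) ⟩
      ∣ B′ ∩ F ∣ + suc q  ≡⟨ B′≡ ⟩
      r                   <⟨ m<m+n r (s≤s z≤n) ⟩
      r + suc p           ≡⟨ B≡ ⟨
      ∣ B ∩ F ∣           ∎
      where open ≤-Reasoning
    more-outside : ∣ B ∩ ∁ F ∣ < ∣ B′ ∩ ∁ F ∣
    more-outside = +-cancelˡ-< (∣ B ∩ F ∣) _ _ (begin-strict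
      ∣ B ∩ F ∣ + ∣ B ∩ ∁ F ∣     ≡⟨ trans (∣∩∁∣ B F) (trans B≡k (sym (trans (∣∩∁∣ B′ F) B′≡k))) ⟩
      ∣ B′ ∩ F ∣ + ∣ B′ ∩ ∁ F ∣   <⟨ +-monoˡ-< _ more-inside ⟩
      ∣ B ∩ F ∣ + ∣ B′ ∩ ∁ F ∣    ∎)
      where open ≤-Reasoning
  ... | e , e∈B , e∉B′ , e∈F | f , f∈B′ , f∉B , f∈∁F
    with ∃-quotient 0≤1 (ℚP.<-≤-trans (ℚP.positive⁻¹ 1ℚ) (ℚP.≤-trans (ℚP.≤-reflexive (sym (ℚP.+-identityʳ 1ℚ))) (ℚP.+-monoʳ-≤ 1ℚ (0≤fromℕ (p + q)))))
  ...   | c , 0≤c , c*[1+p+q]≡1 = hull-cong combine (hull-* c 0≤c (hull-+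
          (hull-* (fromℕ (suc p)) (0≤fromℕ (suc p)) (hyperplane-crossing p (suc q) {exchangeAt B e f} {B′} (trans (∣exchangeAt∣ B e∈B f∉B) B≡k) B′≡k B₁≡ B′≡))
          (hull-* (fromℕ (suc q)) (0≤fromℕ (suc q)) (hyperplane-crossing (suc p) q {B} {exchangeAt B′ f e} B≡k (trans (∣exchangeAt∣ B′ f∈B′ e∉B′) B′≡k) B≡ B₁′≡))))
    where
    f∉F : f ∉ F
    f∉F = SP.x∈∁p⇒x∉p f∈∁F
    B₁≡ : ∣ exchangeAt B e f ∩ F ∣ ≡ r + p
    B₁≡ = suc-injective (trans (subst₂ (λ a b → a + ∣ exchangeAt B e f ∩ F ∣ ≡ b + ∣ B ∩ F ∣) (weight-∈ e∈F) (weight-∉ f∉F) (∣exchangeAt∣∩ B F e∈B f∉B)) (trans B≡ (+-suc r p)))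
    B₁′≡ : ∣ exchangeAt B′ f e ∩ F ∣ + q ≡ r
    B₁′≡ = trans (cong (_+ q) (subst₂ (λ a b → a + ∣ exchangeAt B′ f e ∩ F ∣ ≡ b + ∣ B′ ∩ F ∣) (weight-∉ f∉F) (weight-∈ e∈F) (∣exchangeAt∣∩ B′ F f∈B′ e∉B′)))
      (trans (sym (+-suc _ q)) B′≡)
    combine : ∀ j → fromℕ (suc p) ℚ.* vertex B′ j ℚ.+ fromℕ (suc q) ℚ.* vertex B j ≡
      c ℚ.* (fromℕ (suc p) ℚ.* (fromℕ p ℚ.* vertex B′ j ℚ.+ fromℕ (suc q) ℚ.* vertex (exchangeAt B e f) j)
        ℚ.+ fromℕ (suc q) ℚ.* (fromℕ (suc p) ℚ.* vertex (exchangeAt B′ f e) j ℚ.+ fromℕ q ℚ.* vertex B j))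
    combine j = sym (begin
      _                                      ≡⟨ ring₁ c (fromℕ p) (fromℕ q) (vertex B j) (vertex B′ j) (vertex (exchangeAt B e f) j) (vertex (exchangeAt B′ f e) j) ⟩
      c ℚ.* (X (vertex (exchangeAt B e f) j ℚ.+ vertex (exchangeAt B′ f e) j)) ≡⟨ cong (λ z → c ℚ.* X z) (exchange-balance e∈B e∉B′ f∈B′ f∉B j) ⟨
      c ℚ.* (X (vertex B j ℚ.+ vertex B′ j)) ≡⟨ ring₂ c (fromℕ p) (fromℕ q) (vertex B j) (vertex B′ j) ⟩
      c ℚ.* (1ℚ ℚ.+ (fromℕ p ℚ.+ fromℕ q)) ℚ.* Y  ≡⟨ cong (λ z → c ℚ.* (1ℚ ℚ.+ z) ℚ.* Y) (fromℕ-+ p q) ⟨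
      c ℚ.* (1ℚ ℚ.+ fromℕ (p + q)) ℚ.* Y          ≡⟨ cong (ℚ._* Y) c*[1+p+q]≡1 ⟩
      1ℚ ℚ.* Y                                    ≡⟨ ℚP.*-identityˡ Y ⟩
      Y                                           ∎)
      where
      open ≡-Reasoning
      X : ℚ → ℚ
      X z = (1ℚ ℚ.+ fromℕ p) ℚ.* (1ℚ ℚ.+ fromℕ q) ℚ.* z ℚ.+ ((1ℚ ℚ.+ fromℕ p) ℚ.* fromℕ p ℚ.* vertex B′ j ℚ.+ (1ℚ ℚ.+ fromℕ q) ℚ.* fromℕ q ℚ.* vertex B j)
      Y : ℚ
      Y = (1ℚ ℚ.+ fromℕ p) ℚ.* vertex B′ j ℚ.+ (1ℚ ℚ.+ fromℕ q) ℚ.* vertex B j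
      ring₁ : ∀ c p q b b′ b₁ b₁′ → c ℚ.* ((1ℚ ℚ.+ p) ℚ.* (p ℚ.* b′ ℚ.+ (1ℚ ℚ.+ q) ℚ.* b₁) ℚ.+ (1ℚ ℚ.+ q) ℚ.* ((1ℚ ℚ.+ p) ℚ.* b₁′ ℚ.+ q ℚ.* b)) ≡
        c ℚ.* ((1ℚ ℚ.+ p) ℚ.* (1ℚ ℚ.+ q) ℚ.* (b₁ ℚ.+ b₁′) ℚ.+ ((1ℚ ℚ.+ p) ℚ.* p ℚ.* b′ ℚ.+ (1ℚ ℚ.+ q) ℚ.* q ℚ.* b))
      ring₁ = RingSolver.solve-∀ ℚring
      ring₂ : ∀ c p q b b′ → c ℚ.* ((1ℚ ℚ.+ p) ℚ.* (1ℚ ℚ.+ q) ℚ.* (b ℚ.+ b′) ℚ.+ ((1ℚ ℚ.+ p) ℚ.* p ℚ.* b′ ℚ.+ (1ℚ ℚ.+ q) ℚ.* q ℚ.* b)) ≡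
        c ℚ.* (1ℚ ℚ.+ (p ℚ.+ q)) ℚ.* ((1ℚ ℚ.+ p) ℚ.* b′ ℚ.+ (1ℚ ℚ.+ q) ℚ.* b)
      ring₂ = RingSolver.solve-∀ ℚring

  plane : Fin (suc n) → ℚ
  plane zero    = ℚ.- fromℕ r
  plane (suc j) = indicator (lookup F j)

  -- The functional x ↦ x(F) − r, homogenized.
  excess : (Fin (suc n) → ℚ) → ℚ
  excess = dot plane

  excess-vertex : ∀ B → excess (vertex B) ≡ fromℕ ∣ B ∩ F ∣ ℚ.- fromℕ r
  excess-vertex B = trans (cong (λ z → (ℚ.- fromℕ r) ℚ.* 1ℚ ℚ.+ z) (dot-indicators F B)) (ring (fromℕ r) (fromℕ ∣ B ∩ F ∣))
    where
    ring : ∀ a b → (ℚ.- a) ℚ.* 1ℚ ℚ.+ b ≡ b ℚ.- a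
    ring = RingSolver.solve-∀ ℚring

  excess-above : ∀ {B p} → ∣ B ∩ F ∣ ≡ r + p → excess (vertex B) ≡ fromℕ p
  excess-above {B} {p} e = trans (excess-vertex B) (trans (cong (ℚ._- fromℕ r) (trans (cong fromℕ e) (fromℕ-+ r p))) (ring (fromℕ r) (fromℕ p)))
    where
    ring : ∀ a b → (a ℚ.+ b) ℚ.- a ≡ b
    ring = RingSolver.solve-∀ ℚring

  excess-below : ∀ {B q} → ∣ B ∩ F ∣ + q ≡ r → ℚ.- excess (vertex B) ≡ fromℕ q
  excess-below {B} {q} e = trans (cong ℚ.-_ (excess-vertex B)) (trans (cong (λ z → ℚ.- (fromℕ ∣ B ∩ F ∣ ℚ.- z)) (trans (cong fromℕ (sym e)) (fromℕ-+ ∣ B ∩ F ∣ q))) (ring (fromℕ ∣ B ∩ F ∣) (fromℕ q)))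
    where
    ring : ∀ a b → ℚ.- (a ℚ.- (a ℚ.+ b)) ≡ b
    ring = RingSolver.solve-∀ ℚring

  excess-≤0 : ∀ {B} → ∣ B ∩ F ∣ ≤ r → excess (vertex B) ℚ.≤ 0ℚ
  excess-≤0 {B} le = ≤-by-difference {d = fromℕ r ℚ.- fromℕ ∣ B ∩ F ∣} (0≤difference (fromℕ-mono le))
    (sym (trans (cong (ℚ._+ (fromℕ r ℚ.- fromℕ ∣ B ∩ F ∣)) (excess-vertex B)) (ring (fromℕ r) (fromℕ ∣ B ∩ F ∣))))
    where
    ring : ∀ a b → (b ℚ.- a) ℚ.+ (a ℚ.- b) ≡ 0ℚ
    ring = RingSolver.solve-∀ ℚring

  0≤excess : ∀ {B} → r ≤ ∣ B ∩ F ∣ → 0ℚ ℚ.≤ excess (vertex B)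
  0≤excess {B} le = subst (0ℚ ℚ.≤_) (sym (excess-vertex B)) (0≤difference (fromℕ-mono le))

  excess-≤0⁻ : ∀ {B} → excess (vertex B) ℚ.≤ 0ℚ → ∣ B ∩ F ∣ ≤ r
  excess-≤0⁻ {B} le with ∣ B ∩ F ∣ ≤? r
  ... | yes p = p
  ... | no ¬p with m≤n⇒∃[o]m+o≡n (≰⇒> ¬p)
  ...   | o , e = contradiction (fromℕ-cancel-≤ {suc o} {0} (subst (ℚ._≤ 0ℚ) (excess-above {B} (sym (trans (+-suc r o) e))) le)) λ ()

  0≤excess⁻ : ∀ {B} → 0ℚ ℚ.≤ excess (vertex B) → r ≤ ∣ B ∩ F ∣
  0≤excess⁻ {B} le with r ≤? ∣ B ∩ F ∣
  ... | yes p = p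
  ... | no ¬p with m≤n⇒∃[o]m+o≡n (≰⇒> ¬p)
  ...   | o , e = contradiction (fromℕ-cancel-≤ {suc o} {0} (subst (ℚ._≤ 0ℚ) (excess-below {B} (trans (+-suc _ o) e)) (ℚP.neg-antimono-≤ le))) λ ()

  private
    crossing-of : ∀ {B B′} → ∣ B ∣ ≡ k → ∣ B′ ∣ ≡ k → 0ℚ ℚ.< excess (vertex B) → excess (vertex B′) ℚ.< 0ℚ →
      Hull OnHyperplane (λ j → excess (vertex B) ℚ.* vertex B′ j ℚ.+ (ℚ.- excess (vertex B′)) ℚ.* vertex B j)
    crossing-of {B} {B′} B≡k B′≡k 0<B B′<0
      with m≤n⇒∃[o]m+o≡n (0≤excess⁻ {B} (ℚP.<⇒≤ 0<B)) | m≤n⇒∃[o]m+o≡n (excess-≤0⁻ {B′} (ℚP.<⇒≤ B′<0))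
    ... | p , ep | q , eq = hull-cong
      (λ j → cong₂ (λ x y → x ℚ.* vertex B′ j ℚ.+ y ℚ.* vertex B j) (excess-above {B} (sym ep)) (excess-below {B′} eq))
      (hyperplane-crossing p q {B} {B′} B≡k B′≡k (sym ep) eq)

  -- Integrality of the cut: each crossing point of two `k`-sets is by `hyperplane-crossing` a
  -- combination of `k`-sets on the hyperplane. So `Q′` only has to contain these and the surviving
  -- part of `Q`, and no fractional vertices arise.
  cut-above : ∀ {Q Q′ : Subset n → Set} {v} → (∀ {B} → Q B → ∣ B ∣ ≡ k) → (∀ {B} → Q B → ∣ B ∩ F ∣ ≤ r → Q′ B) →
    (∀ {B} → OnHyperplane B → Q′ B) → Hull Q v → excess v ℚ.≤ 0ℚ → Hull Q′ v
  cut-above card keep on-plane = HullCut.hull-cut plane (λ {B} q le → keep q (excess-≤0⁻ {B} le))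
    (λ {B} {B′} q q′ 0<B B′<0 → hull-mono on-plane (crossing-of {B} {B′} (card q) (card q′) 0<B B′<0))

  cut-below : ∀ {Q Q′ : Subset n → Set} {v} → (∀ {B} → Q B → ∣ B ∣ ≡ k) → (∀ {B} → Q B → r ≤ ∣ B ∩ F ∣ → Q′ B) →
    (∀ {B} → OnHyperplane B → Q′ B) → Hull Q v → 0ℚ ℚ.≤ excess v → Hull Q′ v
  cut-below {Q} {Q′} {v} card keep on-plane h 0≤ = HullCut.hull-cut -w
    (λ {B} q le → keep q (0≤excess⁻ {B} (neg-≤0 (subst (ℚ._≤ 0ℚ) (dot-neg plane (vertex B)) le))))
    (λ {B} {B′} q q′ 0<B B′<0 → hull-cong
      (λ j → trans (cong₂ (λ x y → x ℚ.* vertex B′ j ℚ.+ (ℚ.- y) ℚ.* vertex B j) (dot-neg plane (vertex B)) (dot-neg plane (vertex B′)))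
        (ring (excess (vertex B)) (excess (vertex B′)) (vertex B′ j) (vertex B j)))
      (hull-mono on-plane (crossing-of {B′} {B} (card q′) (card q)
        (neg-<0 (subst (ℚ._< 0ℚ) (dot-neg plane (vertex B′)) B′<0)) (0<neg (subst (0ℚ ℚ.<_) (dot-neg plane (vertex B)) 0<B)))))
    h (subst (ℚ._≤ 0ℚ) (sym (dot-neg plane v)) (ℚP.neg-antimono-≤ 0≤))
    where
    -w : Fin (suc n) → ℚ
    -w j = ℚ.- plane j
    dot-neg : ∀ {m} (u v : Fin m → ℚ) → dot (λ j → ℚ.- u j) v ≡ ℚ.- dot u v
    dot-neg {zero}  u v = refl
    dot-neg {suc m} u v = trans (cong ((ℚ.- u zero) ℚ.* v zero ℚ.+_) (dot-neg (u ∘ suc) (v ∘ suc))) (neg-out (u zero) (v zero) (dot (u ∘ suc) (v ∘ suc)))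
      where
      neg-out : ∀ a b c → (ℚ.- a) ℚ.* b ℚ.+ (ℚ.- c) ≡ ℚ.- (a ℚ.* b ℚ.+ c)
      neg-out = RingSolver.solve-∀ ℚring
    double-neg : ∀ a → ℚ.- (ℚ.- a) ≡ a
    double-neg = RingSolver.solve-∀ ℚring
    neg-≤0 : ∀ {a} → ℚ.- a ℚ.≤ 0ℚ → 0ℚ ℚ.≤ a
    neg-≤0 {a} le = subst (0ℚ ℚ.≤_) (double-neg a) (ℚP.neg-antimono-≤ le)
    neg-<0 : ∀ {a} → ℚ.- a ℚ.< 0ℚ → 0ℚ ℚ.< a
    neg-<0 {a} lt = subst (0ℚ ℚ.<_) (double-neg a) (ℚP.neg-antimono-< lt)
    0<neg : ∀ {a} → 0ℚ ℚ.< ℚ.- a → a ℚ.< 0ℚ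
    0<neg {a} lt = subst (ℚ._< 0ℚ) (double-neg a) (ℚP.neg-antimono-< lt)
    ring : ∀ x y b′ b → (ℚ.- x) ℚ.* b′ ℚ.+ (ℚ.- (ℚ.- y)) ℚ.* b ≡ y ℚ.* b ℚ.+ (ℚ.- x) ℚ.* b′
    ring = RingSolver.solve-∀ ℚring

-- Base polytopes and band matroids

module _ {n : ℕ} where
  homogenize : (Fin n → ℚ) → Fin (suc n) → ℚ
  homogenize x zero    = 1ℚ
  homogenize x (suc j) = x j

  private
    marginal : List ℚ → List (Subset n) → Fin (suc n) → ℚ
    marginal λs Bs zero    = sumℚ λs
    marginal λs Bs (suc j) = sumℚ (zipWith (λ l B → if lookup B j then l else 0ℚ) λs Bs)

    marginal-∷ : ∀ l λs B Bs j → marginal (l ∷ λs) (B ∷ Bs) j ≡ l ℚ.* vertex B j ℚ.+ marginal λs Bs j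
    marginal-∷ l λs B Bs zero = cong (ℚ._+ sumℚ λs) (sym (ℚP.*-identityʳ l))
    marginal-∷ l λs B Bs (suc j) with lookup B j
    ... | true  = cong (ℚ._+ marginal λs Bs (suc j)) (sym (ℚP.*-identityʳ l))
    ... | false = cong (ℚ._+ marginal λs Bs (suc j)) (sym (ℚP.*-zeroʳ l))

    weights⇒hull : ∀ {Q : Subset n → Set} λs Bs → length λs ≡ length Bs → All (0ℚ ℚ.≤_) λs → (∀ {B} → B ∈ᴸ Bs → Q B) → Hull Q (marginal λs Bs)
    weights⇒hull [] [] _ _ _ = none λ { zero → refl ; (suc j) → refl }
    weights⇒hull (l ∷ λs) (B ∷ Bs) len (0≤l ∷ 0≤λs) q =
      point l B 0≤l (q (here refl)) (weights⇒hull λs Bs (suc-injective len) 0≤λs (q ∘ there)) (marginal-∷ l λs B Bs)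

    Weights : List (Subset n) → (Fin (suc n) → ℚ) → Set
    Weights Bs v = ∃[ λs ] (length λs ≡ length Bs × All (0ℚ ℚ.≤_) λs × (∀ j → marginal λs Bs j ≡ v j))

    zero-weights : ∀ Bs → Weights Bs (λ _ → 0ℚ)
    zero-weights [] = [] , refl , [] , λ { zero → refl ; (suc j) → refl }
    zero-weights (B ∷ Bs) with zero-weights Bs
    ... | λs , len , 0≤λs , e = 0ℚ ∷ λs , cong suc len , ℚP.≤-refl ∷ 0≤λs ,
      λ j → trans (marginal-∷ 0ℚ λs B Bs j) (trans (cong₂ ℚ._+_ (ℚP.*-zeroˡ (vertex B j)) (e j)) (ℚP.+-identityʳ 0ℚ))

    -- A `Hull` may use a vertex repeatedly, whereas `_∈P_` allots one weight to each position of
    -- the list. The new weight is added at the position named by the membership proof.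
    add-weight : ∀ {Bs B v} l → 0ℚ ℚ.≤ l → B ∈ᴸ Bs → Weights Bs v → Weights Bs (λ j → l ℚ.* vertex B j ℚ.+ v j)
    add-weight {B ∷ Bs} {v = v} l 0≤l (here refl) (m ∷ λs , len , 0≤m ∷ 0≤λs , e) = l ℚ.+ m ∷ λs , len , 0≤+ 0≤l 0≤m ∷ 0≤λs ,
      λ j → trans (marginal-∷ (l ℚ.+ m) λs B Bs j) (trans (ring l m (vertex B j) (marginal λs Bs j))
        (cong (l ℚ.* vertex B j ℚ.+_) (trans (sym (marginal-∷ m λs B Bs j)) (e j))))
      where
      ring : ∀ l m b x → (l ℚ.+ m) ℚ.* b ℚ.+ x ≡ l ℚ.* b ℚ.+ (m ℚ.* b ℚ.+ x)
      ring = RingSolver.solve-∀ ℚring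
    add-weight {C ∷ Bs} {B} {v} l 0≤l (there B∈) (m ∷ λs , len , 0≤m ∷ 0≤λs , e)
      with add-weight {Bs} {B} l 0≤l B∈ (λs , suc-injective len , 0≤λs , λ _ → refl)
    ... | μs , len′ , 0≤μs , e′ = m ∷ μs , cong suc len′ , 0≤m ∷ 0≤μs ,
      λ j → trans (marginal-∷ m μs C Bs j) (trans (cong (m ℚ.* vertex C j ℚ.+_) (e′ j)) (trans (ring (m ℚ.* vertex C j) (l ℚ.* vertex B j) (marginal λs Bs j))
        (cong (l ℚ.* vertex B j ℚ.+_) (trans (sym (marginal-∷ m λs C Bs j)) (e j)))))
      where
      ring : ∀ a b c → a ℚ.+ (b ℚ.+ c) ≡ b ℚ.+ (a ℚ.+ c)
      ring = RingSolver.solve-∀ ℚring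

    hull⇒weights : ∀ {Bs v} → Hull (_∈ᴸ Bs) v → Weights Bs v
    hull⇒weights {Bs} (none z) with zero-weights Bs
    ... | λs , len , 0≤λs , e = λs , len , 0≤λs , λ j → trans (e j) (sym (z j))
    hull⇒weights {Bs} (point {u} l B 0≤l B∈ h f) with add-weight {v = u} l 0≤l B∈ (hull⇒weights h)
    ... | λs , len , 0≤λs , e = λs , len , 0≤λs , λ j → trans (e j) (sym (f j))

  ∈P⇒hull : ∀ {M : Matroid n} {x} → x ∈P M → Hull (IsBase M) (homogenize x)
  ∈P⇒hull {M} (λs , len , 0≤λs , total , coords) =
    hull-cong (λ { zero → sym total ; (suc j) → sym (coords j) }) (weights⇒hull λs (bases M) len 0≤λs id)

  hull⇒∈P : ∀ {M : Matroid n} {x} → Hull (IsBase M) (homogenize x) → x ∈P M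
  hull⇒∈P h with hull⇒weights h
  ... | λs , len , 0≤λs , e = λs , len , 0≤λs , e zero , (e ∘ suc)

allSubsets-complete : ∀ {n} (S : Subset n) → S ∈ᴸ allSubsets n
allSubsets-complete []          = here refl
allSubsets-complete (false ∷ S) = MP.∈-++⁺ˡ (MP.∈-map⁺ (false ∷_) (allSubsets-complete S))
allSubsets-complete {suc n} (true ∷ S) = MP.∈-++⁺ʳ (map (false ∷_) (allSubsets n)) (MP.∈-map⁺ (true ∷_) (allSubsets-complete S))

allSubsets-unique : ∀ n → Unique (allSubsets n)
allSubsets-unique zero    = [] ∷ []
allSubsets-unique (suc n) = UP.++⁺ (UP.map⁺ VP.∷-injectiveʳ (allSubsets-unique n)) (UP.map⁺ VP.∷-injectiveʳ (allSubsets-unique n))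
  λ (x∈ , y∈) → heads-differ (MP.∈-map⁻ (false ∷_) x∈) (MP.∈-map⁻ (true ∷_) y∈)
  where
  heads-differ : ∀ {S : Subset (suc n)} → ∃[ X ] (X ∈ᴸ allSubsets n × S ≡ false ∷ X) → ¬ (∃[ Y ] (Y ∈ᴸ allSubsets n × S ≡ true ∷ Y))
  heads-differ (_ , _ , refl) (_ , _ , ())

_≟ˢ_ : ∀ {n} → DecidableEquality (Subset n)
_≟ˢ_ = VP.≡-dec Bool._≟_

-- One family for all matroids of the subdivision: `a = b` gives a direct sum of two uniform
-- matroids, `b = n` a cuspidal matroid, and the full set with bounds 0 and `n` a uniform matroid.
module Band {n : ℕ} (F : Subset n) (a b k : ℕ) where
  InBand : Subset n → Set
  InBand S = ∣ S ∣ ≡ k × a ≤ ∣ S ∩ F ∣ × ∣ S ∩ F ∣ ≤ b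

  in-band? : ∀ S → Dec (InBand S)
  in-band? S = (∣ S ∣ ≟ k) ×-dec (a ≤? ∣ S ∩ F ∣) ×-dec (∣ S ∩ F ∣ ≤? b)

  band-bases : List (Subset n)
  band-bases = filter in-band? (allSubsets n)

  InBand⇒∈ : ∀ {B} → InBand B → B ∈ᴸ band-bases
  InBand⇒∈ {B} q = MP.∈-filter⁺ in-band? (allSubsets-complete B) q

  ∈⇒InBand : ∀ {B} → B ∈ᴸ band-bases → InBand B
  ∈⇒InBand B∈ = proj₂ (MP.∈-filter⁻ in-band? {xs = allSubsets n} B∈)

  private
    more-than-common : ∀ {B₁ B₂ : Subset n} (T : Subset n) {x} → x ∈ B₁ → x ∉ B₂ → x ∈ T →
      ¬ (∃[ y ] (y ∈ B₂ × y ∉ B₁ × y ∈ T)) → ∣ B₂ ∩ T ∣ < ∣ B₁ ∩ T ∣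
    more-than-common {B₁} {B₂} T {x} x∈ x∉ x∈T none-in-T = SP.p⊂q⇒∣p∣<∣q∣
      ((λ {y} y∈ → let (y∈B₂ , y∈T) = SP.x∈p∩q⁻ B₂ T y∈ in SP.x∈p∩q⁺ (in-B₁ y y∈B₂ y∈T , y∈T))
      , x , SP.x∈p∩q⁺ (x∈ , x∈T) , λ x∈B₂∩T → x∉ (proj₁ (SP.x∈p∩q⁻ B₂ T x∈B₂∩T)))
      where
      in-B₁ : ∀ y → y ∈ B₂ → y ∈ T → y ∈ B₁
      in-B₁ y y∈B₂ y∈T with y SP.∈? B₁
      ... | yes p = p
      ... | no y∉ = contradiction (y , y∈B₂ , y∉ , y∈T) none-in-T

    search : ∀ (B₁ B₂ T : Subset n) → Dec (∃[ y ] (y ∈ B₂ × y ∉ B₁ × y ∈ T))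
    search B₁ B₂ T = FP.any? λ y → (y SP.∈? B₂) ×-dec ¬? (y SP.∈? B₁) ×-dec (y SP.∈? T)

    other-side : ∀ {B₁ B₂ T : Subset n} → ∣ B₁ ∣ ≡ ∣ B₂ ∣ → ∣ B₂ ∩ T ∣ < ∣ B₁ ∩ T ∣ → ∣ B₁ ∩ ∁ T ∣ < ∣ B₂ ∩ ∁ T ∣
    other-side {B₁} {B₂} {T} e lt = +-cancelˡ-< (∣ B₂ ∩ T ∣) _ _ (≤-trans (+-monoˡ-< _ lt)
      (≤-reflexive (trans (∣∩∁∣ B₁ T) (trans e (sym (∣∩∁∣ B₂ T))))))

    same-side : ∀ {B₁ B₂ T : Subset n} → ∣ B₁ ∣ ≡ ∣ B₂ ∣ → ∣ B₂ ∩ ∁ T ∣ < ∣ B₁ ∩ ∁ T ∣ → ∣ B₁ ∩ T ∣ < ∣ B₂ ∩ T ∣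
    same-side {B₁} {B₂} {T} e lt = +-cancelʳ-< (∣ B₂ ∩ ∁ T ∣) _ _ (≤-trans (+-monoʳ-< (∣ B₁ ∩ T ∣) lt)
      (≤-reflexive (trans (∣∩∁∣ B₁ T) (trans e (sym (∣∩∁∣ B₂ T))))))

  -- Exchange within F or within its complement keeps |B ∩ F|; if that is impossible, then the
  -- exchange moves |B₁ ∩ F| towards |B₂ ∩ F|.
  band-exchange : ∀ B₁ B₂ → InBand B₁ → InBand B₂ → ∀ x → x ∈ B₁ → x ∉ B₂ →
    ∃[ y ] (y ∈ B₂ × y ∉ B₁ × InBand (exchangeAt B₁ x y))
  band-exchange B₁ B₂ (c₁ , a₁ , b₁) (c₂ , a₂ , b₂) x x∈ x∉ with weight-cases F x
  ... | inj₁ (x∈F , wx) with search B₁ B₂ F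
  ...   | yes (y , y∈ , y∉ , y∈F) = y , y∈ , y∉ , trans (∣exchangeAt∣ B₁ x∈ y∉) c₁ ,
          subst (a ≤_) (sym same) a₁ , subst (_≤ b) (sym same) b₁
    where
    same : ∣ exchangeAt B₁ x y ∩ F ∣ ≡ ∣ B₁ ∩ F ∣
    same = suc-injective (subst₂ (λ p q → p + ∣ exchangeAt B₁ x y ∩ F ∣ ≡ q + ∣ B₁ ∩ F ∣) wx (weight-∈ y∈F) (∣exchangeAt∣∩ B₁ F x∈ y∉))
  ...   | no none-in-F with ∣∩<∩∣⇒∃ B₁ B₂ (∁ F) (other-side {B₁} {B₂} {F} (trans c₁ (sym c₂)) (more-than-common F x∈ x∉ x∈F none-in-F))
  ...     | y , y∈ , y∉ , y∈∁F = y , y∈ , y∉ , trans (∣exchangeAt∣ B₁ x∈ y∉) c₁ ,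
            ≤-trans a₂ (≤-pred (≤-trans (more-than-common F x∈ x∉ x∈F none-in-F) (≤-reflexive (sym drop)))) ,
            ≤-trans (≤-trans (n≤1+n _) (≤-reflexive drop)) b₁
    where
    drop : suc ∣ exchangeAt B₁ x y ∩ F ∣ ≡ ∣ B₁ ∩ F ∣
    drop = subst₂ (λ p q → p + ∣ exchangeAt B₁ x y ∩ F ∣ ≡ q + ∣ B₁ ∩ F ∣) wx (weight-∉ (SP.x∈∁p⇒x∉p y∈∁F)) (∣exchangeAt∣∩ B₁ F x∈ y∉)
  band-exchange B₁ B₂ (c₁ , a₁ , b₁) (c₂ , a₂ , b₂) x x∈ x∉ | inj₂ (x∉F , wx) with search B₁ B₂ (∁ F)
  ...   | yes (y , y∈ , y∉ , y∈∁F) = y , y∈ , y∉ , trans (∣exchangeAt∣ B₁ x∈ y∉) c₁ ,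
          subst (a ≤_) (sym same) a₁ , subst (_≤ b) (sym same) b₁
    where
    same : ∣ exchangeAt B₁ x y ∩ F ∣ ≡ ∣ B₁ ∩ F ∣
    same = subst₂ (λ p q → p + ∣ exchangeAt B₁ x y ∩ F ∣ ≡ q + ∣ B₁ ∩ F ∣) wx (weight-∉ (SP.x∈∁p⇒x∉p y∈∁F)) (∣exchangeAt∣∩ B₁ F x∈ y∉)
  ...   | no none-outside with ∣∩<∩∣⇒∃ B₁ B₂ F (same-side {B₁} {B₂} {F} (trans c₁ (sym c₂)) (more-than-common (∁ F) x∈ x∉ (SP.x∉p⇒x∈∁p x∉F) none-outside))
  ...     | y , y∈ , y∉ , y∈F = y , y∈ , y∉ , trans (∣exchangeAt∣ B₁ x∈ y∉) c₁ ,
            ≤-trans a₁ (≤-trans (n≤1+n _) (≤-reflexive (sym rise))) ,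
            ≤-trans (≤-reflexive rise) (≤-trans fewer-inside b₂)
    where
    fewer-inside : ∣ B₁ ∩ F ∣ < ∣ B₂ ∩ F ∣
    fewer-inside = same-side {B₁} {B₂} {F} (trans c₁ (sym c₂)) (more-than-common (∁ F) x∈ x∉ (SP.x∉p⇒x∈∁p x∉F) none-outside)
    rise : ∣ exchangeAt B₁ x y ∩ F ∣ ≡ suc ∣ B₁ ∩ F ∣
    rise = subst₂ (λ p q → p + ∣ exchangeAt B₁ x y ∩ F ∣ ≡ q + ∣ B₁ ∩ F ∣) wx (weight-∈ y∈F) (∣exchangeAt∣∩ B₁ F x∈ y∉)

  private
    some-band? : Dec (∃[ B ] (InBand B))
    some-band? = SP.anySubset? in-band?

  -- Junk value outside the nonempty case: the matroid whose only base is empty.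
  bandMatroid : Matroid n
  bandMatroid with some-band?
  ... | yes (B , q) = record
    { bases = band-bases ; nonempty = B , InBand⇒∈ q
    ; exchange = λ B₁ B₂ B₁∈ B₂∈ x x∈ x∉ → let (y , y∈ , y∉ , q) = band-exchange B₁ B₂ (∈⇒InBand B₁∈) (∈⇒InBand B₂∈) x x∈ x∉ in
        y , y∈ , y∉ , InBand⇒∈ q }
  ... | no _ = record
    { bases = Sub.⊥ ∷ [] ; nonempty = Sub.⊥ , here refl
    ; exchange = λ { _ _ (here refl) _ x x∈ _ → contradiction x∈ SP.∉⊥ } }

  bandMatroid-bases : ∀ {B} → InBand B → bases bandMatroid ≡ band-bases
  bandMatroid-bases {B} q with some-band?
  ... | yes _ = refl
  ... | no ¬q = contradiction (B , q) ¬q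

  base⇒InBand : ∀ {B₀} → InBand B₀ → ∀ {B} → IsBase bandMatroid B → InBand B
  base⇒InBand {B₀} q {B} B∈ = ∈⇒InBand (subst (B ∈ᴸ_) (bandMatroid-bases {B₀} q) B∈)

  InBand⇒base : ∀ {B} → InBand B → IsBase bandMatroid B
  InBand⇒base {B} q = subst (B ∈ᴸ_) (sym (bandMatroid-bases {B} q)) (InBand⇒∈ q)

  rank-band : ∀ {B} → InBand B → rank bandMatroid ≡ k
  rank-band {B} q = trans (sym (∣base∣≡rank bandMatroid (InBand⇒base {B} q))) (proj₁ q)

-- The subdivision of a hypersimplex

hull-dots-≤0 : ∀ {n} {Q : Subset n → Set} {v} (w w′ : Fin (suc n) → ℚ) →
  (∀ {B} → Q B → dot w (vertex B) ℚ.+ dot w′ (vertex B) ℚ.≤ 0ℚ) → Hull Q v → dot w v ℚ.+ dot w′ v ℚ.≤ 0ℚ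
hull-dots-≤0 w w′ le (none z) = ℚP.≤-reflexive (trans (cong₂ ℚ._+_ (dot-zero w z) (dot-zero w′ z)) (ℚP.+-identityʳ 0ℚ))
hull-dots-≤0 {v = v} w w′ le (point {u} l B 0≤l q h f) = ≤-by-difference
  (0≤+ (0≤* 0≤l (0≤difference (le q))) (0≤difference (hull-dots-≤0 w w′ le h)))
  (sym (trans (cong₂ (λ a b → a ℚ.+ b ℚ.+ _) (dot-point w l B f) (dot-point w′ l B f))
    (ring l (dot w (vertex B)) (dot w′ (vertex B)) (dot w u) (dot w′ u))))
  where
  ring : ∀ l a b x y → ((l ℚ.* a ℚ.+ x) ℚ.+ (l ℚ.* b ℚ.+ y)) ℚ.+ (l ℚ.* (0ℚ ℚ.- (a ℚ.+ b)) ℚ.+ (0ℚ ℚ.- (x ℚ.+ y))) ≡ 0ℚ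
  ring = RingSolver.solve-∀ ℚring

hull-dot-≤0 : ∀ {n} {Q : Subset n → Set} {v} (w : Fin (suc n) → ℚ) →
  (∀ {B} → Q B → dot w (vertex B) ℚ.≤ 0ℚ) → Hull Q v → dot w v ℚ.≤ 0ℚ
hull-dot-≤0 w le (none z) = ℚP.≤-reflexive (dot-zero w z)
hull-dot-≤0 {v = v} w le (point {u} l B 0≤l q h f) = ≤-by-difference
  (0≤+ (0≤* 0≤l (0≤difference (le q))) (0≤difference (hull-dot-≤0 w le h)))
  (sym (trans (cong (ℚ._+ _) (dot-point w l B f)) (ring l (dot w (vertex B)) (dot w u))))
  where
  ring : ∀ l a x → (l ℚ.* a ℚ.+ x) ℚ.+ (l ℚ.* (0ℚ ℚ.- a) ℚ.+ (0ℚ ℚ.- x)) ≡ 0ℚ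
  ring = RingSolver.solve-∀ ℚring

uniformMatroid : ∀ n → ℕ → Matroid n
uniformMatroid n k = Band.bandMatroid {n} Sub.⊤ 0 n k

-- In the paper's notation: the cuspidal matroid Λ of a stressed subset F of rank r, and the
-- direct sum U_{r,F} ⊕ U_{k-r,E∖F} obtained by cutting along its defining hyperplane.
cuspidalMatroid splitMatroid : ∀ {n} → Subset n → ℕ → ℕ → Matroid n
cuspidalMatroid {n} F r k = Band.bandMatroid F r n k
splitMatroid F r k        = Band.bandMatroid F r r k

module Subdivision {n : ℕ} (M : Matroid n) (split : ElementarySplit M) where
  private
    k = rank M

    Sized : Subset n → Set
    Sized B = ∣ B ∣ ≡ k

    1ᴹ -1ᴹ : Matroid n → ℤ × Matroid n
    1ᴹ N  = 1ℤ , N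
    -1ᴹ N = ℤ.- 1ℤ , N

    pieces : Subset n → List (ℤ × Matroid n)
    pieces F = 1ᴹ (cuspidalMatroid F (rk M F) k) ∷ -1ᴹ (splitMatroid F (rk M F) k) ∷ []

  flats : List (Subset n)
  flats = filter (proper-cyclic-flat? M) (allSubsets n)

  flats-unique : Unique flats
  flats-unique = UP.filter⁺ (proper-cyclic-flat? M) (allSubsets-unique n)

  ∈flats⁻ : ∀ {F} → F ∈ᴸ flats → ProperCyclicFlat M F
  ∈flats⁻ F∈ = proj₂ (MP.∈-filter⁻ (proper-cyclic-flat? M) {xs = allSubsets n} F∈)

  ∈flats⁺ : ∀ {F} → ProperCyclicFlat M F → F ∈ᴸ flats
  ∈flats⁺ {F} p = MP.∈-filter⁺ (proper-cyclic-flat? M) (allSubsets-complete F) p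

  ∩-bound : ∀ {F G} → F ∈ᴸ flats → G ∈ᴸ flats → F ≢ G → ∣ F ∩ G ∣ + k ≤ rk M F + rk M G
  ∩-bound F∈ G∈ = clutter⇒∩-bound M (elementary-split⇒clutter M split) (∈flats⁻ F∈) (∈flats⁻ G∈)

  private
    -- This holds for every `k`-subset, hence linearly on the whole hypersimplex. It is the reason
    -- that two inequalities never fail together and that equality at one flat implies the
    -- inequalities at all others.
    two-flats : ∀ {B F G} → Sized B → F ∈ᴸ flats → G ∈ᴸ flats → F ≢ G → ∣ B ∩ F ∣ + ∣ B ∩ G ∣ ≤ rk M F + rk M G
    two-flats {B} {F} {G} card F∈ G∈ F≢G = begin
      ∣ B ∩ F ∣ + ∣ B ∩ G ∣                 ≡⟨ ∣∩∪∣+∣∩∩∣ B F G ⟨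
      ∣ B ∩ (F ∪ G) ∣ + ∣ B ∩ (F ∩ G) ∣     ≤⟨ +-mono-≤ (SP.∣p∩q∣≤∣p∣ B (F ∪ G)) (SP.∣p∩q∣≤∣q∣ B (F ∩ G)) ⟩
      ∣ B ∣ + ∣ F ∩ G ∣                     ≡⟨ trans (cong (_+ ∣ F ∩ G ∣) card) (+-comm k _) ⟩
      ∣ F ∩ G ∣ + k                         ≤⟨ ∩-bound F∈ G∈ F≢G ⟩
      rk M F + rk M G                       ∎
      where open ≤-Reasoning

    -- A `k`-set that is not a basis is dependent and not spanning, so the cyclic flat of its
    -- closure violates its inequality.
    bounded⇒base : ∀ {B} → Sized B → All (λ F → ∣ B ∩ F ∣ ≤ rk M F) flats → IsBase M B
    bounded⇒base {B} card bounded with k ≤? rk M B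
    ... | yes le = independent-spanning⇒base M card le
    ... | no ¬le with dependent⇒proper-cyclic-flat M B (subst (rk M B <_) (sym card) (≰⇒> ¬le)) (≰⇒> ¬le)
    ...   | F , p , _ , lt = contradiction (All.lookup bounded (∈flats⁺ p)) (<⇒≱ lt)

    -- Equality at `F` leaves, by `two-flats`, no room to violate another flat. Thus a cut along one
    -- flat adds only bases of `M`, and the cuts can be made in succession.
    hyperplane⇒base : ∀ {F} → F ∈ᴸ flats → ∀ {B} → OnHyperplane F (rk M F) k B → IsBase M B
    hyperplane⇒base {F} F∈ {B} (card , e) = bounded⇒base {B} card (All.tabulate bound)
      where
      bound : ∀ {G} → G ∈ᴸ flats → ∣ B ∩ G ∣ ≤ rk M G
      bound {G} G∈ with F ≟ˢ G
      ... | yes refl = ≤-reflexive e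
      ... | no F≢G = +-cancelˡ-≤ (rk M F) _ _ (subst (λ c → c + ∣ B ∩ G ∣ ≤ rk M F + rk M G) e (two-flats {B} card F∈ G∈ F≢G))

    hyperplane-nonempty : ∀ F → ∃[ B ] (OnHyperplane F (rk M F) k B)
    hyperplane-nonempty F with rk-attained M F
    ... | B , B∈ , e = B , ∣base∣≡rank M B∈ , e

    uniform-nonempty : ∃[ B ] (Band.InBand Sub.⊤ 0 n k B)
    uniform-nonempty with nonempty M
    ... | B , B∈ = B , ∣base∣≡rank M B∈ , z≤n , SP.∣p∣≤n (B ∩ Sub.⊤)

  split-nonempty : ∀ F → ∃[ B ] (Band.InBand F (rk M F) (rk M F) k B)
  split-nonempty F with hyperplane-nonempty F
  ... | B , c , e = B , c , ≤-reflexive (sym e) , ≤-reflexive e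

  cuspidal-nonempty : ∀ F → ∃[ B ] (Band.InBand F (rk M F) n k B)
  cuspidal-nonempty F with hyperplane-nonempty F
  ... | B , c , e = B , c , ≤-reflexive (sym e) , SP.∣p∣≤n (B ∩ F)

  private
    excessAt : Subset n → (Fin (suc n) → ℚ) → ℚ
    excessAt F = excess F (rk M F) k

    module _ (x : Fin n → ℚ) where
      v : Fin (suc n) → ℚ
      v = homogenize x

      ∈M⇒sized : x ∈P M → Hull Sized v
      ∈M⇒sized x∈ = hull-mono (∣base∣≡rank M) (∈P⇒hull {M = M} x∈)

      ∈M⇒excess : ∀ F → x ∈P M → excessAt F v ℚ.≤ 0ℚ
      ∈M⇒excess F x∈ = hull-dot-≤0 (plane F (rk M F) k) (λ {B} B∈ → excess-≤0 F (rk M F) k {B} (rk-upper M F B∈)) (∈P⇒hull {M = M} x∈)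

      sized⇒∈M : Hull Sized v → (∀ {F} → F ∈ᴸ flats → excessAt F v ℚ.≤ 0ℚ) → x ∈P M
      sized⇒∈M h le = hull⇒∈P {M = M} (hull-mono (λ {B} (card , bounded) → bounded⇒base {B} card bounded) (cut-all flats id))
        where
        Cut : List (Subset n) → Subset n → Set
        Cut Gs B = Sized B × All (λ F → ∣ B ∩ F ∣ ≤ rk M F) Gs
        base⇒Cut : ∀ {Gs B} → (∀ {F} → F ∈ᴸ Gs → F ∈ᴸ flats) → IsBase M B → Cut Gs B
        base⇒Cut Gs⊆ B∈ = ∣base∣≡rank M B∈ , All.tabulate λ {F} _ → rk-upper M F B∈
        cut-all : ∀ Gs → (∀ {F} → F ∈ᴸ Gs → F ∈ᴸ flats) → Hull (Cut Gs) v
        cut-all []       _   = hull-mono (λ card → card , []) h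
        cut-all (G ∷ Gs) Gs⊆ = cut-above G (rk M G) k proj₁ (λ (card , bounded) le → card , le ∷ bounded)
          (λ {B} on-plane → base⇒Cut Gs⊆ (hyperplane⇒base (Gs⊆ (here refl)) {B} on-plane)) (cut-all Gs (Gs⊆ ∘ there)) (le (Gs⊆ (here refl)))

      ∈U⇒sized : x ∈P uniformMatroid n k → Hull Sized v
      ∈U⇒sized x∈ = hull-mono (λ {B} B∈ → proj₁ (Band.base⇒InBand Sub.⊤ 0 n k {proj₁ uniform-nonempty} (proj₂ uniform-nonempty) {B} B∈)) (∈P⇒hull {M = uniformMatroid n k} x∈)

      sized⇒∈U : Hull Sized v → x ∈P uniformMatroid n k
      sized⇒∈U h = hull⇒∈P {M = uniformMatroid n k} (hull-mono (λ {B} card → Band.InBand⇒base Sub.⊤ 0 n k {B} (card , z≤n , SP.∣p∣≤n (B ∩ Sub.⊤))) h)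

      module _ (F : Subset n) where
        private
          r = rk M F
          cuspidal-hull : x ∈P cuspidalMatroid F r k → Hull (Band.InBand F r n k) v
          cuspidal-hull x∈ = hull-mono (λ {B} B∈ → Band.base⇒InBand F r n k {proj₁ (cuspidal-nonempty F)} (proj₂ (cuspidal-nonempty F)) {B} B∈)
            (∈P⇒hull {M = cuspidalMatroid F r k} x∈)
          split-hull : x ∈P splitMatroid F r k → Hull (Band.InBand F r r k) v
          split-hull x∈ = hull-mono (λ {B} B∈ → Band.base⇒InBand F r r k {proj₁ (split-nonempty F)} (proj₂ (split-nonempty F)) {B} B∈)
            (∈P⇒hull {M = splitMatroid F r k} x∈)

          cut-to-cuspidal : Hull Sized v → 0ℚ ℚ.≤ excessAt F v → Hull (Band.InBand F r n k) v
          cut-to-cuspidal = cut-below F r k id (λ {B} card le → card , le , SP.∣p∣≤n (B ∩ F))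
            (λ {B} (card , e) → card , ≤-reflexive (sym e) , SP.∣p∣≤n (B ∩ F))

        ∈cuspidal⇒sized : x ∈P cuspidalMatroid F r k → Hull Sized v
        ∈cuspidal⇒sized x∈ = hull-mono proj₁ (cuspidal-hull x∈)

        ∈cuspidal⇒excess : x ∈P cuspidalMatroid F r k → 0ℚ ℚ.≤ excessAt F v
        ∈cuspidal⇒excess x∈ = hull-dot-≥0 (plane F r k) (λ {B} (_ , le , _) → 0≤excess F r k {B} le) (cuspidal-hull x∈)

        sized⇒∈cuspidal : Hull Sized v → 0ℚ ℚ.≤ excessAt F v → x ∈P cuspidalMatroid F r k
        sized⇒∈cuspidal h 0≤ = hull⇒∈P {M = cuspidalMatroid F r k} (hull-mono (λ {B} → Band.InBand⇒base F r n k {B}) (cut-to-cuspidal h 0≤))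

        ∈split⇒∈cuspidal : x ∈P splitMatroid F r k → x ∈P cuspidalMatroid F r k
        ∈split⇒∈cuspidal x∈ = hull⇒∈P {M = cuspidalMatroid F r k} (hull-mono (λ {B} (card , le , _) → Band.InBand⇒base F r n k {B} (card , le , SP.∣p∣≤n (B ∩ F))) (split-hull x∈))

        ∈split⇒excess : x ∈P splitMatroid F r k → excessAt F v ℚ.≤ 0ℚ
        ∈split⇒excess x∈ = hull-dot-≤0 (plane F r k) (λ {B} (_ , _ , le) → excess-≤0 F r k {B} le) (split-hull x∈)

        sized⇒∈split : Hull Sized v → 0ℚ ℚ.≤ excessAt F v → excessAt F v ℚ.≤ 0ℚ → x ∈P splitMatroid F r k
        sized⇒∈split h 0≤ ≤0 = hull⇒∈P {M = splitMatroid F r k} (hull-mono (λ {B} → Band.InBand⇒base F r r k {B})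
          (cut-above F r k proj₁ (λ (card , ge , _) le → card , ge , le) (λ (card , e) → card , ≤-reflexive (sym e) , ≤-reflexive e) (cut-to-cuspidal h 0≤) ≤0))

      at-most-one : ∀ {F G} → Hull Sized v → F ∈ᴸ flats → G ∈ᴸ flats → F ≢ G → 0ℚ ℚ.< excessAt F v → excessAt G v ℚ.≤ 0ℚ
      at-most-one {F} {G} h F∈ G∈ F≢G 0<F = ≤-by-difference (0≤+ (ℚP.<⇒≤ 0<F) (0≤difference
        (hull-dots-≤0 (plane F (rk M F) k) (plane G (rk M G) k) (λ {B} card → bound B card) h))) (ring (excessAt F v) (excessAt G v))
        where
        ring : ∀ a b → 0ℚ ≡ b ℚ.+ (a ℚ.+ (0ℚ ℚ.- (a ℚ.+ b)))
        ring = RingSolver.solve-∀ ℚring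
        bound : ∀ B → Sized B → excessAt F (vertex B) ℚ.+ excessAt G (vertex B) ℚ.≤ 0ℚ
        bound B card = ≤-by-difference (0≤difference (fromℕ-mono (two-flats {B} card F∈ G∈ F≢G)))
          (sym (trans (cong₂ ℚ._+_ (cong₂ ℚ._+_ (excess-vertex F (rk M F) k B) (excess-vertex G (rk M G) k B))
            (cong₂ ℚ._-_ (fromℕ-+ (rk M F) (rk M G)) (fromℕ-+ ∣ B ∩ F ∣ ∣ B ∩ G ∣)))
            (ring₂ (fromℕ ∣ B ∩ F ∣) (fromℕ ∣ B ∩ G ∣) (fromℕ (rk M F)) (fromℕ (rk M G)))))
          where
          ring₂ : ∀ a b c d → ((a ℚ.- c) ℚ.+ (b ℚ.- d)) ℚ.+ ((c ℚ.+ d) ℚ.- (a ℚ.+ b)) ≡ 0ℚ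
          ring₂ = RingSolver.solve-∀ ℚring

      total : List Bool → List (ℤ × Matroid n) → ℤ
      total bs xs = sumℤ (zipWith (λ b aM → if b then proj₁ aM else 0ℤ) bs xs)

      Values : List Bool → List (ℤ × Matroid n) → Set
      Values = Pointwise (λ b aM → (b ≡ true) ⇔ (x ∈P proj₂ aM))

      outside-total : ¬ Hull Sized v → ∀ Gs {bs} → Values bs (concatMap pieces Gs) → total bs (concatMap pieces Gs) ≡ 0ℤ
      outside-total ¬h [] [] = refl
      outside-total ¬h (G ∷ Gs) {bΛ ∷ bD ∷ bs} (iffΛ ∷ iffD ∷ vals) with bΛ | bD
      ... | true | _ = contradiction (∈cuspidal⇒sized G (Equivalence.to iffΛ refl)) ¬h
      ... | false | true = contradiction (∈cuspidal⇒sized G (∈split⇒∈cuspidal G (Equivalence.to iffD refl))) ¬h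
      ... | false | false = cong (λ z → 0ℤ ℤ.+ (0ℤ ℤ.+ z)) (outside-total ¬h Gs vals)

      -- By `at-most-one`, at most one flat of `Gs` is strictly violated at a point of the
      -- hypersimplex, so the total is the indicator of violation rather than a count.
      Outcome : List (Subset n) → ℤ → Set
      Outcome Gs t = ((∀ {G} → G ∈ᴸ Gs → excessAt G v ℚ.≤ 0ℚ) × t ≡ 0ℤ) ⊎ (∃[ G ] (G ∈ᴸ Gs × 0ℚ ℚ.< excessAt G v × t ≡ 1ℤ))

      -- The cuspidal polytope is the closed part of the hypersimplex where x(G) ≥ rk G, and the
      -- split polytope is its section by the hyperplane. Their difference indicates strict
      -- violation of the inequality of `G`.
      Contribution : Subset n → Bool → Bool → Set
      Contribution G bΛ bD = (0ℚ ℚ.< excessAt G v × bΛ ≡ true × bD ≡ false) ⊎ (excessAt G v ℚ.≤ 0ℚ × bΛ ≡ bD)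

      contribution : Hull Sized v → ∀ G → Dec (0ℚ ℚ.< excessAt G v) → ∀ bΛ bD →
        (bΛ ≡ true) ⇔ (x ∈P cuspidalMatroid G (rk M G) k) → (bD ≡ true) ⇔ (x ∈P splitMatroid G (rk M G) k) → Contribution G bΛ bD
      contribution h G (yes gt) true  false iffΛ iffD = inj₁ (gt , refl , refl)
      contribution h G (yes gt) _     true  iffΛ iffD = contradiction gt (≤ℚ⇒≯ (∈split⇒excess G (Equivalence.to iffD refl)))
      contribution h G (yes gt) false false iffΛ iffD = contradiction (Equivalence.from iffΛ (sized⇒∈cuspidal G h (ℚP.<⇒≤ gt))) λ ()
      contribution h G (no ¬gt) true  true  iffΛ iffD = inj₂ (ℚP.≮⇒≥ ¬gt , refl)
      contribution h G (no ¬gt) false false iffΛ iffD = inj₂ (ℚP.≮⇒≥ ¬gt , refl)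
      contribution h G (no ¬gt) true  false iffΛ iffD =
        contradiction (Equivalence.from iffD (sized⇒∈split G h (∈cuspidal⇒excess G (Equivalence.to iffΛ refl)) (ℚP.≮⇒≥ ¬gt))) λ ()
      contribution h G (no ¬gt) false true  iffΛ iffD =
        contradiction (Equivalence.from iffΛ (∈split⇒∈cuspidal G (Equivalence.to iffD refl))) λ ()

      add-contribution : Hull Sized v → ∀ {G Gs} → (∀ {F} → F ∈ᴸ G ∷ Gs → F ∈ᴸ flats) → All (G ≢_) Gs → ∀ {bΛ bD t} →
        Contribution G bΛ bD → Outcome Gs t → Outcome (G ∷ Gs) ((if bΛ then 1ℤ else 0ℤ) ℤ.+ ((if bD then ℤ.- 1ℤ else 0ℤ) ℤ.+ t))
      add-contribution h Gs⊆ G∉ (inj₁ (gt , refl , refl)) (inj₁ (_ , refl)) = inj₂ (_ , here refl , gt , refl)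
      add-contribution h Gs⊆ G∉ (inj₁ (gt , refl , refl)) (inj₂ (F , F∈ , gtF , _)) = contradiction gtF
        (≤ℚ⇒≯ (at-most-one h (Gs⊆ (here refl)) (Gs⊆ (there F∈)) (All.lookup G∉ F∈) gt))
      add-contribution h Gs⊆ G∉ {true}  (inj₂ (le , refl)) (inj₁ (les , refl)) = inj₁ ((λ { (here refl) → le ; (there F∈) → les F∈ }) , refl)
      add-contribution h Gs⊆ G∉ {false} (inj₂ (le , refl)) (inj₁ (les , refl)) = inj₁ ((λ { (here refl) → le ; (there F∈) → les F∈ }) , refl)
      add-contribution h Gs⊆ G∉ {true}  (inj₂ (le , refl)) (inj₂ (F , F∈ , gtF , refl)) = inj₂ (F , there F∈ , gtF , refl)
      add-contribution h Gs⊆ G∉ {false} (inj₂ (le , refl)) (inj₂ (F , F∈ , gtF , refl)) = inj₂ (F , there F∈ , gtF , refl)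

      inside-total : Hull Sized v → ∀ Gs → (∀ {F} → F ∈ᴸ Gs → F ∈ᴸ flats) → Unique Gs → ∀ {bs} → Values bs (concatMap pieces Gs) →
        Outcome Gs (total bs (concatMap pieces Gs))
      inside-total h [] _ _ [] = inj₁ ((λ ()) , refl)
      inside-total h (G ∷ Gs) Gs⊆ (G∉ ∷ uniq) (iffΛ ∷ iffD ∷ vals) = add-contribution h Gs⊆ G∉
        (contribution h G (0ℚ ℚP.<? excessAt G v) _ _ iffΛ iffD) (inside-total h Gs (Gs⊆ ∘ there) uniq vals)

      vanishing : ∀ bM bU {t} → (bM ≡ true) ⇔ (x ∈P M) → Hull Sized v → bU ≡ true → Outcome flats t →
        (if bM then 1ℤ else 0ℤ) ℤ.+ ((if bU then ℤ.- 1ℤ else 0ℤ) ℤ.+ t) ≡ 0ℤ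
      vanishing true  true iffM h _ (inj₁ (_ , refl))          = refl
      vanishing false true iffM h _ (inj₁ (les , _))           = contradiction (Equivalence.from iffM (sized⇒∈M h les)) λ ()
      vanishing true  true iffM h _ (inj₂ (F , _ , gtF , _))   = contradiction gtF (≤ℚ⇒≯ (∈M⇒excess F (Equivalence.to iffM refl)))
      vanishing false true iffM h _ (inj₂ (_ , _ , _ , refl))  = refl

      total-vanishes : ∀ bM bU bs → (bM ≡ true) ⇔ (x ∈P M) → (bU ≡ true) ⇔ (x ∈P uniformMatroid n k) → Values bs (concatMap pieces flats) →
        (if bM then 1ℤ else 0ℤ) ℤ.+ ((if bU then ℤ.- 1ℤ else 0ℤ) ℤ.+ total bs (concatMap pieces flats)) ≡ 0ℤ
      total-vanishes bM true bs iffM iffU vals = vanishing bM true iffM h refl (inside-total h flats id flats-unique vals)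
        where
        h : Hull Sized v
        h = ∈U⇒sized (Equivalence.to iffU refl)
      total-vanishes true false bs iffM iffU vals =
        contradiction (Equivalence.from iffU (sized⇒∈U (∈M⇒sized (Equivalence.to iffM refl)))) λ ()
      total-vanishes false false bs iffM iffU vals = cong (λ z → 0ℤ ℤ.+ (0ℤ ℤ.+ z))
        (outside-total (λ h → contradiction (Equivalence.from iffU (sized⇒∈U h)) λ ()) flats vals)

  relation : List (ℤ × Matroid n)
  relation = 1ᴹ M ∷ -1ᴹ (uniformMatroid n k) ∷ concatMap pieces flats

  relation-cancels : IndicatorsCancel relation
  relation-cancels x (bM ∷ bU ∷ bs) (iffM ∷ iffU ∷ vals) = total-vanishes x bM bU bs iffM iffU vals

  relation-rank : All (λ aM → rank (proj₂ aM) ≡ k) relation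
  relation-rank = refl ∷ Band.rank-band Sub.⊤ 0 n k {proj₁ uniform-nonempty} (proj₂ uniform-nonempty) ∷ pieces-rank flats
    where
    pieces-rank : ∀ Gs → All (λ aM → rank (proj₂ aM) ≡ k) (concatMap pieces Gs)
    pieces-rank []       = []
    pieces-rank (G ∷ Gs) = Band.rank-band G (rk M G) n k {proj₁ (cuspidal-nonempty G)} (proj₂ (cuspidal-nonempty G))
      ∷ Band.rank-band G (rk M G) (rk M G) k {proj₁ (split-nonempty G)} (proj₂ (split-nonempty G)) ∷ pieces-rank Gs

  module _ {c ℓ : Level} (A : AbelianGroup c ℓ) (f : ∀ {m} → Matroid m → AbelianGroup.Carrier A) where
    open AbelianGroup A using (Carrier; _≈_; _∙_; ε; _⁻¹; setoid; ∙-cong; ∙-congˡ; ∙-congʳ; identityˡ; identityʳ; assoc; ⁻¹-cong; inverseˡ)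
      renaming (refl to ≈-refl; sym to ≈-sym; trans to ≈-trans)
    open AbelianGroupProperties A using (⁻¹-∙-comm; ⁻¹-involutive; ⁻¹-anti-homo-∙)
    open AbelianSums A using (∑; ∑-⁻¹)
    open SetoidReasoning setoid

    -- The sign is opposite to that of `pieces`, which makes the expansion of `f M` a plain sum.
    defect : Subset n → ℕ → Carrier
    defect F r = f (splitMatroid F r k) ∙ f (cuspidalMatroid F r k) ⁻¹

    private
      evaluate : List (ℤ × Matroid n) → Carrier
      evaluate xs = sumA A (map (λ aM → _·_ A (proj₁ aM) (f (proj₂ aM))) xs)

      evaluate-pieces : ∀ Gs → evaluate (concatMap pieces Gs) ≈ ∑ Gs (λ F → defect F (rk M F)) ⁻¹
      evaluate-pieces Gs = ≈-trans (go Gs) (≈-sym (∑-⁻¹ Gs _))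
        where
        go : ∀ Gs → evaluate (concatMap pieces Gs) ≈ ∑ Gs (λ F → defect F (rk M F) ⁻¹)
        go []       = ≈-refl
        go (G ∷ Gs) = begin
          (Λ ∙ ε) ∙ ((D ∙ ε) ⁻¹ ∙ evaluate (concatMap pieces Gs))  ≈⟨ ∙-cong (identityʳ Λ) (∙-cong (⁻¹-cong (identityʳ D)) (go Gs)) ⟩
          Λ ∙ (D ⁻¹ ∙ _)                                           ≈⟨ assoc Λ (D ⁻¹) _ ⟨
          (Λ ∙ D ⁻¹) ∙ _                                           ≈⟨ ∙-congʳ (≈-trans (⁻¹-anti-homo-∙ D (Λ ⁻¹)) (∙-congʳ (⁻¹-involutive Λ))) ⟨
          (D ∙ Λ ⁻¹) ⁻¹ ∙ _                                        ∎
          where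
          Λ = f (cuspidalMatroid G (rk M G) k)
          D = f (splitMatroid G (rk M G) k)

    valuative-expansion : IsValuativeOn A f n k → f M ≈ f (uniformMatroid n k) ∙ ∑ flats (λ F → defect F (rk M F))
    valuative-expansion val = begin
      f M                                     ≈⟨ identityʳ (f M) ⟨
      f M ∙ ε                                 ≈⟨ ∙-congˡ (inverseˡ (U ∙ S)) ⟨
      f M ∙ ((U ∙ S) ⁻¹ ∙ (U ∙ S))            ≈⟨ assoc (f M) _ _ ⟨
      (f M ∙ (U ∙ S) ⁻¹) ∙ (U ∙ S)            ≈⟨ ∙-congʳ (∙-congˡ (⁻¹-∙-comm U S)) ⟨
      (f M ∙ (U ⁻¹ ∙ S ⁻¹)) ∙ (U ∙ S)         ≈⟨ ∙-congʳ (∙-cong (identityʳ (f M)) (∙-cong (⁻¹-cong (identityʳ U)) (evaluate-pieces flats))) ⟨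
      evaluate relation ∙ (U ∙ S)             ≈⟨ ∙-congʳ (val relation relation-rank relation-cancels) ⟩
      ε ∙ (U ∙ S)                             ≈⟨ identityˡ _ ⟩
      U ∙ S                                   ∎
      where
      U = f (uniformMatroid n k)
      S = ∑ flats (λ F → defect F (rk M F))

-- Fourier–Motzkin elimination of a nonnegative variable

Form System : ℕ → Set
Form n   = (Fin n → ℚ) × ℚ
System n = List (Form n)

module _ {n : ℕ} where
  eval : Form n → (Fin n → ℚ) → ℚ
  eval (a , b) v = dot a v ℚ.+ b

  _⊨_ : (Fin n → ℚ) → System n → Set
  v ⊨ Σs = All (λ φ → 0ℚ ℚ.≤ eval φ v) Σs

  _⊨?_ : ∀ v Σs → Dec (v ⊨ Σs)
  v ⊨? Σs = All.all? (λ φ → 0ℚ ℚP.≤? eval φ v) Σs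

cons : ∀ {n} → ℚ → (Fin n → ℚ) → Fin (suc n) → ℚ
cons t v zero    = t
cons t v (suc j) = v j

dot-scaleˡ : ∀ {n} c (a v : Fin n → ℚ) → dot (λ j → c ℚ.* a j) v ≡ c ℚ.* dot a v
dot-scaleˡ {zero}  c a v = sym (ℚP.*-zeroʳ c)
dot-scaleˡ {suc n} c a v = trans (cong (c ℚ.* a zero ℚ.* v zero ℚ.+_) (dot-scaleˡ c (a ∘ suc) (v ∘ suc))) (ring c (a zero) (v zero) (dot (a ∘ suc) (v ∘ suc)))
  where
  ring : ∀ c a v d → c ℚ.* a ℚ.* v ℚ.+ c ℚ.* d ≡ c ℚ.* (a ℚ.* v ℚ.+ d)
  ring = RingSolver.solve-∀ ℚring

dot-subˡ : ∀ {n} (a b v : Fin n → ℚ) → dot (λ j → a j ℚ.- b j) v ≡ dot a v ℚ.- dot b v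
dot-subˡ {zero}  a b v = refl
dot-subˡ {suc n} a b v = trans (cong ((a zero ℚ.- b zero) ℚ.* v zero ℚ.+_) (dot-subˡ (a ∘ suc) (b ∘ suc) (v ∘ suc)))
  (ring (a zero) (b zero) (v zero) (dot (a ∘ suc) (v ∘ suc)) (dot (b ∘ suc) (v ∘ suc)))
  where
  ring : ∀ a b v d e → (a ℚ.- b) ℚ.* v ℚ.+ (d ℚ.- e) ≡ (a ℚ.* v ℚ.+ d) ℚ.- (b ℚ.* v ℚ.+ e)
  ring = RingSolver.solve-∀ ℚring

dot-zeroˡ : ∀ {n} (v : Fin n → ℚ) → dot (λ _ → 0ℚ) v ≡ 0ℚ
dot-zeroˡ {zero}  v = refl
dot-zeroˡ {suc n} v = trans (cong (0ℚ ℚ.* v zero ℚ.+_) (dot-zeroˡ (v ∘ suc))) (trans (cong (ℚ._+ 0ℚ) (ℚP.*-zeroˡ (v zero))) (ℚP.+-identityʳ 0ℚ))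

scaleForm : ∀ {n} → ℚ → Form n → Form n
scaleForm c (a , b) = (λ j → c ℚ.* a j) , c ℚ.* b

subForm : ∀ {n} → Form n → Form n → Form n
subForm (a , b) (a′ , b′) = (λ j → a j ℚ.- a′ j) , b ℚ.- b′

zeroForm : ∀ {n} → Form n
zeroForm = (λ _ → 0ℚ) , 0ℚ

eval-scale : ∀ {n} c (φ : Form n) v → eval (scaleForm c φ) v ≡ c ℚ.* eval φ v
eval-scale c (a , b) v = trans (cong (ℚ._+ c ℚ.* b) (dot-scaleˡ c a v)) (sym (ℚP.*-distribˡ-+ c (dot a v) b))

eval-sub : ∀ {n} (φ ψ : Form n) v → eval (subForm φ ψ) v ≡ eval φ v ℚ.- eval ψ v
eval-sub (a , b) (a′ , b′) v = trans (cong (ℚ._+ (b ℚ.- b′)) (dot-subˡ a a′ v)) (ring (dot a v) (dot a′ v) b b′)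
  where
  ring : ∀ d e b c → (d ℚ.- e) ℚ.+ (b ℚ.- c) ≡ (d ℚ.+ b) ℚ.- (e ℚ.+ c)
  ring = RingSolver.solve-∀ ℚring

eval-zero : ∀ {n} (v : Fin n → ℚ) → eval zeroForm v ≡ 0ℚ
eval-zero v = trans (cong (ℚ._+ 0ℚ) (dot-zeroˡ v)) (ℚP.+-identityʳ 0ℚ)

data Half (n : ℕ) : Set where
  lower upper free : Form n → Half n

Holds : ∀ {n} → Half n → ℚ → (Fin n → ℚ) → Set
Holds (lower φ) t v = eval φ v ℚ.≤ t
Holds (upper φ) t v = t ℚ.≤ eval φ v
Holds (free φ)  t v = 0ℚ ℚ.≤ eval φ v

tail : ∀ {n} → Form (suc n) → Form n
tail (a , b) = a ∘ suc , b

solveFor : ∀ {n} (φ : Form (suc n)) → ∃[ H ] (∀ t v → (0ℚ ℚ.≤ eval φ (cons t v)) ⇔ Holds {n} H t v)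
solveFor φ@(a , b) with ℚP.<-cmp (a zero) 0ℚ
... | tri≈ _ e _ = free (tail φ) , λ t v → mk⇔ (subst (0ℚ ℚ.≤_) (same t v)) (subst (0ℚ ℚ.≤_) (sym (same t v)))
  where
  same : ∀ t v → eval φ (cons t v) ≡ eval (tail φ) v
  same t v = cong (ℚ._+ b) (trans (cong (λ z → z ℚ.* t ℚ.+ dot (a ∘ suc) v) e) (trans (cong (ℚ._+ dot (a ∘ suc) v) (ℚP.*-zeroˡ t)) (ℚP.+-identityˡ (dot (a ∘ suc) v))))
... | tri< neg _ _ with ∃-quotient 0≤1 (ℚP.neg-antimono-< neg)
...   | c , 0≤c , c*-a≡1 = upper (scaleForm c (tail φ)) , λ t v → mk⇔
  (λ le → ≤-by-difference (0≤* 0≤c le) (trans (eval-scale c (tail φ) v) (trans (ring₁ c (a zero) t (dot (a ∘ suc) v) b)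
    (cong (ℚ._+ c ℚ.* eval φ (cons t v)) (trans (cong (ℚ._* t) c*-a≡1) (ℚP.*-identityˡ t))))))
  (λ le → ≤-by-difference (0≤* (a<0⇒0≤-a neg) (0≤difference le)) (trans (ring₂ c (a zero) t (dot (a ∘ suc) v) b)
    (cong (λ z → 0ℚ ℚ.+ z) (trans (cong (λ z → z ℚ.* eval (tail φ) v ℚ.- (ℚ.- a zero) ℚ.* t) (sym c*-a≡1)) (trans (ring₃ c (a zero) t (eval (tail φ) v)) (cong (λ z → (ℚ.- a zero) ℚ.* (z ℚ.- t)) (sym (eval-scale c (tail φ) v))))))))
  where
  ring₁ : ∀ c a t d b → c ℚ.* (d ℚ.+ b) ≡ c ℚ.* (ℚ.- a) ℚ.* t ℚ.+ c ℚ.* (a ℚ.* t ℚ.+ d ℚ.+ b)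
  ring₁ = RingSolver.solve-∀ ℚring
  ring₂ : ∀ c a t d b → a ℚ.* t ℚ.+ d ℚ.+ b ≡ 0ℚ ℚ.+ (1ℚ ℚ.* (d ℚ.+ b) ℚ.- (ℚ.- a) ℚ.* t)
  ring₂ = RingSolver.solve-∀ ℚring
  ring₃ : ∀ c a t d → c ℚ.* (ℚ.- a) ℚ.* d ℚ.- (ℚ.- a) ℚ.* t ≡ (ℚ.- a) ℚ.* (c ℚ.* d ℚ.- t)
  ring₃ = RingSolver.solve-∀ ℚring
solveFor φ@(a , b) | tri> _ _ gt with ∃-quotient 0≤1 gt
...   | c , 0≤c , c*a≡1 = lower (scaleForm (ℚ.- c) (tail φ)) , λ t v → mk⇔
  (λ le → ≤-by-difference (0≤* 0≤c le) (trans (trans (sym (ℚP.*-identityˡ t)) (cong (ℚ._* t) (sym c*a≡1)))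
    (trans (ring₁ c (a zero) t (dot (a ∘ suc) v) b) (cong (ℚ._+ c ℚ.* eval φ (cons t v)) (sym (eval-scale (ℚ.- c) (tail φ) v))))))
  (λ le → ≤-by-difference (0≤* (ℚP.<⇒≤ gt) (0≤difference le)) (trans (ring₂ (a zero) t (dot (a ∘ suc) v) b)
    (cong (λ z → 0ℚ ℚ.+ z) (trans (cong (λ z → a zero ℚ.* t ℚ.+ z ℚ.* eval (tail φ) v) (sym c*a≡1)) (trans (ring₃ c (a zero) t (eval (tail φ) v)) (cong (λ z → a zero ℚ.* (t ℚ.- z)) (sym (eval-scale (ℚ.- c) (tail φ) v))))))))
  where
  ring₁ : ∀ c a t d b → c ℚ.* a ℚ.* t ≡ (ℚ.- c) ℚ.* (d ℚ.+ b) ℚ.+ c ℚ.* (a ℚ.* t ℚ.+ d ℚ.+ b)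
  ring₁ = RingSolver.solve-∀ ℚring
  ring₂ : ∀ a t d b → a ℚ.* t ℚ.+ d ℚ.+ b ≡ 0ℚ ℚ.+ (a ℚ.* t ℚ.+ 1ℚ ℚ.* (d ℚ.+ b))
  ring₂ = RingSolver.solve-∀ ℚring
  ring₃ : ∀ c a t d → a ℚ.* t ℚ.+ c ℚ.* a ℚ.* d ≡ a ℚ.* (t ℚ.- (ℚ.- c) ℚ.* d)
  ring₃ = RingSolver.solve-∀ ℚring

module _ {n : ℕ} where
  lowers uppers frees : List (Form (suc n)) → List (Form n)
  lowers []       = []
  lowers (φ ∷ Σs) with proj₁ (solveFor φ)
  ... | lower ψ = ψ ∷ lowers Σs
  ... | upper _ = lowers Σs
  ... | free _  = lowers Σs
  uppers []       = []
  uppers (φ ∷ Σs) with proj₁ (solveFor φ)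
  ... | lower _ = uppers Σs
  ... | upper ψ = ψ ∷ uppers Σs
  ... | free _  = uppers Σs
  frees []       = []
  frees (φ ∷ Σs) with proj₁ (solveFor φ)
  ... | lower _ = frees Σs
  ... | upper _ = frees Σs
  ... | free ψ  = ψ ∷ frees Σs

  Solved : List (Form (suc n)) → ℚ → (Fin n → ℚ) → Set
  Solved Σs t v = All (λ φ → eval φ v ℚ.≤ t) (lowers Σs) × All (λ φ → t ℚ.≤ eval φ v) (uppers Σs) × v ⊨ frees Σs

  ⊨⇒Solved : ∀ Σs {t v} → cons t v ⊨ Σs → Solved Σs t v
  ⊨⇒Solved [] [] = [] , [] , []
  ⊨⇒Solved (φ ∷ Σs) {t} {v} (p ∷ ps) with solveFor φ | ⊨⇒Solved Σs ps
  ... | lower ψ , iff | ls , us , fs = Equivalence.to (iff t v) p ∷ ls , us , fs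
  ... | upper ψ , iff | ls , us , fs = ls , Equivalence.to (iff t v) p ∷ us , fs
  ... | free ψ  , iff | ls , us , fs = ls , us , Equivalence.to (iff t v) p ∷ fs

  Solved⇒⊨ : ∀ Σs {t v} → Solved Σs t v → cons t v ⊨ Σs
  Solved⇒⊨ [] _ = []
  Solved⇒⊨ (φ ∷ Σs) {t} {v} s with solveFor φ
  Solved⇒⊨ (φ ∷ Σs) {t} {v} (p ∷ ls , us , fs) | lower ψ , iff = Equivalence.from (iff t v) p ∷ Solved⇒⊨ Σs (ls , us , fs)
  Solved⇒⊨ (φ ∷ Σs) {t} {v} (ls , p ∷ us , fs) | upper ψ , iff = Equivalence.from (iff t v) p ∷ Solved⇒⊨ Σs (ls , us , fs)
  Solved⇒⊨ (φ ∷ Σs) {t} {v} (ls , us , p ∷ fs) | free ψ  , iff = Equivalence.from (iff t v) p ∷ Solved⇒⊨ Σs (ls , us , fs)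

  -- Besides the explicit lower bounds, every upper bound is paired with `zeroForm`, the bound 0
  -- coming from nonnegativity of the eliminated variable.
  elim : System (suc n) → System n
  elim Σs = frees Σs ++ concatMap (λ u → map (subForm u) (zeroForm ∷ lowers Σs)) (uppers Σs)

  -- The value 0 at the empty list is again the implicit lower bound; it makes `lowest` the least
  -- element of every nonempty fibre, even when no form bounds the variable from below.
  maxEval : (Fin n → ℚ) → List (Form n) → ℚ
  maxEval v []       = 0ℚ
  maxEval v (φ ∷ φs) = eval φ v ℚ.⊔ maxEval v φs

  lowest : System (suc n) → (Fin n → ℚ) → ℚ
  lowest Σs v = maxEval v (lowers Σs)

  private
    max-≤ : ∀ {t} {v : Fin n → ℚ} φs → 0ℚ ℚ.≤ t → All (λ φ → eval φ v ℚ.≤ t) φs → maxEval v φs ℚ.≤ t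
    max-≤ []       0≤ []       = 0≤
    max-≤ {v = v} (φ ∷ φs) 0≤ (p ∷ ps) = ℚP.⊔-lub p (max-≤ {v = v} φs 0≤ ps)

    ≤-max : ∀ {t} {v : Fin n → ℚ} φs → maxEval v φs ℚ.≤ t → 0ℚ ℚ.≤ t × All (λ φ → eval φ v ℚ.≤ t) φs
    ≤-max []       le = le , []
    ≤-max {t} {v} (φ ∷ φs) le with ≤-max {t} {v} φs (ℚP.≤-trans (ℚP.p≤q⊔p (eval φ v) (maxEval v φs)) le)
    ... | 0≤ , ps = 0≤ , ℚP.≤-trans (ℚP.p≤p⊔q (eval φ v) (maxEval v φs)) le ∷ ps

    0≤sub⇒≤ : ∀ (u l : Form n) v → 0ℚ ℚ.≤ eval (subForm u l) v → eval l v ℚ.≤ eval u v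
    0≤sub⇒≤ u l v le = ≤-by-difference (subst (0ℚ ℚ.≤_) (eval-sub u l v) le) (ring (eval u v) (eval l v))
      where
      ring : ∀ a b → a ≡ b ℚ.+ (a ℚ.- b)
      ring = RingSolver.solve-∀ ℚring

    ≤⇒0≤sub : ∀ (u l : Form n) v → eval l v ℚ.≤ eval u v → 0ℚ ℚ.≤ eval (subForm u l) v
    ≤⇒0≤sub u l v le = subst (0ℚ ℚ.≤_) (sym (eval-sub u l v)) (0≤difference le)

    bounds⇒ : ∀ (v : Fin n → ℚ) ls us → v ⊨ concatMap (λ u → map (subForm u) (zeroForm ∷ ls)) us →
      All (λ u → maxEval v ls ℚ.≤ eval u v) us
    bounds⇒ v ls [] _ = []
    bounds⇒ v ls (u ∷ us) h with AllP.++⁻ (map (subForm u) (zeroForm ∷ ls)) h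
    ... | p ∷ ps , rest = max-≤ {v = v} ls (subst (ℚ._≤ eval u v) (eval-zero v) (0≤sub⇒≤ u zeroForm v p))
      (All.map (λ {l} → 0≤sub⇒≤ u l v) (AllP.map⁻ ps)) ∷ bounds⇒ v ls us rest

    bounds⇐ : ∀ (v : Fin n → ℚ) ls us → All (λ u → maxEval v ls ℚ.≤ eval u v) us →
      v ⊨ concatMap (λ u → map (subForm u) (zeroForm ∷ ls)) us
    bounds⇐ v ls [] _ = []
    bounds⇐ v ls (u ∷ us) (p ∷ ps) with ≤-max {eval u v} {v} ls p
    ... | 0≤ , all = AllP.++⁺ (≤⇒0≤sub u zeroForm v (subst (ℚ._≤ eval u v) (sym (eval-zero v)) 0≤) ∷ AllP.map⁺ (All.map (λ {l} → ≤⇒0≤sub u l v) all)) (bounds⇐ v ls us ps)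

  0≤lowest : ∀ Σs v → 0ℚ ℚ.≤ lowest Σs v
  0≤lowest Σs v = proj₁ (≤-max {lowest Σs v} {v} (lowers Σs) ℚP.≤-refl)

  elim⇒lowest : ∀ Σs {v} → v ⊨ elim Σs → cons (lowest Σs v) v ⊨ Σs
  elim⇒lowest Σs {v} h with AllP.++⁻ (frees Σs) h
  ... | fs , bs = Solved⇒⊨ Σs (proj₂ (≤-max {lowest Σs v} {v} (lowers Σs) ℚP.≤-refl) , bounds⇒ v (lowers Σs) (uppers Σs) bs , fs)

  lowest-≤ : ∀ Σs {t v} → 0ℚ ℚ.≤ t → cons t v ⊨ Σs → lowest Σs v ℚ.≤ t
  lowest-≤ Σs {v = v} 0≤t h = max-≤ {v = v} (lowers Σs) 0≤t (proj₁ (⊨⇒Solved Σs h))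

  ⊨⇒elim : ∀ Σs {t v} → 0ℚ ℚ.≤ t → cons t v ⊨ Σs → v ⊨ elim Σs
  ⊨⇒elim Σs {t} {v} 0≤t h with ⊨⇒Solved Σs h
  ... | ls , us , fs = AllP.++⁺ fs (bounds⇐ v (lowers Σs) (uppers Σs) (All.map (ℚP.≤-trans (lowest-≤ Σs 0≤t h)) us))

  between : ∀ Σs {s t v} → lowest Σs v ℚ.≤ s → s ℚ.≤ t → cons t v ⊨ Σs → cons s v ⊨ Σs
  between Σs {s} {t} {v} lo≤s s≤t h with ⊨⇒Solved Σs h
  ... | _ , us , fs = Solved⇒⊨ Σs (proj₂ (≤-max {s} {v} (lowers Σs) lo≤s) , All.map (ℚP.≤-trans s≤t) us , fs)

  private
    below-threshold : ∀ c (us : List (Form n)) v → ∃[ τ ] (τ ℚ.< c × All (λ u → eval u v ℚ.< c → eval u v ℚ.≤ τ) us)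
    -- With no upper bounds to avoid, any number below `c` serves.
    below-threshold c [] v = c ℚ.- 1ℚ , subst (c ℚ.- 1ℚ ℚ.<_) (ℚP.+-identityʳ c) (ℚP.+-monoʳ-< c (ℚP.neg-antimono-< (ℚP.positive⁻¹ 1ℚ))) , []
    below-threshold c (u ∷ us) v with below-threshold c us v | eval u v ℚP.<? c
    ... | τ , τ<c , all | no ¬lt = τ , τ<c , (λ lt → contradiction lt ¬lt) ∷ all
    ... | τ , τ<c , all | yes lt = eval u v ℚ.⊔ τ , ⊔-< lt τ<c , (λ _ → ℚP.p≤p⊔q (eval u v) τ)
          ∷ All.map (λ f l → ℚP.≤-trans (f l) (ℚP.p≤q⊔p (eval u v) τ)) all

  -- Passing from `t` up to `c` can break only upper bounds. Finitely many of these lie below `c`,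
  -- so a `τ` below `c` can be chosen above or at all of them, and a point right of `τ` would
  -- already have violated them.
  left-limit : ∀ Σs v c → ∃[ τ ] (τ ℚ.< c × (∀ {t} → τ ℚ.< t → t ℚ.≤ c → 0ℚ ℚ.≤ t → cons t v ⊨ Σs → cons c v ⊨ Σs))
  left-limit Σs v c with below-threshold c (uppers Σs) v
  ... | τ , τ<c , small = τ , τ<c , λ {t} τ<t t≤c 0≤t h → let (ls , us , fs) = ⊨⇒Solved Σs h in
    Solved⇒⊨ Σs (All.map (λ p → ℚP.≤-trans p t≤c) ls , All.zipWith (λ (t≤u , sm) → ℚP.≮⇒≥ λ u<c → ≤ℚ⇒≯ t≤u (ℚP.≤-<-trans (sm u<c) τ<t)) (us , small) , fs)

-- Nonemptiness as an additive functional on systems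

module ℤSums = AbelianSums ℤP.+-0-abelianGroup

gate : ∀ {P : Set} → Dec P → ℤ → ℤ
gate d a = if does d then a else 0ℤ

gate-yes : ∀ {P : Set} (d : Dec P) {a} → P → gate d a ≡ a
gate-yes (yes _) _ = refl
gate-yes (no ¬p) p = contradiction p ¬p

gate-no : ∀ {P : Set} (d : Dec P) {a} → ¬ P → gate d a ≡ 0ℤ
gate-no (yes p) ¬p = contradiction p ¬p
gate-no (no _)  _  = refl

gate-⇔ : ∀ {P Q : Set} (d : Dec P) (e : Dec Q) {a} → (P → Q) → (Q → P) → gate d a ≡ gate e a
gate-⇔ (yes p) e f g = sym (gate-yes e (f p))
gate-⇔ (no ¬p) e f g = sym (gate-no e (¬p ∘ g))

•-1 : ∀ a → a ℤSums.• 1ℤ ≡ a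
•-1 a = trans (identity a) (ℤP.*-identityʳ a)
  where
  ×-1 : ∀ m → _×ₙ_ ℤP.+-0-abelianGroup m 1ℤ ≡ pos m
  ×-1 zero    = refl
  ×-1 (suc m) = cong (ℤ._+_ 1ℤ) (×-1 m)
  identity : ∀ a → a ℤSums.• 1ℤ ≡ a ℤ.* 1ℤ
  identity (pos m)    = trans (×-1 m) (sym (ℤP.*-identityʳ (pos m)))
  identity (-[1+ m ]) = trans (cong ℤ.-_ (×-1 (suc m))) (sym (ℤP.*-identityʳ -[1+ m ]))

module _ {X : Set} (xs : List X) (a : X → ℤ) where

  -- The sum over the fibre of the least element over c is the jump at c, from the left, of the
  -- function t ↦ Σ a x [t ∈ Iₓ].
  module _ {n : ℕ} (S : X → System (suc n)) (v : Fin n → ℚ)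
           (cancels : ∀ t → sumℤ (map (λ x → gate (cons t v ⊨? S x) (a x)) xs) ≡ 0ℤ) where
    private
      Member : X → ℚ → Set
      Member x t = 0ℚ ℚ.≤ t × cons t v ⊨ S x

      member? : ∀ x t → Dec (Member x t)
      member? x t = (0ℚ ℚP.≤? t) ×-dec (cons t v ⊨? S x)

      low : X → ℚ
      low x = lowest (S x) v

      member-sum : ∀ t → sumℤ (map (λ x → gate (member? x t) (a x)) xs) ≡ 0ℤ
      member-sum t = by-sign (0ℚ ℚP.≤? t)
        where
        by-sign : Dec (0ℚ ℚ.≤ t) → sumℤ (map (λ x → gate (member? x t) (a x)) xs) ≡ 0ℤ
        by-sign (yes 0≤t) = trans (ℤSums.∑-cong xs λ x → gate-⇔ (member? x t) (cons t v ⊨? S x) proj₂ (0≤t ,_)) (cancels t)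
        by-sign (no t<0)  = ℤSums.∑-ε xs λ {x} _ → gate-no (member? x t) (t<0 ∘ proj₁)

      -- No end of the interval of `x` lies strictly between `τ` and `c`. As `xs` is finite, one `τ`
      -- works for all its members, so a single `t` in the gap represents the left limit for the
      -- whole family.
      Near : ℚ → ℚ → X → Set
      Near c τ x = (∀ {t} → τ ℚ.< t → t ℚ.≤ c → Member x t → Member x c) × (low x ℚ.< c → low x ℚ.≤ τ)

      near-mono : ∀ {c τ τ′ x} → τ ℚ.≤ τ′ → Near c τ x → Near c τ′ x
      near-mono τ≤ (f , g) = (λ τ′<t → f (ℚP.≤-<-trans τ≤ τ′<t)) , λ lt → ℚP.≤-trans (g lt) τ≤

      near-one : ∀ c x → ∃[ τ ] (τ ℚ.< c × Near c τ x)
      near-one c x with left-limit (S x) v c | low x ℚP.<? c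
      ... | τ , τ<c , f | no ¬lt = τ , τ<c , (λ τ<t t≤c (0≤t , h) → ℚP.≤-trans 0≤t t≤c , f τ<t t≤c 0≤t h) , λ lt → contradiction lt ¬lt
      ... | τ , τ<c , f | yes lt = low x ℚ.⊔ τ , ⊔-< lt τ<c ,
        (λ lt t≤c (0≤t , h) → ℚP.≤-trans 0≤t t≤c , f (ℚP.≤-<-trans (ℚP.p≤q⊔p (low x) τ) lt) t≤c 0≤t h) , λ _ → ℚP.p≤p⊔q (low x) τ

      near-all : ∀ c (ys : List X) → ∃[ τ ] (τ ℚ.< c × All (Near c τ) ys)
      near-all c [] = c ℚ.- 1ℚ , subst (c ℚ.- 1ℚ ℚ.<_) (ℚP.+-identityʳ c) (ℚP.+-monoʳ-< c (ℚP.neg-antimono-< (ℚP.positive⁻¹ 1ℚ))) , []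
      near-all c (y ∷ ys) with near-one c y | near-all c ys
      ... | τ , τ<c , near | τ′ , τ′<c , nears = τ ℚ.⊔ τ′ , ⊔-< τ<c τ′<c ,
        near-mono {x = y} (ℚP.p≤p⊔q τ τ′) near ∷ All.map (λ {x} → near-mono {x = x} (ℚP.p≤q⊔p τ τ′)) nears

      in-elim : ∀ {x t} → Member x t → v ⊨ elim (S x)
      in-elim {x} (0≤t , h) = ⊨⇒elim (S x) 0≤t h

      low-≤ : ∀ {x t} → Member x t → low x ℚ.≤ t
      low-≤ {x} (0≤t , h) = lowest-≤ (S x) 0≤t h

      -- An interval starting at `c` contains `c` but not `t`. One starting later contains neither,
      -- and for one starting earlier `Near` makes membership at `t` and at `c` agree.
      jump : ∀ {c t τ} → τ ℚ.< t → t ℚ.< c → ∀ x → Near c τ x → (q : Dec (v ⊨ elim (S x))) → (e : Dec (low x ≡ c)) →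
        (if does e then gate q (a x) else 0ℤ) ≡ gate (member? x c) (a x) ℤ.+ ℤ.- gate (member? x t) (a x)
      jump {c} {t} τ<t t<c x near (no ¬q) e = trans (zero-if (does e))
        (sym (cong₂ (λ p q → p ℤ.+ ℤ.- q) (gate-no (member? x c) (¬q ∘ in-elim {x})) (gate-no (member? x t) (¬q ∘ in-elim {x}))))
        where
        zero-if : ∀ b → (if b then 0ℤ else 0ℤ) ≡ 0ℤ
        zero-if true  = refl
        zero-if false = refl
      jump {c} {t} τ<t t<c x near (yes q) (yes refl) = trans (sym (ℤP.+-identityʳ (a x)))
        (sym (cong₂ (λ p q → p ℤ.+ ℤ.- q) (gate-yes (member? x c) (0≤lowest (S x) v , elim⇒lowest (S x) q))
          (gate-no (member? x t) λ m → ≤ℚ⇒≯ (low-≤ {x} m) t<c)))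
      jump {c} {t} τ<t t<c x (left , lows) (yes q) (no lo≢c) with low x ℚP.<? c
      ... | no ¬lt = sym (cong₂ (λ p q → p ℤ.+ ℤ.- q) (gate-no (member? x c) λ m → lo≢c (ℚP.≤-antisym (low-≤ {x} m) (ℚP.≮⇒≥ ¬lt)))
          (gate-no (member? x t) λ m → ≤ℚ⇒≯ (ℚP.≤-trans (ℚP.≮⇒≥ ¬lt) (low-≤ {x} m)) t<c))
      ... | yes lt = sym (trans (cong (ℤ._+ _) (gate-⇔ (member? x c) (member? x t)
          (λ (0≤c , h) → ℚP.≤-trans (0≤lowest (S x) v) lo≤t , between (S x) lo≤t (ℚP.<⇒≤ t<c) h) (left τ<t (ℚP.<⇒≤ t<c))))
          (ℤP.+-inverseʳ (gate (member? x t) (a x))))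
        where
        lo≤t : low x ℚ.≤ t
        lo≤t = ℚP.≤-trans (lows lt) (ℚP.<⇒≤ τ<t)

      fibre-sum : ∀ c → sumℤ (map (λ x → if does (low x ℚP.≟ c) then gate (v ⊨? elim (S x)) (a x) else 0ℤ) xs) ≡ 0ℤ
      fibre-sum c with near-all c xs
      ... | τ , τ<c , nears with ℚP.<-dense τ<c
      ...   | t , τ<t , t<c = begin
        ∑ xs (λ x → if does (low x ℚP.≟ c) then gate (v ⊨? elim (S x)) (a x) else 0ℤ)
          ≡⟨ ∑-cong-∈ xs (λ {x} x∈ → jump τ<t t<c x (All.lookup nears x∈) (v ⊨? elim (S x)) (low x ℚP.≟ c)) ⟩
        ∑ xs (λ x → gate (member? x c) (a x) ℤ.+ ℤ.- gate (member? x t) (a x))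
          ≡⟨ ∑-∙ xs (λ x → gate (member? x c) (a x)) (λ x → ℤ.- gate (member? x t) (a x)) ⟩
        ∑ xs (λ x → gate (member? x c) (a x)) ℤ.+ ∑ xs (λ x → ℤ.- gate (member? x t) (a x))
          ≡⟨ cong₂ ℤ._+_ (member-sum c) (trans (sym (∑-⁻¹ xs (λ x → gate (member? x t) (a x)))) (cong ℤ.-_ (member-sum t))) ⟩
        0ℤ ∎
        where
        open ≡-Reasoning
        open ℤSums

    -- The nonempty fibres are sorted by their least elements. Each class has weight zero by
    -- `fibre-sum`, so `∑-fibres` with the constant value 1 gives total weight zero.
    elim-cancels : sumℤ (map (λ x → gate (v ⊨? elim (S x)) (a x)) xs) ≡ 0ℤ
    elim-cancels = trans (sym (ℤSums.∑-cong xs λ x → •-1 (gate (v ⊨? elim (S x)) (a x))))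
      (ℤSums.∑-fibres ℚP._≟_ xs (λ x → gate (v ⊨? elim (S x)) (a x)) low (λ _ → 1ℤ) fibre-sum)

elimAll : ∀ {n} → System n → System 0
elimAll {zero}  S = S
elimAll {suc n} S = elimAll (elim S)

noVariables : Fin 0 → ℚ
noVariables ()

euler-characteristic : ∀ {X : Set} (xs : List X) (a : X → ℤ) {n} (S : X → System n) →
  (∀ v → sumℤ (map (λ x → gate (v ⊨? S x) (a x)) xs) ≡ 0ℤ) →
  sumℤ (map (λ x → gate (noVariables ⊨? elimAll (S x)) (a x)) xs) ≡ 0ℤ
euler-characteristic xs a {zero}  S cancels = cancels noVariables
euler-characteristic xs a {suc n} S cancels =
  euler-characteristic xs a (elim ∘ S) λ v → elim-cancels xs a S v λ t → cancels (cons t v)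

⊨-cong : ∀ {n} {S : System n} {u v} → (∀ j → u j ≡ v j) → u ⊨ S → v ⊨ S
⊨-cong {v = v} e = All.map λ {φ} → subst (0ℚ ℚ.≤_) (cong (ℚ._+ proj₂ φ) (dot-cong (proj₁ φ) e))

cons-η : ∀ {n} (v : Fin (suc n) → ℚ) j → v j ≡ cons (v zero) (v ∘ suc) j
cons-η v zero    = refl
cons-η v (suc j) = refl

elimAll⁺ : ∀ {n} (S : System n) {v} → (∀ j → 0ℚ ℚ.≤ v j) → v ⊨ S → noVariables ⊨ elimAll S
elimAll⁺ {zero}  S {v} 0≤v h = ⊨-cong {S = S} {u = v} {noVariables} (λ ()) h
elimAll⁺ {suc n} S {v} 0≤v h = elimAll⁺ (elim S) (0≤v ∘ suc) (⊨⇒elim S (0≤v zero) (⊨-cong (cons-η v) h))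

elimAll⁻ : ∀ {n} (S : System n) → noVariables ⊨ elimAll S → ∃[ v ] (v ⊨ S)
elimAll⁻ {zero}  S h = noVariables , h
elimAll⁻ {suc n} S h with elimAll⁻ (elim S) h
... | v , h′ = cons (lowest S v) v , elim⇒lowest S h′

append : ∀ {m n} → (Fin m → ℚ) → (Fin n → ℚ) → Fin (m + n) → ℚ
append {zero}  l x = x
append {suc m} l x = cons (l zero) (append (l ∘ suc) x)

elimFirst : ∀ m {n} → System (m + n) → System n
elimFirst zero    S = S
elimFirst (suc m) S = elimFirst m (elim S)

elimFirst⁺ : ∀ m {n} (S : System (m + n)) {l x} → (∀ i → 0ℚ ℚ.≤ l i) → append l x ⊨ S → x ⊨ elimFirst m S
elimFirst⁺ zero    S 0≤l h = h
elimFirst⁺ (suc m) S {l} 0≤l h = elimFirst⁺ m (elim S) (0≤l ∘ suc) (⊨⇒elim S (0≤l zero) h)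

elimFirst⁻ : ∀ m {n} (S : System (m + n)) {x} → x ⊨ elimFirst m S → ∃[ l ] ((∀ i → 0ℚ ℚ.≤ l i) × append l x ⊨ S)
elimFirst⁻ zero    S h = (λ ()) , (λ ()) , h
elimFirst⁻ (suc m) S {x} h with elimFirst⁻ m (elim S) h
... | l , 0≤l , h′ = cons (lowest S (append l x)) l , (λ { zero → 0≤lowest S (append l x) ; (suc i) → 0≤l i }) , elim⇒lowest S h′

dot-append : ∀ {m n} (a l : Fin m → ℚ) (b x : Fin n → ℚ) → dot (append a b) (append l x) ≡ dot a l ℚ.+ dot b x
dot-append {zero}  a l b x = sym (ℚP.+-identityˡ _)
dot-append {suc m} a l b x = trans (cong (a zero ℚ.* l zero ℚ.+_) (dot-append (a ∘ suc) (l ∘ suc) b x)) (sym (ℚP.+-assoc (a zero ℚ.* l zero) (dot (a ∘ suc) (l ∘ suc)) (dot b x)))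

-- Base polytopes and their slices as linear systems

module _ {n : ℕ} where
  private
    unit : ∀ {n} → Fin n → Fin n → ℚ
    unit i j = indicator (does (i Fin.≟ j))

    dot-unit : ∀ {n} (i : Fin n) x → dot (unit i) x ≡ x i
    dot-unit zero x = trans (cong₂ ℚ._+_ (ℚP.*-identityˡ (x zero)) (dot-zeroˡ (x ∘ suc))) (ℚP.+-identityʳ (x zero))
    dot-unit (suc i) x = trans (cong₂ ℚ._+_ (ℚP.*-zeroˡ (x zero)) (trans (dot-congˡ same (x ∘ suc)) (dot-unit i (x ∘ suc)))) (ℚP.+-identityˡ _)
      where
      same : ∀ j → unit (suc i) (suc j) ≡ unit i j
      same j with i Fin.≟ j
      ... | yes _ = refl
      ... | no _  = refl
      dot-congˡ : ∀ {m} {u w : Fin m → ℚ} → (∀ j → u j ≡ w j) → ∀ x → dot u x ≡ dot w x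
      dot-congˡ {zero}  e x = refl
      dot-congˡ {suc m} e x = cong₂ (λ p q → p ℚ.* x zero ℚ.+ q) (e zero) (dot-congˡ (e ∘ suc) (x ∘ suc))

    target : Fin (suc n) → Form n
    target zero    = (λ _ → 0ℚ) , 1ℚ
    target (suc j) = unit j , 0ℚ

    eval-target : ∀ j x → eval (target j) x ≡ homogenize x j
    eval-target zero    x = trans (cong (ℚ._+ 1ℚ) (dot-zeroˡ x)) (ℚP.+-identityˡ 1ℚ)
    eval-target (suc j) x = trans (ℚP.+-identityʳ _) (dot-unit j x)

    coefficients : (Bs : List (Subset n)) → Fin (suc n) → Fin (length Bs) → ℚ
    coefficients Bs j i = vertex (List.lookup Bs i) j

    left-form right-form : (Bs : List (Subset n)) → Fin (suc n) → Form (length Bs + n)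
    left-form  Bs j = append (coefficients Bs j) (λ _ → 0ℚ) , 0ℚ
    right-form Bs j = append (λ _ → 0ℚ) (proj₁ (target j)) , proj₂ (target j)

    eval-left : ∀ Bs j l x → eval (left-form Bs j) (append l x) ≡ dot (coefficients Bs j) l
    eval-left Bs j l x = trans (ℚP.+-identityʳ _) (trans (dot-append (coefficients Bs j) l (λ _ → 0ℚ) x)
      (trans (cong (dot (coefficients Bs j) l ℚ.+_) (dot-zeroˡ x)) (ℚP.+-identityʳ _)))

    eval-right : ∀ Bs j l x → eval (right-form Bs j) (append l x) ≡ homogenize x j
    eval-right Bs j l x = trans (cong (ℚ._+ proj₂ (target j)) (trans (dot-append {length Bs} (λ _ → 0ℚ) l (proj₁ (target j)) x)
      (trans (cong (ℚ._+ dot (proj₁ (target j)) x) (dot-zeroˡ l)) (ℚP.+-identityˡ (dot (proj₁ (target j)) x))))) (eval-target j x)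

    -- The leading `length Bs` variables are vertex weights, the others the coordinates of the
    -- point. Each of the `suc n` equations becomes two opposite inequalities; nonnegativity of the
    -- weights is supplied by the elimination itself.
    weightSystem : (Bs : List (Subset n)) → System (length Bs + n)
    weightSystem Bs = concatMap (λ j → subForm (left-form Bs j) (right-form Bs j) ∷ subForm (right-form Bs j) (left-form Bs j) ∷ []) (allFin (suc n))

    equal⇒⊨ : ∀ Bs {l x} → (∀ j → dot (coefficients Bs j) l ≡ homogenize x j) → append l x ⊨ weightSystem Bs
    equal⇒⊨ Bs {l} {x} e = go (allFin (suc n))
      where
      vanish : ∀ φ ψ {y z} → eval φ (append l x) ≡ y → eval ψ (append l x) ≡ z → y ≡ z → 0ℚ ℚ.≤ eval (subForm φ ψ) (append l x)
      vanish φ ψ refl refl eq = ℚP.≤-reflexive (sym (trans (eval-sub φ ψ (append l x)) (trans (cong (ℚ._- eval ψ (append l x)) eq) (ℚP.+-inverseʳ (eval ψ (append l x))))))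
      go : ∀ js → append l x ⊨ concatMap (λ j → subForm (left-form Bs j) (right-form Bs j) ∷ subForm (right-form Bs j) (left-form Bs j) ∷ []) js
      go []       = []
      go (j ∷ js) = vanish (left-form Bs j) (right-form Bs j) (eval-left Bs j l x) (eval-right Bs j l x) (e j)
        ∷ vanish (right-form Bs j) (left-form Bs j) (eval-right Bs j l x) (eval-left Bs j l x) (sym (e j)) ∷ go js

    ⊨⇒equal : ∀ Bs {l x} → append l x ⊨ weightSystem Bs → ∀ j → dot (coefficients Bs j) l ≡ homogenize x j
    ⊨⇒equal Bs {l} {x} h j = go (allFin (suc n)) h (MP.∈-allFin j)
      where
      ring : ∀ a b → a ≡ b ℚ.+ (a ℚ.- b)
      ring = RingSolver.solve-∀ ℚring
      half : ∀ φ ψ {y z} → eval φ (append l x) ≡ y → eval ψ (append l x) ≡ z → 0ℚ ℚ.≤ eval (subForm φ ψ) (append l x) → z ℚ.≤ y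
      half φ ψ refl refl le = ≤-by-difference (subst (0ℚ ℚ.≤_) (eval-sub φ ψ (append l x)) le) (ring (eval φ (append l x)) (eval ψ (append l x)))
      go : ∀ js → append l x ⊨ concatMap (λ j → subForm (left-form Bs j) (right-form Bs j) ∷ subForm (right-form Bs j) (left-form Bs j) ∷ []) js →
        j ∈ᴸ js → dot (coefficients Bs j) l ≡ homogenize x j
      go (j ∷ js) (p ∷ q ∷ _) (here refl) = ℚP.≤-antisym (half (right-form Bs j) (left-form Bs j) (eval-right Bs j l x) (eval-left Bs j l x) q)
        (half (left-form Bs j) (right-form Bs j) (eval-left Bs j l x) (eval-right Bs j l x) p)
      go (_ ∷ js) (_ ∷ _ ∷ h) (there j∈) = go js h j∈

    coefficients⇒hull : ∀ {Q : Subset n → Set} Bs l → (∀ i → 0ℚ ℚ.≤ l i) → (∀ {B} → B ∈ᴸ Bs → Q B) → Hull Q (λ j → dot (coefficients Bs j) l)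
    coefficients⇒hull []       l 0≤l q = none λ _ → refl
    coefficients⇒hull (B ∷ Bs) l 0≤l q = point (l zero) B (0≤l zero) (q (here refl)) (coefficients⇒hull Bs (l ∘ suc) (0≤l ∘ suc) (q ∘ there))
      λ j → cong (ℚ._+ dot (coefficients Bs j) (l ∘ suc)) (ℚP.*-comm (vertex B j) (l zero))

    hull⇒coefficients : ∀ Bs {v} → Hull (_∈ᴸ Bs) v → ∃[ l ] ((∀ i → 0ℚ ℚ.≤ l i) × (∀ j → dot (coefficients Bs j) l ≡ v j))
    hull⇒coefficients Bs (none z) = (λ _ → 0ℚ) , (λ _ → ℚP.≤-refl) , λ j → trans (dot-zero (coefficients Bs j) (λ _ → refl)) (sym (z j))
    hull⇒coefficients Bs (point {u} {v} c B 0≤c B∈ h f) with hull⇒coefficients Bs h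
    ... | l , 0≤l , e = (λ i → c ℚ.* unit i₀ i ℚ.+ l i) , (λ i → 0≤+ (0≤* 0≤c (0≤unit i)) (0≤l i)) , correct
      where
      i₀ : Fin (length Bs)
      i₀ = Any.index B∈
      0≤unit : ∀ i → 0ℚ ℚ.≤ unit i₀ i
      0≤unit i with i₀ Fin.≟ i
      ... | yes _ = 0≤1
      ... | no _  = ℚP.≤-refl
      dot-comm : ∀ {m} (u w : Fin m → ℚ) → dot u w ≡ dot w u
      dot-comm {zero}  u w = refl
      dot-comm {suc m} u w = cong₂ ℚ._+_ (ℚP.*-comm (u zero) (w zero)) (dot-comm (u ∘ suc) (w ∘ suc))
      at-i₀ : B ≡ List.lookup Bs i₀
      at-i₀ = AnyP.lookup-index B∈
      correct : ∀ j → dot (coefficients Bs j) (λ i → c ℚ.* unit i₀ i ℚ.+ l i) ≡ v j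
      correct j = trans (dot-+ (coefficients Bs j) (λ i → c ℚ.* unit i₀ i) l) (trans (cong₂ ℚ._+_
        (trans (dot-* (coefficients Bs j) c (unit i₀)) (cong (c ℚ.*_) (trans (dot-comm (coefficients Bs j) (unit i₀)) (trans (dot-unit i₀ (coefficients Bs j)) (cong (λ C → vertex C j) (sym at-i₀))))))
        (e j)) (sym (f j)))

  -- Projecting away the weights leaves finitely many inequalities in the point alone. This decides
  -- membership in P(M), which yields the Boolean values demanded by `IndicatorsCancel`.
  polytopeSystem : Matroid n → System n
  polytopeSystem M = elimFirst (length (bases M)) (weightSystem (bases M))

  ⊨⇒hull : ∀ M {x} → x ⊨ polytopeSystem M → Hull (IsBase M) (homogenize x)
  ⊨⇒hull M {x} h with elimFirst⁻ (length (bases M)) (weightSystem (bases M)) h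
  ... | l , 0≤l , h′ = hull-cong (λ j → sym (⊨⇒equal (bases M) {l} {x} h′ j)) (coefficients⇒hull (bases M) l 0≤l id)

  hull⇒⊨ : ∀ M {x} → Hull (IsBase M) (homogenize x) → x ⊨ polytopeSystem M
  hull⇒⊨ M {x} h with hull⇒coefficients (bases M) h
  ... | l , 0≤l , e = elimFirst⁺ (length (bases M)) (weightSystem (bases M)) {l} {x} 0≤l (equal⇒⊨ (bases M) e)

  halfspaceForm : Subset n → ℕ → Form n
  halfspaceForm T r = indicator ∘ lookup T , ℚ.- fromℕ r

  slice : Subset n → ℕ → Matroid n → System n
  slice T r M = halfspaceForm T r ∷ polytopeSystem M

  -- The maximum of x(T) over P(M) is `rk M T`: it bounds all vertices and is attained at the vertex
  -- of an optimal basis. That vertex has nonnegative coordinates, as `elimAll⁺` requires.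
  slice-nonempty⇔ : ∀ T r M → (noVariables ⊨ elimAll (slice T r M)) ⇔ (r ≤ rk M T)
  slice-nonempty⇔ T r M = mk⇔ to from
    where
    to : noVariables ⊨ elimAll (slice T r M) → r ≤ rk M T
    to h with elimAll⁻ (slice T r M) h
    ... | x , p ∷ ps = fromℕ-cancel-≤ (≤-by-difference (0≤+ p (0≤difference
        (hull-dot-≤0 (plane T (rk M T) 0) (λ {B} B∈ → excess-≤0 T (rk M T) 0 {B} (rk-upper M T B∈)) (⊨⇒hull M ps))))
        (ring (fromℕ r) (fromℕ (rk M T)) (dot (indicator ∘ lookup T) x)))
      where
      ring : ∀ r k d → k ≡ r ℚ.+ (d ℚ.+ ℚ.- r ℚ.+ (0ℚ ℚ.- ((ℚ.- k) ℚ.* 1ℚ ℚ.+ d)))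
      ring = RingSolver.solve-∀ ℚring
    from : r ≤ rk M T → noVariables ⊨ elimAll (slice T r M)
    from le with rk-attained M T
    ... | B , B∈ , e = elimAll⁺ (slice T r M) {indicator ∘ lookup B} (λ j → 0≤indicator (lookup B j))
      (subst (λ z → 0ℚ ℚ.≤ z ℚ.- fromℕ r) (sym (trans (dot-indicators T B) (cong fromℕ e))) (0≤difference (fromℕ-mono le))
      ∷ hull⇒⊨ M (hull-cong (λ { zero → refl ; (suc j) → sym (ℚP.*-identityˡ _) }) (hull-vertex 1ℚ B 0≤1 B∈)))
      where
      0≤indicator : ∀ b → 0ℚ ℚ.≤ indicator b
      0≤indicator true  = 0≤1
      0≤indicator false = ℚP.≤-refl

  module _ (xs : List (ℤ × Matroid n)) (cancel : IndicatorsCancel xs) where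
    private
      polytope-cancels : ∀ x → sumℤ (map (λ aM → gate (x ⊨? polytopeSystem (proj₂ aM)) (proj₁ aM)) xs) ≡ 0ℤ
      polytope-cancels x = trans (cong sumℤ (zip-map xs)) (cancel x (map inside? xs) (values xs))
        where
        inside? : ℤ × Matroid n → Bool
        inside? aM = does (x ⊨? polytopeSystem (proj₂ aM))
        zip-map : ∀ ys → map (λ aM → gate (x ⊨? polytopeSystem (proj₂ aM)) (proj₁ aM)) ys ≡ zipWith (λ b aM → if b then proj₁ aM else 0ℤ) (map inside? ys) ys
        zip-map []       = refl
        zip-map (_ ∷ ys) = cong (_ ∷_) (zip-map ys)
        value : ∀ M → (does (x ⊨? polytopeSystem M) ≡ true) ⇔ (x ∈P M)
        value M with x ⊨? polytopeSystem M
        ... | yes h = mk⇔ (λ _ → hull⇒∈P {M = M} (⊨⇒hull M h)) (λ _ → refl)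
        ... | no ¬h = mk⇔ (λ ()) (λ x∈ → contradiction (hull⇒⊨ M (∈P⇒hull {M = M} x∈)) ¬h)
        values : ∀ ys → Pointwise (λ b aM → (b ≡ true) ⇔ (x ∈P proj₂ aM)) (map inside? ys) ys
        values []             = []
        values ((_ , M) ∷ ys) = value M ∷ values ys

      -- The half-space condition at `x` is the same for all matroids: if it fails, every term
      -- vanishes; if it holds, the slices may be replaced by the polytopes.
      slice-cancels : ∀ T r x → sumℤ (map (λ aM → gate (x ⊨? slice T r (proj₂ aM)) (proj₁ aM)) xs) ≡ 0ℤ
      slice-cancels T r x = by-sign (0ℚ ℚP.≤? eval (halfspaceForm T r) x)
        where
        by-sign : Dec (0ℚ ℚ.≤ eval (halfspaceForm T r) x) → sumℤ (map (λ aM → gate (x ⊨? slice T r (proj₂ aM)) (proj₁ aM)) xs) ≡ 0ℤ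
        by-sign (yes p) = trans (ℤSums.∑-cong xs λ aM →
          gate-⇔ (x ⊨? slice T r (proj₂ aM)) (x ⊨? polytopeSystem (proj₂ aM)) (λ { (_ ∷ h) → h }) (p ∷_)) (polytope-cancels x)
        by-sign (no ¬p) = ℤSums.∑-ε xs λ {aM} _ → gate-no (x ⊨? slice T r (proj₂ aM)) λ { (p ∷ _) → ¬p p }

    rk-≥-cancels : ∀ T r → sumℤ (map (λ aM → gate (r ≤? rk (proj₂ aM) T) (proj₁ aM)) xs) ≡ 0ℤ
    rk-≥-cancels T r = trans (cong sumℤ (LP.map-cong (λ aM → let iff = slice-nonempty⇔ T r (proj₂ aM) in
        gate-⇔ (r ≤? rk (proj₂ aM) T) (noVariables ⊨? elimAll (slice T r (proj₂ aM))) (Equivalence.from iff) (Equivalence.to iff)) xs))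
      (euler-characteristic xs proj₁ (λ aM → slice T r (proj₂ aM)) (slice-cancels T r))

    rk-cancels : ∀ T r → sumℤ (map (λ aM → if does (rk (proj₂ aM) T ≟ r) then proj₁ aM else 0ℤ) xs) ≡ 0ℤ
    rk-cancels T r = trans (ℤSums.∑-cong xs λ (a , M) → difference a (rk M T)) (trans (ℤSums.∑-∙ xs _ _)
      (cong₂ ℤ._+_ (rk-≥-cancels T r) (trans (sym (ℤSums.∑-⁻¹ xs _)) (cong ℤ.-_ (rk-≥-cancels T (suc r))))))
      where
      difference : ∀ a ρ → (if does (ρ ≟ r) then a else 0ℤ) ≡ gate (r ≤? ρ) a ℤ.+ ℤ.- gate (suc r ≤? ρ) a
      difference a ρ with <-cmp ρ r
      ... | tri< lt ρ≢r _ = trans (gate-no (ρ ≟ r) ρ≢r) (sym (cong₂ (λ p q → p ℤ.+ ℤ.- q) (gate-no (r ≤? ρ) (<⇒≱ lt)) (gate-no (suc r ≤? ρ) λ le → <⇒≱ lt (<⇒≤ le))))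
      ... | tri≈ _ refl _ = trans (gate-yes (ρ ≟ ρ) refl) (trans (sym (ℤP.+-identityʳ a)) (sym (cong₂ (λ p q → p ℤ.+ ℤ.- q) (gate-yes (ρ ≤? ρ) ≤-refl) (gate-no (suc ρ ≤? ρ) (<⇒≱ ≤-refl)))))
      ... | tri> _ ρ≢r gt = trans (gate-no (ρ ≟ r) ρ≢r) (trans (sym (ℤP.+-inverseʳ a)) (sym (cong₂ (λ p q → p ℤ.+ ℤ.- q) (gate-yes (r ≤? ρ) (<⇒≤ gt)) (gate-yes (suc r ≤? ρ) gt))))

-- In fixed rank `k`, the term of a subset `S` depends on the matroid only through `rk M S`. The
-- matroids with a given value of `rk M S` have total weight zero by `rk-cancels`.
tutte-valuative : ∀ n k → IsValuativeOn ℤ[x,y] tutte n k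
tutte-valuative n k xs ranks cancel = begin
  ∑ xs (λ aM → proj₁ aM • tutte (proj₂ aM))                                   ≈⟨ ∑-cong-∈ xs (λ {aM} aM∈ → expand aM aM∈) ⟩
  ∑ xs (λ aM → ∑ (allSubsets n) (λ S → proj₁ aM • term S (rk (proj₂ aM) S)))  ≈⟨ ∑-swap xs (allSubsets n) (λ aM S → proj₁ aM • term S (rk (proj₂ aM) S)) ⟩
  ∑ (allSubsets n) (λ S → ∑ xs (λ aM → proj₁ aM • term S (rk (proj₂ aM) S)))  ≈⟨ ∑-ε (allSubsets n) (λ {S} _ → ∑-fibres _≟_ xs proj₁ (λ aM → rk (proj₂ aM) S) (term S) (rk-cancels xs cancel S)) ⟩
  []                                                                          ∎
  where
  open AbelianSums ℤ[x,y]
  open SetoidReasoning (AbelianGroup.setoid ℤ[x,y])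
  term : Subset n → ℕ → Poly
  term S r = mulₚ (powₚ x-1 (k ∸ r)) (powₚ y-1 (∣ S ∣ ∸ r))
  expand : ∀ aM → aM ∈ᴸ xs → (proj₁ aM • tutte (proj₂ aM)) ≈ₚ ∑ (allSubsets n) (λ S → proj₁ aM • term S (rk (proj₂ aM) S))
  expand (a , M) aM∈ = AbelianGroup.trans ℤ[x,y]
    {a • tutte M} {a • ∑ (allSubsets n) (λ S → term S (rk M S))} {∑ (allSubsets n) (λ S → a • term S (rk M S))}
    (AbelianGroup.reflexive ℤ[x,y] (cong (λ ρ → a • ∑ (allSubsets n) (λ S → mulₚ (powₚ x-1 (ρ ∸ rk M S)) (powₚ y-1 (∣ S ∣ ∸ rk M S)))) (All.lookup ranks aM∈)))
    (∑-• a (allSubsets n) (λ S → term S (rk M S)))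

-- Isomorphisms

module _ {n : ℕ} (σ : Fin n ↔ Fin n) where
  private
    π π⁻¹ : Fin n → Fin n
    π   = Inverse.to σ
    π⁻¹ = Inverse.from σ

    π-injective : Injective _≡_ _≡_ π
    π-injective {i} {j} e = trans (sym (Inverse.strictlyInverseʳ σ i)) (trans (cong π⁻¹ e) (Inverse.strictlyInverseʳ σ j))

  ∣image-perm∣ : ∀ X → ∣ image π X ∣ ≡ ∣ X ∣
  ∣image-perm∣ = ∣image∣ π π-injective

  ∈-image-perm⁻ : ∀ X {i} → π i ∈ image π X → i ∈ X
  ∈-image-perm⁻ X πi∈ with ∈-image⁻ π X πi∈
  ... | j , j∈ , e = subst (_∈ X) (π-injective e) j∈

  image-∩ : ∀ X Y → image π (X ∩ Y) ≡ image π X ∩ image π Y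
  image-∩ X Y = SP.⊆-antisym to from
    where
    to : image π (X ∩ Y) ⊆ image π X ∩ image π Y
    to z∈ with ∈-image⁻ π (X ∩ Y) z∈
    ... | i , i∈ , refl with SP.x∈p∩q⁻ X Y i∈
    ...   | i∈X , i∈Y = SP.x∈p∩q⁺ (∈-image π X i∈X , ∈-image π Y i∈Y)
    from : image π X ∩ image π Y ⊆ image π (X ∩ Y)
    from z∈ with SP.x∈p∩q⁻ (image π X) (image π Y) z∈
    ... | z∈X , z∈Y with ∈-image⁻ π X z∈X
    ...   | i , i∈ , refl = ∈-image π (X ∩ Y) (SP.x∈p∩q⁺ (i∈ , ∈-image-perm⁻ Y z∈Y))

  ∣image∩image∣ : ∀ X Y → ∣ image π X ∩ image π Y ∣ ≡ ∣ X ∩ Y ∣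
  ∣image∩image∣ X Y = trans (cong ∣_∣ (sym (image-∩ X Y))) (∣image-perm∣ (X ∩ Y))

  image-inverse : ∀ X → image π (image π⁻¹ X) ≡ X
  image-inverse X = SP.⊆-antisym to from
    where
    to : image π (image π⁻¹ X) ⊆ X
    to z∈ with ∈-image⁻ π (image π⁻¹ X) z∈
    ... | i , i∈ , refl with ∈-image⁻ π⁻¹ X i∈
    ...   | j , j∈ , refl = subst (_∈ X) (sym (Inverse.strictlyInverseˡ σ j)) j∈
    from : X ⊆ image π (image π⁻¹ X)
    from {z} z∈ = subst (_∈ image π (image π⁻¹ X)) (Inverse.strictlyInverseˡ σ z) (∈-image π (image π⁻¹ X) (∈-image π⁻¹ X z∈))

  image-injective : ∀ {X Y} → image π X ≡ image π Y → X ≡ Y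
  image-injective {X} {Y} e = SP.⊆-antisym
    (λ i∈ → ∈-image-perm⁻ Y (subst (_ ∈_) e (∈-image π X i∈))) (λ i∈ → ∈-image-perm⁻ X (subst (_ ∈_) (sym e) (∈-image π Y i∈)))

  ∣image∩∁image∣ : ∀ X Y → ∣ image π X ∩ ∁ (image π Y) ∣ ≡ ∣ X ∩ ∁ Y ∣
  ∣image∩∁image∣ X Y = +-cancelˡ-≡ (∣ X ∩ Y ∣) _ _ (trans (cong (_+ ∣ image π X ∩ ∁ (image π Y) ∣) (sym (∣image∩image∣ X Y)))
    (trans (∣∩∁∣ (image π X) (image π Y)) (trans (∣image-perm∣ X) (sym (∣∩∁∣ X Y)))))

  allSubsets-image : map (image π) (allSubsets n) ↭ allSubsets n
  allSubsets-image = ∼bag⇒↭ (unique∧set⇒bag (UP.map⁺ image-injective (allSubsets-unique n)) (allSubsets-unique n) λ {X} →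
    mk⇔ (λ _ → allSubsets-complete X) (λ _ → subst (_∈ᴸ map (image π) (allSubsets n)) (image-inverse X) (MP.∈-map⁺ (image π) (allSubsets-complete (image π⁻¹ X)))))

  module _ {c ℓ : Level} (A : AbelianGroup c ℓ) where
    open AbelianGroup A using (Carrier; _≈_) renaming (sym to ≈-sym; trans to ≈-trans; reflexive to ≈-reflexive)
    open AbelianSums A

    ∑-image : ∀ (g : Subset n → Carrier) → ∑ (allSubsets n) g ≈ ∑ (allSubsets n) (g ∘ image π)
    ∑-image g = ≈-trans (≈-sym (∑-↭ allSubsets-image g)) (≈-reflexive (∑-map (image π) (allSubsets n) g))

  module _ (M N : Matroid n) (iso : ∀ B → IsBase M B ⇔ IsBase N (image π B)) where
    rk-iso : ∀ S → rk N (image π S) ≡ rk M S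
    rk-iso S with rk-attained M S
    ... | B , B∈ , e = rk-unique N (image π S) at-most
      (image π B , Equivalence.to (iso B) B∈ , ≤-reflexive (sym (trans (∣image∩image∣ B S) e)))
      where
      at-most : ∀ {B′} → IsBase N B′ → ∣ B′ ∩ image π S ∣ ≤ rk M S
      at-most {B′} B′∈ = subst (λ X → ∣ X ∩ image π S ∣ ≤ rk M S) (image-inverse B′) (≤-trans (≤-reflexive (∣image∩image∣ (image π⁻¹ B′) S))
        (rk-upper M S (Equivalence.from (iso (image π⁻¹ B′)) (subst (IsBase N) (sym (image-inverse B′)) B′∈))))

    rank-iso : rank N ≡ rank M
    rank-iso = trans (cong (rk N) (sym (SP.∣p∣≡n⇒p≡⊤ (trans (∣image-perm∣ Sub.⊤) (SP.∣⊤∣≡n n))))) (rk-iso Sub.⊤)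

    tutte-iso : tutte M ≈ₚ tutte N
    tutte-iso = ≈-sym {tutte N} {tutte M} (≈-trans {tutte N} {∑ (allSubsets n) (term N ∘ image π)} {tutte M} (∑-image ℤ[x,y] (term N))
      (∑-cong (allSubsets n) {term N ∘ image π} {term M} λ S → ≈-reflexive (same S)))
      where
      open AbelianGroup ℤ[x,y] using () renaming (sym to ≈-sym; trans to ≈-trans; reflexive to ≈-reflexive)
      open AbelianSums ℤ[x,y]
      term : Matroid n → Subset n → Poly
      term L S = mulₚ (powₚ x-1 (rank L ∸ rk L S)) (powₚ y-1 (∣ S ∣ ∸ rk L S))
      same : ∀ S → term N (image π S) ≡ term M S
      same S rewrite rank-iso | rk-iso S | ∣image-perm∣ S = refl

tutte-invariant : IsValuativeInvariant ℤ[x,y] tutte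
tutte-invariant = tutte-valuative , λ M N (σ , iso) → tutte-iso σ M N iso

-- Repeatedly transpose an element of F ∖ G with one of G ∖ F.
equicardinal⇒permuted : ∀ {n} (F G : Subset n) → ∣ F ∣ ≡ ∣ G ∣ → Σ (Fin n ↔ Fin n) λ σ → image (Inverse.to σ) F ≡ G
equicardinal⇒permuted {n} F G card = go _ F G ≤-refl card
  where
  image-id : ∀ (X : Subset n) → image id X ≡ X
  image-id X = SP.⊆-antisym (λ z∈ → let (i , i∈ , e) = ∈-image⁻ id X z∈ in subst (_∈ X) e i∈) (∈-image id X)

  image-∘ : ∀ (ρ τ : Fin n → Fin n) X → image (ρ ∘ τ) X ≡ image ρ (image τ X)
  image-∘ ρ τ X = SP.⊆-antisym to from
    where
    to : image (ρ ∘ τ) X ⊆ image ρ (image τ X)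
    to z∈ with ∈-image⁻ (ρ ∘ τ) X z∈
    ... | i , i∈ , refl = ∈-image ρ (image τ X) (∈-image τ X i∈)
    from : image ρ (image τ X) ⊆ image (ρ ∘ τ) X
    from z∈ with ∈-image⁻ ρ (image τ X) z∈
    ... | j , j∈ , refl with ∈-image⁻ τ X j∈
    ...   | i , i∈ , refl = ∈-image (ρ ∘ τ) X i∈

  image-transpose : ∀ (F : Subset n) {x y} → x ∈ F → y ∉ F → image (Inverse.to (Perm.transpose x y)) F ≡ exchangeAt F x y
  image-transpose F {x} {y} x∈ y∉ = ⊆∧∣≤∣⇒≡ sub (≤-reflexive (trans (∣exchangeAt∣ F x∈ y∉) (sym (∣image-perm∣ (Perm.transpose x y) F))))
    where
    sub : image (Inverse.to (Perm.transpose x y)) F ⊆ exchangeAt F x y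
    sub z∈ with ∈-image⁻ (Inverse.to (Perm.transpose x y)) F z∈
    ... | i , i∈ , refl with i Fin.≟ x
    ...   | yes refl = ∈-insert (delete F x) y
    ...   | no i≢x with i Fin.≟ y
    ...     | yes refl = contradiction i∈ y∉
    ...     | no i≢y   = ⊆-insert (delete F x) y (∈-delete F x i∈ i≢x)

  go : ∀ m F G → ∣ F ∩ ∁ G ∣ ≤ m → ∣ F ∣ ≡ ∣ G ∣ → Σ (Fin n ↔ Fin n) λ σ → image (Inverse.to σ) F ≡ G
  go m F G le card with FP.any? (λ x → (x SP.∈? F) ×-dec ¬? (x SP.∈? G))
  ... | no F⊆G = Perm.id , trans (image-id F) (⊆∧∣≤∣⇒≡ F⊆G′ (≤-reflexive (sym card)))
    where
    F⊆G′ : F ⊆ G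
    F⊆G′ {x} x∈ with x SP.∈? G
    ... | yes p = p
    ... | no x∉ = contradiction (x , x∈ , x∉) F⊆G
  ... | yes (x , x∈ , x∉) with ∣∩<∩∣⇒∃ F G (∁ F) (subst₂ _<_ (sym (trans (cong ∣_∣ (SP.∩-inverseʳ F)) (SP.∣⊥∣≡0 n))) refl 0<∣G∖F∣)
    where
    ∣F∩G∣<∣F∣ : ∣ F ∩ G ∣ < ∣ F ∣
    ∣F∩G∣<∣F∣ = SP.p⊂q⇒∣p∣<∣q∣ (SP.p∩q⊆p F G , x , x∈ , λ x∈∩ → x∉ (SP.p∩q⊆q F G x∈∩))
    0<∣G∖F∣ : 0 < ∣ G ∩ ∁ F ∣
    0<∣G∖F∣ = +-cancelˡ-< (∣ G ∩ F ∣) _ _ (subst₂ _<_ (trans (cong ∣_∣ (SP.∩-comm F G)) (sym (+-identityʳ _)))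
      (trans card (sym (∣∩∁∣ G F))) ∣F∩G∣<∣F∣)
  go zero F G le card | yes (x , x∈ , x∉) | _ = contradiction (≤-trans (∈⇒0<∣∣ (SP.x∈p∩q⁺ {p = F} {q = ∁ G} (x∈ , SP.x∉p⇒x∈∁p x∉))) le) λ ()
  go (suc m) F G le card | yes (x , x∈ , x∉) | y , y∈ , y∉ , _
    with go m (exchangeAt F x y) G (≤-pred (subst (_≤ suc m) (sym closer) le)) (trans (∣exchangeAt∣ F x∈ y∉) card)
    where
    closer : suc ∣ exchangeAt F x y ∩ ∁ G ∣ ≡ ∣ F ∩ ∁ G ∣
    closer = subst₂ (λ a b → a + ∣ exchangeAt F x y ∩ ∁ G ∣ ≡ b + ∣ F ∩ ∁ G ∣)
      (weight-∈ (SP.x∉p⇒x∈∁p x∉)) (weight-∉ (λ y∈∁ → SP.x∈∁p⇒x∉p y∈∁ y∈)) (∣exchangeAt∣∩ F (∁ G) x∈ y∉)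
  ... | σ , e = Perm._∘ₚ_ (Perm.transpose x y) σ ,
    trans (image-∘ (Inverse.to σ) (Inverse.to (Perm.transpose x y)) F) (trans (cong (image (Inverse.to σ)) (image-transpose F x∈ y∉)) e)

band-iso : ∀ {n} (F : Subset n) (σ : Fin n ↔ Fin n) a b k {B₀} → Band.InBand F a b k B₀ →
  Iso (Band.bandMatroid F a b k) (Band.bandMatroid (image (Inverse.to σ) F) a b k)
band-iso {n} F σ a b k {B₀} q₀ = σ , λ B → mk⇔
  (λ B∈ → G.InBand⇒base {image π B} (to {B} (F.base⇒InBand {B₀} q₀ {B} B∈)))
  (λ πB∈ → F.InBand⇒base {B} (from {B} (G.base⇒InBand {image π B₀} (to {B₀} q₀) {image π B} πB∈)))
  where
  π = Inverse.to σ
  module F = Band F a b k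
  module G = Band (image π F) a b k
  to : ∀ {B} → F.InBand B → G.InBand (image π B)
  to {B} (c , p , q) = trans (∣image-perm∣ σ B) c , subst (a ≤_) (sym (∣image∩image∣ σ B F)) p , subst (_≤ b) (sym (∣image∩image∣ σ B F)) q
  from : ∀ {B} → G.InBand (image π B) → F.InBand B
  from {B} (c , p , q) = trans (sym (∣image-perm∣ σ B)) c , subst (a ≤_) (∣image∩image∣ σ B F) p , subst (_≤ b) (∣image∩image∣ σ B F) q

-- A standard subset of each size (truncated at `n`), at which quantities depending only on the size
-- of a subset are evaluated.
initial : ℕ → ∀ n → Subset n
initial h       zero    = []
initial zero    (suc n) = outside ∷ initial zero n
initial (suc h) (suc n) = inside ∷ initial h n

∣initial∣ : ∀ {h n} → h ≤ n → ∣ initial h n ∣ ≡ h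
∣initial∣ {zero}  {zero}  _       = refl
∣initial∣ {zero}  {suc n} _       = ∣initial∣ {zero} {n} z≤n
∣initial∣ {suc h} {suc n} (s≤s p) = cong suc (∣initial∣ p)

permuted-initial : ∀ {n} (F : Subset n) → Σ (Fin n ↔ Fin n) λ σ → image (Inverse.to σ) F ≡ initial ∣ F ∣ n
permuted-initial {n} F = equicardinal⇒permuted F (initial ∣ F ∣ n) (sym (∣initial∣ (SP.∣p∣≤n F)))

-- Linear functionals on ℤ[x,y]

_≟ᵖ_ : DecidableEquality (ℕ × ℕ)
(a , b) ≟ᵖ (i , j) = map′ (λ (p , q) → cong₂ _,_ p q) (λ { refl → refl , refl }) ((a ≟ i) ×-dec (b ≟ j))

module PolynomialEvaluation {c ℓ : Level} (A : AbelianGroup c ℓ) where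
  open AbelianGroup A using (Carrier; _≈_; _∙_; ε; _⁻¹; setoid; ∙-cong; ∙-congˡ; ∙-congʳ; identityˡ; identityʳ; assoc; comm; ⁻¹-cong; inverseʳ; commutativeMonoid; rawGroup)
    renaming (refl to ≈-refl; sym to ≈-sym; trans to ≈-trans; reflexive to ≈-reflexive)
  open AbelianGroupProperties A using (ε⁻¹≈ε; ⁻¹-involutive; ⁻¹-∙-comm; inverseˡ-unique)
  open CommutativeSemigroupProperties (CommutativeMonoid.commutativeSemigroup commutativeMonoid) using (interchange)
  open AbelianSums A
  open SetoidReasoning setoid

  Coefficients : Set c
  Coefficients = ℕ → ℕ → Carrier

  apply : Coefficients → Poly → Carrier
  apply Ψ p = ∑ p (λ (a , b , m) → m • Ψ a b)

  apply-++ : ∀ Ψ p q → apply Ψ (p ++ q) ≈ apply Ψ p ∙ apply Ψ q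
  apply-++ Ψ []      q = ≈-sym (identityˡ _)
  apply-++ Ψ (t ∷ p) q = ≈-trans (∙-congˡ (apply-++ Ψ p q)) (≈-sym (assoc _ _ _))

  apply-neg : ∀ Ψ p → apply Ψ (negₚ p) ≈ apply Ψ p ⁻¹
  apply-neg Ψ [] = ≈-sym ε⁻¹≈ε
  apply-neg Ψ ((a , b , m) ∷ p) = ≈-trans (∙-cong (•-neg m (Ψ a b)) (apply-neg Ψ p)) (⁻¹-∙-comm _ _)

  -- A `Poly` is an unreduced list of terms, so compatibility with `_≈ₚ_` needs an argument: grouped
  -- by exponent pair, the terms of each group have total coefficient zero.
  apply-null : ∀ Ψ p → p ≈ₚ [] → apply Ψ p ≈ ε
  apply-null Ψ p null = ∑-fibres _≟ᵖ_ p (λ (_ , _ , m) → m) (λ (a , b , _) → a , b) (λ (a , b) → Ψ a b)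
    λ (i , j) → trans (fibre p i j) (null i j)
    where
    fibre : ∀ p i j → sumℤ (map (λ (a , b , m) → if does ((a , b) ≟ᵖ (i , j)) then m else 0ℤ) p) ≡ coeff p i j
    fibre []                i j = refl
    fibre ((a , b , m) ∷ p) i j = cong (ℤ._+_ (termCoeff a b m i j)) (fibre p i j)

  apply-cong : ∀ Ψ p q → p ≈ₚ q → apply Ψ p ≈ apply Ψ q
  apply-cong Ψ p q p≈q = ≈-trans (inverseˡ-unique (apply Ψ p) (apply Ψ (negₚ q)) (≈-trans (≈-sym (apply-++ Ψ p (negₚ q)))
      (apply-null Ψ (p ++ negₚ q) (ℤ[x,y].trans {p ++ negₚ q} {q ++ negₚ q} {[]} (ℤ[x,y].∙-congʳ {negₚ q} {p} {q} p≈q) (ℤ[x,y].inverseʳ q)))))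
    (≈-trans (⁻¹-cong (apply-neg Ψ q)) (⁻¹-involutive _))
    where
    module ℤ[x,y] = AbelianGroup ℤ[x,y]

  apply-homomorphism : ∀ Ψ → GroupMorphisms.IsGroupHomomorphism (AbelianGroup.rawGroup ℤ[x,y]) rawGroup (apply Ψ)
  apply-homomorphism Ψ = record
    { isMonoidHomomorphism = record
      { isMagmaHomomorphism = record
        { isRelHomomorphism = record { cong = λ {p} {q} → apply-cong Ψ p q }
        ; homo = apply-++ Ψ }
      ; ε-homo = ≈-refl }
    ; ⁻¹-homo = apply-neg Ψ }

  apply-congˡ : ∀ {Ψ Φ} p → (∀ i j → Ψ i j ≈ Φ i j) → apply Ψ p ≈ apply Φ p
  apply-congˡ p e = ∑-cong p λ (a , b , m) → •-cong m (e a b)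

  apply-∙ : ∀ Ψ Φ p → apply (λ i j → Ψ i j ∙ Φ i j) p ≈ apply Ψ p ∙ apply Φ p
  apply-∙ Ψ Φ p = ≈-trans (∑-cong p λ (a , b , m) → •-distribˡ m (Ψ a b) (Φ a b)) (∑-∙ p _ _)

  shift : ℕ → ℕ → Coefficients → Coefficients
  shift i j Ψ a b = Ψ (i + a) (j + b)

  -- The coefficient table of the functional p ↦ Ψ(p q).
  _⋆_ : Coefficients → Poly → Coefficients
  (Ψ ⋆ q) i j = apply (shift i j Ψ) q

  apply-mul : ∀ Ψ p q → apply Ψ (mulₚ p q) ≈ apply (Ψ ⋆ q) p
  apply-mul Ψ [] q = ≈-refl
  apply-mul Ψ ((a , b , m) ∷ p) q =
    ≈-trans (apply-++ Ψ (map times q) (mulₚ p q)) (∙-cong (monomial q) (apply-mul Ψ p q))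
    where
    times : ℕ × ℕ × ℤ → ℕ × ℕ × ℤ
    times (a′ , b′ , m′) = a + a′ , b + b′ , m ℤ.* m′
    monomial : ∀ q → apply Ψ (map times q) ≈ m • apply (shift a b Ψ) q
    monomial [] = ≈-sym (•-ε m)
    monomial ((a′ , b′ , m′) ∷ q) =
      ≈-trans (∙-cong (•-assoc m m′ (Ψ (a + a′) (b + b′))) (monomial q)) (≈-sym (•-distribˡ m _ _))

  private
    difference : ∀ {x y z} → x ≈ y ∙ z → pos 1 • x ∙ (-[1+ 0 ] • y ∙ ε) ≈ z
    difference {x} {y} {z} e = begin
      (x ∙ ε) ∙ ((y ∙ ε) ⁻¹ ∙ ε)  ≈⟨ ∙-cong (identityʳ x) (≈-trans (identityʳ _) (⁻¹-cong (identityʳ y))) ⟩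
      x ∙ y ⁻¹                    ≈⟨ ∙-congʳ (≈-trans e (comm y z)) ⟩
      (z ∙ y) ∙ y ⁻¹              ≈⟨ assoc z y (y ⁻¹) ⟩
      z ∙ (y ∙ y ⁻¹)              ≈⟨ ∙-congˡ (inverseʳ y) ⟩
      z ∙ ε                       ≈⟨ identityʳ z ⟩
      z                           ∎

  -- Multiplication by x - 1 is adjoint to the forward difference in the first index. The hypothesis
  -- says, without inverses, that `Ψ′` is this difference of `Ψ`.
  apply-x-1 : ∀ {Ψ Ψ′} → (∀ i j → Ψ (suc i) j ≈ Ψ i j ∙ Ψ′ i j) → ∀ p → apply Ψ (mulₚ x-1 p) ≈ apply Ψ′ p
  apply-x-1 {Ψ} {Ψ′} e p = ≈-trans (apply-mul Ψ x-1 p) (difference (≈-trans (apply-congˡ p e) (apply-∙ Ψ Ψ′ p)))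

  apply-y-1 : ∀ {Ψ Ψ′} → (∀ i j → Ψ i (suc j) ≈ Ψ i j ∙ Ψ′ i j) → ∀ p → apply Ψ (mulₚ y-1 p) ≈ apply Ψ′ p
  apply-y-1 {Ψ} {Ψ′} e p = ≈-trans (apply-mul Ψ y-1 p) (difference (≈-trans (apply-congˡ p e) (apply-∙ Ψ Ψ′ p)))

  apply-x-1-pow : ∀ {Ψ Ψ′} → (∀ i j → Ψ (suc i) j ≈ Ψ i j ∙ Ψ′ i j) → ∀ a q →
    apply Ψ (mulₚ (powₚ x-1 (suc a)) q) ≈ apply Ψ′ (mulₚ (powₚ x-1 a) q)
  apply-x-1-pow {Ψ} {Ψ′} e a q = begin
    apply Ψ (mulₚ (mulₚ x-1 (powₚ x-1 a)) q)   ≈⟨ apply-mul Ψ (mulₚ x-1 (powₚ x-1 a)) q ⟩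
    apply (Ψ ⋆ q) (mulₚ x-1 (powₚ x-1 a))      ≈⟨ apply-x-1 {Ψ ⋆ q} {Ψ′ ⋆ q} (λ i j → ≈-trans (apply-congˡ q λ a b → e (i + a) (j + b))
                                                    (apply-∙ (shift i j Ψ) (shift i j Ψ′) q)) (powₚ x-1 a) ⟩
    apply (Ψ′ ⋆ q) (powₚ x-1 a)                ≈⟨ apply-mul Ψ′ (powₚ x-1 a) q ⟨
    apply Ψ′ (mulₚ (powₚ x-1 a) q)             ∎

  -- Newton interpolation: the functional taking (x − 1)ᵃ(y − 1)ᵇ to Γ a b takes xⁱyʲ to newton Γ i j.
  newton : Coefficients → Coefficients
  newton Γ zero    zero    = Γ 0 0
  newton Γ zero    (suc j) = newton Γ zero j ∙ newton (λ a b → Γ a (suc b)) zero j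
  newton Γ (suc i) j       = newton Γ i j ∙ newton (λ a b → Γ (suc a) b) i j

  -- `newton` recurses on the first index, so the difference equation in the second is definitional
  -- only at `i = 0`; beyond that it holds because the two differences commute.
  newton-y : ∀ Γ i j → newton Γ i (suc j) ≈ newton Γ i j ∙ newton (λ a b → Γ a (suc b)) i j
  newton-y Γ zero    j = ≈-refl
  newton-y Γ (suc i) j = ≈-trans (∙-cong (newton-y Γ i j) (newton-y (λ a b → Γ (suc a) b) i j)) (interchange _ _ _ _)

  apply-newton : ∀ Γ a b → apply (newton Γ) (mulₚ (powₚ x-1 a) (powₚ y-1 b)) ≈ Γ a b
  apply-newton Γ zero b = ≈-trans (apply-mul (newton Γ) (powₚ x-1 0) (powₚ y-1 b)) (≈-trans (identityʳ _) (≈-trans (identityʳ _) (y-powers Γ b)))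
    where
    y-powers : ∀ Γ b → apply (newton Γ) (powₚ y-1 b) ≈ Γ 0 b
    y-powers Γ zero    = ≈-trans (identityʳ _) (identityʳ _)
    y-powers Γ (suc b) = ≈-trans (apply-y-1 (newton-y Γ) (powₚ y-1 b)) (y-powers (λ a b → Γ a (suc b)) b)
  apply-newton Γ (suc a) b = ≈-trans (apply-x-1-pow {newton Γ} (λ i j → ≈-refl) a (powₚ y-1 b)) (apply-newton (λ a b → Γ (suc a) b) a b)

  apply-concat : ∀ Ψ {X : Set} (xs : List X) (t : X → Poly) → apply Ψ (concat (map t xs)) ≈ ∑ xs (λ x → apply Ψ (t x))
  apply-concat Ψ []       t = ≈-refl
  apply-concat Ψ (x ∷ xs) t = ≈-trans (apply-++ Ψ (t x) _) (∙-congˡ (apply-concat Ψ xs t))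

  -- A subset of rank r and size s contributes (x - 1)ᵃ(y - 1)ᵇ with a = k - r and b = s - r; the
  -- arguments of `H` decode r and s from a and b.
  rankSizeFunctional : ℕ → (ℕ → ℕ → Carrier) → Poly → Carrier
  rankSizeFunctional k H = apply (newton (λ a b → H (k ∸ a) (k ∸ a + b)))

  rankSizeFunctional-tutte : ∀ {n} (M : Matroid n) H →
    rankSizeFunctional (rank M) H (tutte M) ≈ ∑ (allSubsets n) (λ S → H (rk M S) ∣ S ∣)
  rankSizeFunctional-tutte {n} M H = ≈-trans (apply-concat _ (allSubsets n) _) (∑-cong (allSubsets n) λ S →
    ≈-trans (apply-newton _ (rank M ∸ rk M S) (∣ S ∣ ∸ rk M S)) (≈-reflexive (cong₂ H (m∸[m∸n]≡n (rk≤rank M S))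
      (trans (cong (_+ (∣ S ∣ ∸ rk M S)) (m∸[m∸n]≡n (rk≤rank M S))) (m+[n∸m]≡n (rk≤∣∣ M S))))))

-- Inverting the unitriangular system

module Inversion {c ℓ : Level} (A : AbelianGroup c ℓ) (n k : ℕ) (g : ℕ → ℕ → AbelianGroup.Carrier A) where
  open AbelianGroup A using (Carrier; _≈_; _∙_; ε; _⁻¹; setoid; ∙-congˡ; ∙-congʳ; identityˡ; identityʳ; assoc; ⁻¹-cong; inverseˡ)
    renaming (refl to ≈-refl; sym to ≈-sym; trans to ≈-trans; reflexive to ≈-reflexive)
  open AbelianSums A
  open SetoidReasoning setoid

  -- With `r` the rank of a proper cyclic flat F, `i = |S ∩ F|` and `o = |S ∖ F|`, this is the
  -- numerical form of "S is attached to F"; in an elementary split matroid such an S has rank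
  -- `r + o` and size `i + o`. Being purely numerical, it makes sense for the model subsets too,
  -- with no matroid at hand.
  Degenerate : ℕ → ℕ → ℕ → Set
  Degenerate r i o = r < i × r + o < k

  degenerate? : ∀ r i o → Dec (Degenerate r i o)
  degenerate? r i o = (r <? i) ×-dec (r + o <? k)

  restrict : ∀ {P : Set} → Dec P → Carrier → Carrier
  restrict d a = if does d then a else ε

  restrict-yes : ∀ {P : Set} (d : Dec P) {a} → P → restrict d a ≡ a
  restrict-yes (yes _) _ = refl
  restrict-yes (no ¬p) p = contradiction p ¬p

  restrict-no : ∀ {P : Set} (d : Dec P) {a} → ¬ P → restrict d a ≡ ε
  restrict-no (yes p) ¬p = contradiction p ¬p
  restrict-no (no _)  _  = refl

  restrict-cong : ∀ {P : Set} (d : Dec P) {a b} → (P → a ≈ b) → restrict d a ≈ restrict d b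
  restrict-cong (yes p) e = e p
  restrict-cong (no _)  e = ≈-refl

  private
    Other : ℕ → ℕ → Subset n → Set
    Other r h S = S ≢ initial h n × Degenerate r ∣ S ∩ initial h n ∣ ∣ S ∩ ∁ (initial h n) ∣

    other? : ∀ r h S → Dec (Other r h S)
    other? r h S = ¬? (S ≟ˢ initial h n) ×-dec degenerate? r ∣ S ∩ initial h n ∣ ∣ S ∩ ∁ (initial h n) ∣

    -- Fuel-indexed back substitution in the system Σ_S contribution r |S ∩ F| |S ∖ F| = g r |F|: the term S = F
    -- is solution r |F| itself, and every other term has larger rank or the same rank and smaller size.
    approx : ℕ → ℕ → ℕ → Carrier
    approx zero    r h = ε
    approx (suc m) r h = g r h ∙ ∑ (allSubsets n) (λ S → restrict (other? r h S) (approx m (r + ∣ S ∩ ∁ (initial h n) ∣) ∣ S ∣)) ⁻¹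

    -- Lexicographic order on `k ∸ r` and the size; the factor `suc n` exceeds every size. The
    -- condition `r + o < k` in `Degenerate` makes the truncated difference strictly decrease when
    -- `o` is positive.
    measure : ℕ → ℕ → ℕ
    measure r h = (k ∸ r) * suc n + h

    measure-drops : ∀ r h S → h ≤ n → Other r h S → measure (r + ∣ S ∩ ∁ (initial h n) ∣) ∣ S ∣ < measure r h
    measure-drops r h S h≤n (S≢ , _ , r+o<k) with ∣ S ∩ ∁ (initial h n) ∣ in outside
    ... | zero = subst (λ x → measure x ∣ S ∣ < measure r h) (sym (+-identityʳ r)) (+-monoʳ-< ((k ∸ r) * suc n)
          (≰⇒> λ h≤∣S∣ → S≢ (⊆∧∣≤∣⇒≡ S⊆ (subst (_≤ ∣ S ∣) (sym (∣initial∣ h≤n)) h≤∣S∣))))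
      where
      S⊆ : S ⊆ initial h n
      S⊆ = ∣∩∣≡∣∣⇒⊆ S (initial h n) (≤-reflexive (trans (sym (∣∩∁∣ S (initial h n))) (trans (cong (∣ S ∩ initial h n ∣ +_) outside) (+-identityʳ _))))
    ... | suc o = ≤-trans (≤-trans (s≤s (+-monoʳ-≤ ((k ∸ (r + suc o)) * suc n) (SP.∣p∣≤n S))) (≤-trans (≤-reflexive (trans (sym (+-suc _ n)) (+-comm _ (suc n))))
          (*-monoˡ-≤ (suc n) (∸-monoʳ-< (m<m+n r (s≤s z≤n)) (<⇒≤ r+o<k))))) (m≤m+n _ h)

    approx-stable : ∀ m m′ r h → h ≤ n → measure r h < m → measure r h < m′ → approx m r h ≈ approx m′ r h
    approx-stable (suc m) (suc m′) r h h≤n lt lt′ = ∙-congˡ (⁻¹-cong (∑-cong (allSubsets n) λ S →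
      restrict-cong (other? r h S) λ o → let drop = measure-drops r h S h≤n o in
        approx-stable m m′ _ ∣ S ∣ (SP.∣p∣≤n S) (≤-trans drop (≤-pred lt)) (≤-trans drop (≤-pred lt′))))

    bound : ℕ
    bound = k * suc n + n

    measure≤bound : ∀ r {h} → h ≤ n → measure r h ≤ bound
    measure≤bound r h≤n = +-mono-≤ (*-monoˡ-≤ (suc n) (m∸n≤m k r)) h≤n

  solution : ℕ → ℕ → Carrier
  solution = approx (suc bound)

  contribution : ℕ → ℕ → ℕ → Carrier
  contribution r i o = restrict (degenerate? r i o) (solution (r + o) (i + o))

  private
    solution-eq : ∀ r h → h ≤ n →
      solution r h ≈ g r h ∙ ∑ (allSubsets n) (λ S → restrict (other? r h S) (solution (r + ∣ S ∩ ∁ (initial h n) ∣) ∣ S ∣)) ⁻¹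
    solution-eq r h h≤n = ∙-congˡ (⁻¹-cong (∑-cong (allSubsets n) λ S → restrict-cong (other? r h S) λ o →
      let lt = ≤-trans (measure-drops r h S h≤n o) (measure≤bound r h≤n) in
      approx-stable bound (suc bound) _ ∣ S ∣ (SP.∣p∣≤n S) lt (≤-trans lt (n≤1+n bound))))

  solution-initial : ∀ r h → h ≤ n → r < h → r < k →
    ∑ (allSubsets n) (λ S → contribution r ∣ S ∩ initial h n ∣ ∣ S ∩ ∁ (initial h n) ∣) ≈ g r h
  solution-initial r h h≤n r<h r<k = begin
    ∑ (allSubsets n) (λ S → contribution r ∣ S ∩ F ∣ ∣ S ∩ ∁ F ∣)
      ≈⟨ ∑-cong (allSubsets n) (λ S → divide S (S ≟ˢ F) (degenerate? r ∣ S ∩ F ∣ ∣ S ∩ ∁ F ∣)) ⟩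
    ∑ (allSubsets n) (λ S → restrict (S ≟ˢ F) (solution r h) ∙ others S)
      ≈⟨ ∑-∙ (allSubsets n) _ _ ⟩
    ∑ (allSubsets n) (λ S → restrict (S ≟ˢ F) (solution r h)) ∙ ∑ (allSubsets n) others
      ≈⟨ ∙-congʳ (≈-trans (∑-sole _≟ˢ_ (allSubsets-unique n) (allSubsets-complete F) _ (λ {S} _ S≢F → ≈-reflexive (restrict-no (S ≟ˢ F) S≢F))) (≈-reflexive (restrict-yes (F ≟ˢ F) refl))) ⟩
    solution r h ∙ ∑ (allSubsets n) others
      ≈⟨ ∙-congʳ (solution-eq r h h≤n) ⟩
    (g r h ∙ ∑ (allSubsets n) others ⁻¹) ∙ ∑ (allSubsets n) others
      ≈⟨ ≈-trans (assoc _ _ _) (≈-trans (∙-congˡ (inverseˡ _)) (identityʳ _)) ⟩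
    g r h ∎
    where
    F : Subset n
    F = initial h n
    others : Subset n → Carrier
    others S = restrict (other? r h S) (solution (r + ∣ S ∩ ∁ F ∣) ∣ S ∣)
    divide : ∀ S (e : Dec (S ≡ F)) (d : Dec (Degenerate r ∣ S ∩ F ∣ ∣ S ∩ ∁ F ∣)) →
      restrict d (solution (r + ∣ S ∩ ∁ F ∣) (∣ S ∩ F ∣ + ∣ S ∩ ∁ F ∣)) ≈
      restrict e (solution r h) ∙ restrict (¬? e ×-dec d) (solution (r + ∣ S ∩ ∁ F ∣) ∣ S ∣)
    divide S (no S≢F) (no _)  = ≈-sym (identityˡ ε)
    divide S (no S≢F) (yes _) = ≈-trans (≈-reflexive (cong (solution (r + ∣ S ∩ ∁ F ∣)) (∣∩∁∣ S F))) (≈-sym (identityˡ _))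
    divide S (yes refl) d = ≈-trans (≈-reflexive (trans (restrict-yes d (subst (r <_) (sym inner) r<h , subst (λ o → r + o < k) (sym outer) (subst (_< k) (sym (+-identityʳ r)) r<k)))
      (cong₂ solution (trans (cong (r +_) outer) (+-identityʳ r)) (trans (cong₂ _+_ inner outer) (+-identityʳ h))))) (≈-sym (identityʳ _))
      where
      inner : ∣ F ∩ F ∣ ≡ h
      inner = trans (cong ∣_∣ (SP.∩-idem F)) (∣initial∣ h≤n)
      outer : ∣ F ∩ ∁ F ∣ ≡ 0
      outer = trans (cong ∣_∣ (SP.∩-inverseʳ F)) (SP.∣⊥∣≡0 n)

  -- `contribution` sees `S` only through cardinalities, so a permutation carrying `F` to the model
  -- subset reindexes the sum.
  solution-sum : ∀ F r → r < ∣ F ∣ → r < k → ∑ (allSubsets n) (λ S → contribution r ∣ S ∩ F ∣ ∣ S ∩ ∁ F ∣) ≈ g r ∣ F ∣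
  solution-sum F r r<∣F∣ r<k with permuted-initial F
  ... | σ , e = begin
    ∑ (allSubsets n) (λ S → contribution r ∣ S ∩ F ∣ ∣ S ∩ ∁ F ∣)
      ≈⟨ ∑-cong (allSubsets n) (λ S → ≈-reflexive (cong₂ (contribution r)
           (trans (cong (λ X → ∣ π S ∩ X ∣) (sym e)) (∣image∩image∣ σ S F)) (trans (cong (λ X → ∣ π S ∩ ∁ X ∣) (sym e)) (∣image∩∁image∣ σ S F)))) ⟨
    ∑ (allSubsets n) (λ S → contribution r ∣ π S ∩ model ∣ ∣ π S ∩ ∁ model ∣)
      ≈⟨ ∑-image σ A (λ S → contribution r ∣ S ∩ model ∣ ∣ S ∩ ∁ model ∣) ⟨
    ∑ (allSubsets n) (λ S → contribution r ∣ S ∩ model ∣ ∣ S ∩ ∁ model ∣)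
      ≈⟨ solution-initial r ∣ F ∣ (SP.∣p∣≤n F) r<∣F∣ r<k ⟩
    g r ∣ F ∣ ∎
    where
    model : Subset n
    model = initial (∣ F ∣) n
    π : Subset n → Subset n
    π = image (Inverse.to σ)

-- Universality of the Tutte polynomial

module Universality {c ℓ : Level} (A : AbelianGroup c ℓ) (f : ∀ {m} → Matroid m → AbelianGroup.Carrier A)
  (inv : IsValuativeInvariant A f) (n : ℕ) where
  open AbelianGroup A using (Carrier; _≈_; _∙_; _⁻¹; setoid; ∙-cong; ⁻¹-cong)
    renaming (sym to ≈-sym; trans to ≈-trans; reflexive to ≈-reflexive)
  open AbelianSums A
  open PolynomialEvaluation A
  open SetoidReasoning setoid

  module _ (k : ℕ) where
    modelDefect : ℕ → ℕ → Carrier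
    modelDefect r h = f (splitMatroid (initial h n) r k) ∙ f (cuspidalMatroid (initial h n) r k) ⁻¹

    open Inversion A n k modelDefect public

    -- Size `n` singles out the ground set, so in a sum over all subsets the uniform term of the
    -- expansion is counted exactly once. The second part weights dependent nonspanning sets by the
    -- solved system.
    rankSizeWeight : ℕ → ℕ → Carrier
    rankSizeWeight r s = restrict (s ≟ n) (f (uniformMatroid n k)) ∙ restrict ((r <? s) ×-dec (r <? k)) (solution r s)

    functional : Poly → Carrier
    functional = rankSizeFunctional k rankSizeWeight

  module _ (M : Matroid n) (split : ElementarySplit M) where
    open Subdivision M split

    private
      k = rank M

      band-invariant : ∀ F a b {B} → Band.InBand F a b k B → f (Band.bandMatroid F a b k) ≈ f (Band.bandMatroid (initial (∣ F ∣) n) a b k)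
      band-invariant F a b {B} q with permuted-initial F
      ... | σ , e = ≈-trans (proj₂ inv _ _ (band-iso F σ a b k {B} q)) (≈-reflexive (cong (λ G → f (Band.bandMatroid G a b k)) e))

      defect-model : ∀ F → defect A f F (rk M F) ≈ modelDefect k (rk M F) ∣ F ∣
      defect-model F = ∙-cong (band-invariant F (rk M F) (rk M F) {proj₁ (split-nonempty F)} (proj₂ (split-nonempty F)))
        (⁻¹-cong (band-invariant F (rk M F) n {proj₁ (cuspidal-nonempty F)} (proj₂ (cuspidal-nonempty F))))

      rk<∣flat∣ : ∀ {F} → F ∈ᴸ flats → rk M F < ∣ F ∣
      rk<∣flat∣ {F} F∈ with ∈flats⁻ F∈
      ... | _ , cyc , (e , e∈) , _ = ≤-trans (s≤s (≤-trans (cyc e e∈) (rk≤∣∣ M (delete F e))))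
        (SP.p⊂q⇒∣p∣<∣q∣ (delete-⊆ F e , e , e∈ , ∉-delete F e))

      rk-flat<rank : ∀ {F} → F ∈ᴸ flats → rk M F < k
      rk-flat<rank {F} F∈ with ∈flats⁻ F∈
      ... | flat , _ , _ , (d , d∉) = ≤-trans (flat d d∉) (rk≤rank M (insert F d))

      weightAt : Subset n → Subset n → Carrier
      weightAt S F = contribution k (rk M F) ∣ S ∩ F ∣ ∣ S ∩ ∁ F ∣

      degenerate⇒nonuniform : ∀ S F → Degenerate k (rk M F) ∣ S ∩ F ∣ ∣ S ∩ ∁ F ∣ → rk M S < ∣ S ∣ × rk M S < k
      degenerate⇒nonuniform S F (r<i , r+o<k) =
        ≤-trans (s≤s (rk≤rk+∣∖∣ M S F)) (≤-trans (+-monoˡ-< ∣ S ∩ ∁ F ∣ r<i) (≤-reflexive (∣∩∁∣ S F))) ,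
        ≤-trans (s≤s (rk≤rk+∣∖∣ M S F)) r+o<k

      -- Inside `S` one has |S ∩ F| + |S ∩ G| ≤ |S| + |F ∩ G|. Adding `∩-bound` and the two strict
      -- inequalities produces the same terms on both sides, with the smaller side ahead by two.
      not-both-degenerate : ∀ S {F G} → F ∈ᴸ flats → G ∈ᴸ flats → F ≢ G → rk M G < ∣ S ∩ G ∣ → ¬ Degenerate k (rk M F) ∣ S ∩ F ∣ ∣ S ∩ ∁ F ∣
      not-both-degenerate S {F} {G} F∈ G∈ F≢G r<i (_ , r+o<k) = 1+n≰n (≤-trans (n≤1+n _) (≤-trans (≤-reflexive
          (sym (rearrange (∣ S ∩ F ∣) (∣ S ∩ G ∣) (∣ F ∩ G ∣) k (rk M F) (rk M G) (∣ S ∩ ∁ F ∣))))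
        (+-mono-≤ (+-mono-≤ sharing (∩-bound F∈ G∈ F≢G)) (+-mono-≤ r+o<k r<i))))
        where
        sharing : ∣ S ∩ F ∣ + ∣ S ∩ G ∣ ≤ (∣ S ∩ F ∣ + ∣ S ∩ ∁ F ∣) + ∣ F ∩ G ∣
        sharing = ≤-trans (≤-reflexive (sym (∣∩∪∣+∣∩∩∣ S F G)))
          (+-mono-≤ (≤-trans (SP.∣p∩q∣≤∣p∣ S (F ∪ G)) (≤-reflexive (sym (∣∩∁∣ S F)))) (SP.∣p∩q∣≤∣q∣ S (F ∩ G)))
        rearrange : ∀ i j c k r s o → ((i + j) + (c + k)) + (suc (r + o) + suc s) ≡ suc (suc (((i + o) + c) + (r + s) + (k + j)))
        rearrange = solve-∀

      -- A degenerate flat makes `S` dependent and nonspanning. Conversely, the cyclic flat of such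
      -- an `S` is degenerate for it, excludes all others, and has a contribution depending only on
      -- `rk M S` and `∣ S ∣`.
      unique-flat : ∀ S → (d : Dec (rk M S < ∣ S ∣ × rk M S < k)) → ∑ flats (weightAt S) ≈ restrict k d (solution k (rk M S) ∣ S ∣)
      unique-flat S (no uniform) = ∑-ε flats λ {F} _ →
        ≈-reflexive (restrict-no k (degenerate? k (rk M F) ∣ S ∩ F ∣ ∣ S ∩ ∁ F ∣) (uniform ∘ degenerate⇒nonuniform S F))
      unique-flat S (yes (dependent , nonspanning)) with dependent⇒proper-cyclic-flat M S dependent nonspanning
      ... | F , p , rk≡ , r<i = ≈-trans
        (∑-sole _≟ˢ_ flats-unique (∈flats⁺ p) (weightAt S) λ {G} G∈ G≢F → ≈-reflexive
          (restrict-no k (degenerate? k (rk M G) ∣ S ∩ G ∣ ∣ S ∩ ∁ G ∣) (not-both-degenerate S G∈ (∈flats⁺ p) G≢F r<i)))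
        (≈-reflexive (trans (restrict-yes k (degenerate? k (rk M F) ∣ S ∩ F ∣ ∣ S ∩ ∁ F ∣) (r<i , subst (_< k) rk≡ nonspanning))
          (cong₂ (solution k) (sym rk≡) (∣∩∁∣ S F))))

      -- A double count of pairs (F, S): for fixed F the contributions add up to the defect of F, by
      -- the choice of `solution`; for fixed S at most one flat contributes, with a weight that the
      -- Tutte polynomial can see.
      defect-sum : ∑ flats (λ F → defect A f F (rk M F)) ≈
                   ∑ (allSubsets n) (λ S → restrict k ((rk M S <? ∣ S ∣) ×-dec (rk M S <? k)) (solution k (rk M S) ∣ S ∣))
      defect-sum = begin
        ∑ flats (λ F → defect A f F (rk M F))
          ≈⟨ ∑-cong flats defect-model ⟩
        ∑ flats (λ F → modelDefect k (rk M F) ∣ F ∣)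
          ≈⟨ ∑-cong-∈ flats (λ {F} F∈ → solution-sum k F (rk M F) (rk<∣flat∣ F∈) (rk-flat<rank F∈)) ⟨
        ∑ flats (λ F → ∑ (allSubsets n) (λ S → weightAt S F))
          ≈⟨ ∑-swap flats (allSubsets n) (λ F S → weightAt S F) ⟩
        ∑ (allSubsets n) (λ S → ∑ flats (weightAt S))
          ≈⟨ ∑-cong (allSubsets n) (λ S → unique-flat S ((rk M S <? ∣ S ∣) ×-dec (rk M S <? k))) ⟩
        ∑ (allSubsets n) (λ S → restrict k ((rk M S <? ∣ S ∣) ×-dec (rk M S <? k)) (solution k (rk M S) ∣ S ∣)) ∎

      uniform-sum : ∑ (allSubsets n) (λ S → restrict k (∣ S ∣ ≟ n) (f (uniformMatroid n k))) ≈ f (uniformMatroid n k)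
      uniform-sum = ≈-trans (∑-sole _≟ˢ_ (allSubsets-unique n) (allSubsets-complete Sub.⊤) _
          λ {S} _ S≢⊤ → ≈-reflexive (restrict-no k (∣ S ∣ ≟ n) (S≢⊤ ∘ SP.∣p∣≡n⇒p≡⊤)))
        (≈-reflexive (restrict-yes k (∣ Sub.⊤ {n} ∣ ≟ n) (SP.∣⊤∣≡n n)))

    functional-tutte : f M ≈ functional (rank M) (tutte M)
    functional-tutte = begin
      f M
        ≈⟨ valuative-expansion A f (proj₁ inv n k) ⟩
      f (uniformMatroid n k) ∙ ∑ flats (λ F → defect A f F (rk M F))
        ≈⟨ ∙-cong (≈-sym uniform-sum) defect-sum ⟩
      ∑ (allSubsets n) (λ S → restrict k (∣ S ∣ ≟ n) (f (uniformMatroid n k))) ∙ _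
        ≈⟨ ∑-∙ (allSubsets n) _ _ ⟨
      ∑ (allSubsets n) (λ S → rankSizeWeight k (rk M S) ∣ S ∣)
        ≈⟨ rankSizeFunctional-tutte M (rankSizeWeight k) ⟨
      functional k (tutte M) ∎

theoremB : IsValuativelyUniversalWithin ℤ[x,y] tutte ElementarySplit
theoremB = record
  { valuative = tutte-invariant
  ; universal = λ A f inv n k → let open Universality A f inv n in
      functional k , PolynomialEvaluation.apply-homomorphism A _ ,
      λ M split rank≡k → subst (λ k → AbelianGroup._≈_ A (f M) (functional k (tutte M))) rank≡k (functional-tutte M split) }
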